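{- As $s\to\infty$, $$\left(\sqrt{2}\ln 2-o(1)\right)2^{\frac{s}{2}}< r'_2(s)\leq \left\lceil\frac{13}{48}2^s\right\rceil.$$ That is, there is a function $\varepsilon(s)\to 0$ (as $s\to\infty$) such that for all sufficiently large integers $s$ one has $(\sqrt{2}\ln 2-\varepsilon(s))2^{s/2}<r'_2(s)\leq \lceil \frac{13}{48}2^s\rceil$.
   Context: All graphs are finite and simple. A threshold graph of order $s$ is an $s$-vertex graph that can be constructed from the one-vertex graph by repeatedly adding a new vertex that is either adjacent to all the previous vertices or nonadjacent to all the previous vertices. For a positive integer $s$, $r'_2(s)$ is the minimum integer $n$ such that every $n$-vertex graph contains a threshold graph of order $s$ as an induced subgraph. -}

module Defs where

open import Data.Bool.Base using (Bool; false)
open import Data.Fin.Base using (Fin; zero; suc)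
open import Data.Integer.Base as ℤ using (+_)
import Data.Integer.Properties as ℤ
open import Data.Nat.Base as ℕ using (ℕ; zero; suc)
import Data.Nat.Properties as ℕ
open import Data.Nat.Tactic.RingSolver using (solve-∀)
open import Data.Product using (Σ; Σ-syntax; ∃; ∃-syntax; _×_; _,_; proj₁; proj₂)
open import Data.Rational.Base as ℚ using (ℚ; 0ℚ; 1ℚ; ½)
import Data.Rational.Properties as ℚ
open import Data.Rational.Solver using (module +-*-Solver)
open import Data.Rational.Unnormalised.Base as ℚᵘ using (ℚᵘ; mkℚᵘ)
import Data.Rational.Unnormalised.Properties as ℚᵘ
open import Data.Sum.Base using (inj₁; inj₂)
open import Function.Base using (_∘_)
open import Function.Bundles using (_↣_; _↔_; Injection; Inverse)
open import Relation.Binary.PropositionalEquality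
open import Relation.Nullary using (yes; no)

------------------------------------------------------------------------
-- Graphs

record Graph (n : ℕ) : Set where
  field
    adj        : Fin n → Fin n → Bool
    adj-sym    : ∀ u v → adj u v ≡ adj v u
    adj-irrefl : ∀ v → adj v v ≡ false

open Graph public using (adj)

_≅_ : ∀ {m n} → Graph m → Graph n → Set
_≅_ {m} {n} G H =
  Σ[ f ∈ Fin m ↔ Fin n ]
    ∀ u v → adj G u v ≡ adj H (Inverse.to f u) (Inverse.to f v)

_ContainsInduced_ : ∀ {m n} → Graph n → Graph m → Set
_ContainsInduced_ {m} {n} G H =
  Σ[ f ∈ Fin m ↣ Fin n ]
    ∀ u v → adj H u v ≡ adj G (Injection.to f u) (Injection.to f v)

single : Graph 1
single = record
  { adj = λ _ _ → false ; adj-sym = λ _ _ → refl ; adj-irrefl = λ _ → refl }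

-- The new vertex is `zero`; it is adjacent to every old vertex if b = true
-- and to none if b = false.
addVertex : ∀ {n} → Bool → Graph n → Graph (suc n)
addVertex {n} b G = record { adj = a ; adj-sym = s ; adj-irrefl = i }
  where
  a : Fin (suc n) → Fin (suc n) → Bool
  a zero    zero    = false
  a zero    (suc _) = b
  a (suc _) zero    = b
  a (suc u) (suc v) = adj G u v

  s : ∀ u v → a u v ≡ a v u
  s zero    zero    = refl
  s zero    (suc _) = refl
  s (suc _) zero    = refl
  s (suc u) (suc v) = Graph.adj-sym G u v

  i : ∀ v → a v v ≡ false
  i zero    = refl
  i (suc v) = Graph.adj-irrefl G v

data Constructible : ∀ {n} → Graph n → Set where
  start : Constructible single
  grow  : ∀ {n} {G : Graph n} (b : Bool) →
          Constructible G → Constructible (addVertex b G)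

Threshold : ∀ {n} → Graph n → Set
Threshold {n} G = Σ[ H ∈ Graph n ] Constructible H × H ≅ G

Unavoidable : ℕ → ℕ → Set
Unavoidable s n =
  (G : Graph n) → Σ[ T ∈ Graph s ] Threshold T × G ContainsInduced T

IsMinimum : (ℕ → Set) → ℕ → Set
IsMinimum P n = P n × (∀ m → P m → n ℕ.≤ m)

-- "r'₂(s) is defined and equals r"; such an r is unique.
IsR'₂ : ℕ → ℕ → Set
IsR'₂ s r = IsMinimum (Unavoidable s) r

------------------------------------------------------------------------
-- Real numbers, as Cauchy sequences of rationals

IsCauchy : (ℕ → ℚ) → Set
IsCauchy x = ∀ ε → 0ℚ ℚ.< ε →
  ∃[ N ] ∀ m n → N ℕ.≤ m → N ℕ.≤ n → ℚ.∣ x m ℚ.- x n ∣ ℚ.< ε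

record ℝ : Set where
  constructor mkℝ
  field
    seq    : ℕ → ℚ
    cauchy : IsCauchy seq

open ℝ public

infix 4 _<ℝ_
infixl 6 _-ℝ_
infixl 7 _*ℝ_

-- The uniform gap δ makes this the strict order of the limits, not merely
-- eventual strict inequality of the terms.
_<ℝ_ : ℝ → ℝ → Set
x <ℝ y = ∃[ δ ] 0ℚ ℚ.< δ × ∃[ N ] (∀ n → N ℕ.≤ n → seq x n ℚ.+ δ ℚ.< seq y n)

½-pos : ∀ {ε} → 0ℚ ℚ.< ε → 0ℚ ℚ.< ½ ℚ.* ε
½-pos {ε} 0<ε =
  subst (ℚ._< ½ ℚ.* ε) (ℚ.*-zeroʳ ½) (ℚ.*-monoʳ-<-pos ½ 0<ε)

½+½ : ∀ ε → ½ ℚ.* ε ℚ.+ ½ ℚ.* ε ≡ ε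
½+½ ε = trans (sym (ℚ.*-distribʳ-+ ε ½ ½)) (ℚ.*-identityˡ ε)

∣-∣-lub : ∀ {p q} → p ℚ.≤ q → ℚ.- p ℚ.≤ q → ℚ.∣ p ∣ ℚ.≤ q
∣-∣-lub {p} p≤q -p≤q with ℚ.∣p∣≡p∨∣p∣≡-p p
... | inj₁ e = subst (ℚ._≤ _) (sym e) p≤q
... | inj₂ e = subst (ℚ._≤ _) (sym e) -p≤q

neg-sub : ∀ p q → ℚ.- (p ℚ.- q) ≡ q ℚ.- p
neg-sub = solve 2 (λ p q → :- (p :- q) := q :- p) refl
  where open +-*-Solver

∣-∣-swap : ∀ p q → ℚ.∣ p ℚ.- q ∣ ≡ ℚ.∣ q ℚ.- p ∣
∣-∣-swap p q = trans (sym (ℚ.∣-p∣≡∣p∣ (p ℚ.- q))) (cong ℚ.∣_∣ (neg-sub p q))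

≤+⇒-≤ : ∀ {p q r} → p ℚ.≤ q ℚ.+ r → p ℚ.- q ℚ.≤ r
≤+⇒-≤ {p} {q} {r} h =
  subst (p ℚ.- q ℚ.≤_) (eq q r) (ℚ.+-monoˡ-≤ (ℚ.- q) h)
  where
  open +-*-Solver
  eq : ∀ q r → (q ℚ.+ r) ℚ.- q ≡ r
  eq = solve 2 (λ q r → (q :+ r) :- q := r) refl

∣-∣-reverse : ∀ p q → ℚ.∣ ℚ.∣ p ∣ ℚ.- ℚ.∣ q ∣ ∣ ℚ.≤ ℚ.∣ p ℚ.- q ∣
∣-∣-reverse p q = ∣-∣-lub (half p q)
  (subst₂ ℚ._≤_ (sym (neg-sub ℚ.∣ p ∣ ℚ.∣ q ∣)) (∣-∣-swap q p) (half q p))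
  where
  open +-*-Solver
  eq : ∀ p q → q ℚ.+ (p ℚ.- q) ≡ p
  eq = solve 2 (λ p q → q :+ (p :- q) := p) refl
  half : ∀ p q → ℚ.∣ p ∣ ℚ.- ℚ.∣ q ∣ ℚ.≤ ℚ.∣ p ℚ.- q ∣
  half p q = ≤+⇒-≤ (subst (λ z → ℚ.∣ z ∣ ℚ.≤ ℚ.∣ q ∣ ℚ.+ ℚ.∣ p ℚ.- q ∣)
                     (eq p q) (ℚ.∣p+q∣≤∣p∣+∣q∣ q (p ℚ.- q)))

fromℚ : ℚ → ℝ
fromℚ q = mkℝ (λ _ → q) λ ε 0<ε → 0 , λ _ _ _ _ →
  subst (ℚ._< ε) (sym (cong ℚ.∣_∣ (ℚ.+-inverseʳ q))) 0<ε

fromℕ : ℕ → ℝ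
fromℕ n = fromℚ (+ n ℚ./ 1)

∣_∣ℝ : ℝ → ℝ
∣ x ∣ℝ = mkℝ (λ n → ℚ.∣ seq x n ∣) λ ε 0<ε →
  let (N , h) = cauchy x ε 0<ε in
  N , λ m n N≤m N≤n →
    ℚ.≤-<-trans (∣-∣-reverse (seq x m) (seq x n)) (h m n N≤m N≤n)

_-ℝ_ : ℝ → ℝ → ℝ
x -ℝ y = mkℝ (λ n → seq x n ℚ.- seq y n) λ ε 0<ε →
  let (M , h) = cauchy x (½ ℚ.* ε) (½-pos 0<ε)
      (N , k) = cauchy y (½ ℚ.* ε) (½-pos 0<ε)
  in M ℕ.⊔ N , λ m n ≤m ≤n →
    bound (seq x m) (seq y m) (seq x n) (seq y n)
      (h m n (ℕ.m⊔n≤o⇒m≤o M N ≤m) (ℕ.m⊔n≤o⇒m≤o M N ≤n))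
      (k m n (ℕ.m⊔n≤o⇒n≤o M N ≤m) (ℕ.m⊔n≤o⇒n≤o M N ≤n))
  where
  open +-*-Solver
  eq : ∀ a b c d → (a ℚ.- c) ℚ.- (b ℚ.- d) ≡ (a ℚ.- b) ℚ.- (c ℚ.- d)
  eq = solve 4 (λ a b c d →
    (a :- c) :- (b :- d) := (a :- b) :- (c :- d)) refl
  bound : ∀ {ε} a b c d →
    ℚ.∣ a ℚ.- c ∣ ℚ.< ½ ℚ.* ε → ℚ.∣ b ℚ.- d ∣ ℚ.< ½ ℚ.* ε →
    ℚ.∣ (a ℚ.- b) ℚ.- (c ℚ.- d) ∣ ℚ.< ε
  bound {ε} a b c d p q =
    subst₂ (λ u v → ℚ.∣ u ∣ ℚ.< v) (eq a b c d) (½+½ ε)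
      (ℚ.≤-<-trans (ℚ.∣p-q∣≤∣p∣+∣q∣ (a ℚ.- c) (b ℚ.- d)) (ℚ.+-mono-< p q))

bounded : ∀ x → IsCauchy x →
  ∃[ B ] 0ℚ ℚ.< B × ∃[ N ] (∀ n → N ℕ.≤ n → ℚ.∣ x n ∣ ℚ.≤ B)
bounded x c with c 1ℚ (ℚ.positive⁻¹ 1ℚ)
... | N , h = ℚ.∣ x N ∣ ℚ.+ 1ℚ ,
    ℚ.+-mono-≤-< (ℚ.0≤∣p∣ (x N)) (ℚ.positive⁻¹ 1ℚ) , N , λ n N≤n →
    ℚ.≤-trans
      (subst (λ z → ℚ.∣ z ∣ ℚ.≤ ℚ.∣ x N ∣ ℚ.+ ℚ.∣ x n ℚ.- x N ∣)
        (eq (x n) (x N)) (ℚ.∣p+q∣≤∣p∣+∣q∣ (x N) (x n ℚ.- x N)))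
      (ℚ.+-monoʳ-≤ ℚ.∣ x N ∣ (ℚ.<⇒≤ (h n N N≤n ℕ.≤-refl)))
  where
  open +-*-Solver
  eq : ∀ p q → q ℚ.+ (p ℚ.- q) ≡ p
  eq = solve 2 (λ p q → q :+ (p :- q) := p) refl

scaled : ∀ x → IsCauchy x → ∀ B → 0ℚ ℚ.< B → ∀ ε → 0ℚ ℚ.< ε →
  ∃[ N ] ∀ m n → N ℕ.≤ m → N ℕ.≤ n → B ℚ.* ℚ.∣ x m ℚ.- x n ∣ ℚ.< ε
scaled x c B 0<B ε 0<ε =
  let (N , h) = c (B⁻¹ ℚ.* ε) 0<B⁻¹ε in
  N , λ m n N≤m N≤n →
    subst (B ℚ.* ℚ.∣ x m ℚ.- x n ∣ ℚ.<_) eq (ℚ.*-monoʳ-<-pos B (h m n N≤m N≤n))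
  where
  instance
    B-pos : ℚ.Positive B
    B-pos = ℚ.positive 0<B
    B-nz : ℚ.NonZero B
    B-nz = ℚ.pos⇒nonZero B
  B⁻¹ : ℚ
  B⁻¹ = ℚ.1/ B
  instance
    B⁻¹-pos : ℚ.Positive B⁻¹
    B⁻¹-pos = ℚ.1/pos⇒pos B
  0<B⁻¹ε : 0ℚ ℚ.< B⁻¹ ℚ.* ε
  0<B⁻¹ε = subst (ℚ._< B⁻¹ ℚ.* ε) (ℚ.*-zeroʳ B⁻¹) (ℚ.*-monoʳ-<-pos B⁻¹ 0<ε)
  eq : B ℚ.* (B⁻¹ ℚ.* ε) ≡ ε
  eq = trans (sym (ℚ.*-assoc B B⁻¹ ε))
         (trans (cong (ℚ._* ε) (ℚ.*-inverseʳ B)) (ℚ.*-identityˡ ε))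

_*ℝ_ : ℝ → ℝ → ℝ
x *ℝ y = mkℝ (λ n → seq x n ℚ.* seq y n) λ ε 0<ε →
  let (A , 0<A , M₁ , a) = bounded (seq x) (cauchy x)
      (B , 0<B , M₂ , b) = bounded (seq y) (cauchy y)
      (M₃ , h) = scaled (seq y) (cauchy y) A 0<A (½ ℚ.* ε) (½-pos 0<ε)
      (M₄ , k) = scaled (seq x) (cauchy x) B 0<B (½ ℚ.* ε) (½-pos 0<ε)
      M₁₂ = M₁ ℕ.⊔ M₂
      M₃₄ = M₃ ℕ.⊔ M₄
      l = λ {m} (p : M₁₂ ℕ.⊔ M₃₄ ℕ.≤ m) → ℕ.m⊔n≤o⇒m≤o M₁₂ M₃₄ p
      r = λ {m} (p : M₁₂ ℕ.⊔ M₃₄ ℕ.≤ m) → ℕ.m⊔n≤o⇒n≤o M₁₂ M₃₄ p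
  in M₁₂ ℕ.⊔ M₃₄ , λ m n ≤m ≤n →
    bound (seq x m) (seq y m) (seq x n) (seq y n) A B
      (a m (ℕ.m⊔n≤o⇒m≤o M₁ M₂ (l ≤m)))
      (b n (ℕ.m⊔n≤o⇒n≤o M₁ M₂ (l ≤n)))
      (h m n (ℕ.m⊔n≤o⇒m≤o M₃ M₄ (r ≤m)) (ℕ.m⊔n≤o⇒m≤o M₃ M₄ (r ≤n)))
      (k m n (ℕ.m⊔n≤o⇒n≤o M₃ M₄ (r ≤m)) (ℕ.m⊔n≤o⇒n≤o M₃ M₄ (r ≤n)))
  where
  open +-*-Solver
  eq : ∀ a b c d → a ℚ.* (b ℚ.- d) ℚ.+ d ℚ.* (a ℚ.- c) ≡ a ℚ.* b ℚ.- c ℚ.* d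
  eq = solve 4 (λ a b c d →
    a :* (b :- d) :+ d :* (a :- c) := a :* b :- c :* d) refl
  term : ∀ {A p} q → ℚ.∣ p ∣ ℚ.≤ A → ℚ.∣ p ℚ.* q ∣ ℚ.≤ A ℚ.* ℚ.∣ q ∣
  term {A} {p} q h = subst (ℚ._≤ A ℚ.* ℚ.∣ q ∣) (sym (ℚ.∣p*q∣≡∣p∣*∣q∣ p q))
    (ℚ.*-monoʳ-≤-nonNeg ℚ.∣ q ∣ {{ℚ.∣-∣-nonNeg q}} h)
  bound : ∀ {ε} a b c d A B → ℚ.∣ a ∣ ℚ.≤ A → ℚ.∣ d ∣ ℚ.≤ B →
    A ℚ.* ℚ.∣ b ℚ.- d ∣ ℚ.< ½ ℚ.* ε → B ℚ.* ℚ.∣ a ℚ.- c ∣ ℚ.< ½ ℚ.* ε →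
    ℚ.∣ a ℚ.* b ℚ.- c ℚ.* d ∣ ℚ.< ε
  bound {ε} a b c d A B a≤A d≤B p q =
    subst₂ (λ u v → ℚ.∣ u ∣ ℚ.< v) (eq a b c d) (½+½ ε)
      (ℚ.≤-<-trans
        (ℚ.∣p+q∣≤∣p∣+∣q∣ (a ℚ.* (b ℚ.- d)) (d ℚ.* (a ℚ.- c)))
        (ℚ.+-mono-<
          (ℚ.≤-<-trans (term (b ℚ.- d) a≤A) p)
          (ℚ.≤-<-trans (term (a ℚ.- c) d≤B) q)))

TendsToZero : (ℕ → ℝ) → Set
TendsToZero x = ∀ δ → 0ℚ ℚ.< δ →
  ∃[ S ] ∀ s → S ℕ.≤ s → ∣ x s ∣ℝ <ℝ fromℚ δ

------------------------------------------------------------------------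
-- Sequences with an explicit rate of convergence

1/suc : ℕ → ℚ
1/suc n = + 1 ℚ./ suc n

/-mono-≤ : ∀ a b c d → a ℕ.* suc d ℕ.≤ b ℕ.* suc c →
  + a ℚ./ suc c ℚ.≤ + b ℚ./ suc d
/-mono-≤ a b c d h = ℚ.toℚᵘ-cancel-≤
  (ℚᵘ.≤-respˡ-≃ (ℚᵘ.≃-sym (ℚ.toℚᵘ-fromℚᵘ (mkℚᵘ (+ a) c)))
    (ℚᵘ.≤-respʳ-≃ (ℚᵘ.≃-sym (ℚ.toℚᵘ-fromℚᵘ (mkℚᵘ (+ b) d)))
      (ℚᵘ.*≤* (subst₂ ℤ._≤_ (ℤ.pos-* a (suc d)) (ℤ.pos-* b (suc c)) (ℤ.+≤+ h)))))

/-add : ∀ a b c → + a ℚ./ suc c ℚ.+ + b ℚ./ suc c ≡ + (a ℕ.+ b) ℚ./ suc c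
/-add a b c = ℚ.toℚᵘ-injective (begin
  ℚ.toℚᵘ (+ a ℚ./ suc c ℚ.+ + b ℚ./ suc c)
    ≈⟨ ℚ.toℚᵘ-homo-+ (+ a ℚ./ suc c) (+ b ℚ./ suc c) ⟩
  ℚ.toℚᵘ (+ a ℚ./ suc c) ℚᵘ.+ ℚ.toℚᵘ (+ b ℚ./ suc c)
    ≈⟨ ℚᵘ.+-cong (ℚ.toℚᵘ-fromℚᵘ (mkℚᵘ (+ a) c)) (ℚ.toℚᵘ-fromℚᵘ (mkℚᵘ (+ b) c)) ⟩
  mkℚᵘ (+ a) c ℚᵘ.+ mkℚᵘ (+ b) c
    ≈⟨ ℚᵘ.*≡* (eq (+ a) (+ b) (+ suc c)) ⟩
  mkℚᵘ (+ (a ℕ.+ b)) c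
    ≈⟨ ℚ.toℚᵘ-fromℚᵘ (mkℚᵘ (+ (a ℕ.+ b)) c) ⟨
  ℚ.toℚᵘ (+ (a ℕ.+ b) ℚ./ suc c) ∎)
  where
  open import Relation.Binary.Reasoning.Setoid ℚᵘ.≃-setoid
  open import Data.Integer.Solver renaming (module +-*-Solver to ℤ-Solver)
  open ℤ-Solver
  eq : ∀ a b c → (a ℤ.* c ℤ.+ b ℤ.* c) ℤ.* c ≡ (a ℤ.+ b) ℤ.* (c ℤ.* c)
  eq = solve 3 (λ a b c →
    (a :* c :+ b :* c) :* c := (a :+ b) :* (c :* c)) refl

1/suc-anti : ∀ m n → m ℕ.≤ n → 1/suc n ℚ.≤ 1/suc m
1/suc-anti m n m≤n = /-mono-≤ 1 1 n m (ℕ.*-monoʳ-≤ 1 (ℕ.s≤s m≤n))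

archimedean : ∀ ε → 0ℚ ℚ.< ε → ∃[ N ] 1/suc N ℚ.< ε
archimedean ε@(ℚ.mkℚ ℤ.+[1+ a ] b _) _ = suc b ,
  ℚ.toℚᵘ-cancel-<
    (ℚᵘ.<-respˡ-≃ (ℚᵘ.≃-sym (ℚ.toℚᵘ-fromℚᵘ (mkℚᵘ (+ 1) (suc b))))
      (ℚᵘ.*<* (subst₂ ℤ._<_ (ℤ.pos-* 1 (suc b)) (ℤ.pos-* (suc a) (suc (suc b)))
        (ℤ.+<+ (ℕ.<-≤-trans
          (subst (ℕ._< suc (suc b)) (sym (ℕ.*-identityˡ (suc b))) ℕ.≤-refl)
          (ℕ.m≤n*m (suc (suc b)) (suc a)))))))
archimedean (ℚ.mkℚ (+ 0) _ _) (ℚ.*<* (ℤ.+<+ ()))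
archimedean (ℚ.mkℚ ℤ.-[1+ _ ] _ _) (ℚ.*<* ())

limit : (x : ℕ → ℚ) → (∀ m n → x m ℚ.≤ x n ℚ.+ 1/suc n) → ℝ
limit x h = mkℝ x λ ε 0<ε →
  let (N , 1/N<ε) = archimedean ε 0<ε in
  N , λ m n N≤m N≤n → ℚ.≤-<-trans
    (∣-∣-lub
      (≤+⇒-≤ (ℚ.≤-trans (h m n) (ℚ.+-monoʳ-≤ (x n) (1/suc-anti N n N≤n))))
      (subst (ℚ._≤ 1/suc N) (sym (neg-sub (x m) (x n)))
        (≤+⇒-≤ (ℚ.≤-trans (h n m) (ℚ.+-monoʳ-≤ (x m) (1/suc-anti N m N≤m))))))
    1/N<ε

------------------------------------------------------------------------
-- Square roots of natural numbers

-- ⌊√n⌋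
isqrt : ℕ → ℕ
isqrt zero    = 0
isqrt (suc n) with suc (isqrt n) ℕ.* suc (isqrt n) ℕ.≤? suc n
... | yes _ = suc (isqrt n)
... | no  _ = isqrt n

isqrt-lower : ∀ n → isqrt n ℕ.* isqrt n ℕ.≤ n
isqrt-lower zero    = ℕ.z≤n
isqrt-lower (suc n) with suc (isqrt n) ℕ.* suc (isqrt n) ℕ.≤? suc n
... | yes h = h
... | no  _ = ℕ.m≤n⇒m≤1+n (isqrt-lower n)

isqrt-upper : ∀ n → n ℕ.< suc (isqrt n) ℕ.* suc (isqrt n)
isqrt-upper zero    = ℕ.s≤s ℕ.z≤n
isqrt-upper (suc n) with suc (isqrt n) ℕ.* suc (isqrt n) ℕ.≤? suc n
... | no  h = ℕ.≰⇒> h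
... | yes _ = ℕ.<-≤-trans (ℕ.s≤s (isqrt-upper n))
    (ℕ.*-mono-< (ℕ.n<1+n (suc (isqrt n))) (ℕ.n<1+n (suc (isqrt n))))

-- Rational approximation of √n from below, with error less than 1/(k+1).
sqrtApprox : ℕ → ℕ → ℚ
sqrtApprox n k = + isqrt (n ℕ.* (suc k ℕ.* suc k)) ℚ./ suc k

sqrtApprox-rate : ∀ n i j → sqrtApprox n i ℚ.≤ sqrtApprox n j ℚ.+ 1/suc j
sqrtApprox-rate n i j = subst (sqrtApprox n i ℚ.≤_) (sym (/-add q 1 j))
  (/-mono-≤ p (q ℕ.+ 1) i j (subst (λ z → p ℕ.* suc j ℕ.≤ z ℕ.* suc i) (ℕ.+-comm 1 q)
    (square-cancel (ℕ.≤-trans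
      (subst₂ ℕ._≤_ (e₁ p (suc j)) refl
        (ℕ.*-monoˡ-≤ (suc j ℕ.* suc j) (isqrt-lower (n ℕ.* (suc i ℕ.* suc i)))))
      (subst₂ ℕ._≤_ (e₂ n (suc i) (suc j)) (e₁ (suc q) (suc i))
        (ℕ.*-monoˡ-≤ (suc i ℕ.* suc i)
          (ℕ.<⇒≤ (isqrt-upper (n ℕ.* (suc j ℕ.* suc j))))))))))
  where
  p = isqrt (n ℕ.* (suc i ℕ.* suc i))
  q = isqrt (n ℕ.* (suc j ℕ.* suc j))
  e₁ : ∀ a b → a ℕ.* a ℕ.* (b ℕ.* b) ≡ a ℕ.* b ℕ.* (a ℕ.* b)
  e₁ = solve-∀
  e₂ : ∀ n a b → n ℕ.* (b ℕ.* b) ℕ.* (a ℕ.* a) ≡ n ℕ.* (a ℕ.* a) ℕ.* (b ℕ.* b)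
  e₂ = solve-∀
  square-cancel : ∀ {a b} → a ℕ.* a ℕ.≤ b ℕ.* b → a ℕ.≤ b
  square-cancel {a} {b} h with a ℕ.≤? b
  ... | yes a≤b = a≤b
  ... | no  a≰b with () ←
    ℕ.<⇒≱ (ℕ.*-mono-< (ℕ.≰⇒> a≰b) (ℕ.≰⇒> a≰b)) h

infix 9 √_

√_ : ℕ → ℝ
√ n = limit (sqrtApprox n) (sqrtApprox-rate n)

------------------------------------------------------------------------
-- The natural logarithm of 2

∑ : ℕ → (ℕ → ℚ) → ℚ
∑ zero    f = 0ℚ
∑ (suc n) f = ∑ n f ℚ.+ f n

∑-head : ∀ n f → ∑ (suc n) f ≡ f 0 ℚ.+ ∑ n (f ∘ suc)
∑-head zero    f = ℚ.+-comm 0ℚ (f 0)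
∑-head (suc n) f = trans (cong (ℚ._+ f (suc n)) (∑-head n f))
  (ℚ.+-assoc (f 0) (∑ n (f ∘ suc)) (f (suc n)))

∑-cong : ∀ n {f g} → (∀ i → f i ≡ g i) → ∑ n f ≡ ∑ n g
∑-cong zero    h = refl
∑-cong (suc n) h = cong₂ ℚ._+_ (∑-cong n h) (h n)

-- ln 2 = ∫₁² dx/x.  With N = n + 1 equal subintervals, the right-endpoint
-- Riemann sum is ∑_{i=1}^{N} (1/N) · 1/(1 + i/N) = ∑_{i=1}^{N} 1/(N + i).
ln2Approx : ℕ → ℚ
ln2Approx n = ∑ (suc n) (λ i → + 1 ℚ./ (suc n ℕ.+ suc i))

ln2-step : ∀ n → 1/suc (suc n) ℚ.+ ln2Approx (suc n) ≡
  ln2Approx n ℚ.+ (1/suc (suc n ℕ.+ suc n) ℚ.+ 1/suc (suc n ℕ.+ suc (suc n)))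
ln2-step n = begin
  1/suc (suc n) ℚ.+ ln2Approx (suc n)
    ≡⟨ cong (λ k → 1/suc k ℚ.+ ln2Approx (suc n)) (ℕ.+-identityʳ (suc n)) ⟨
  f 0 ℚ.+ ∑ (suc (suc n)) (f ∘ suc)
    ≡⟨ ∑-head (suc (suc n)) f ⟨
  ∑ (suc n) f ℚ.+ f (suc n) ℚ.+ f (suc (suc n))
    ≡⟨ ℚ.+-assoc (∑ (suc n) f) (f (suc n)) (f (suc (suc n))) ⟩
  ∑ (suc n) f ℚ.+ (f (suc n) ℚ.+ f (suc (suc n)))
    ≡⟨ cong (ℚ._+ (f (suc n) ℚ.+ f (suc (suc n))))
         (∑-cong (suc n) λ i → cong 1/suc (sym (ℕ.+-suc n i))) ⟩
  ln2Approx n ℚ.+ (f (suc n) ℚ.+ f (suc (suc n))) ∎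
  where
  open ≡-Reasoning
  f : ℕ → ℚ
  f i = 1/suc (suc n ℕ.+ i)

1/suc-double : ∀ n → 1/suc (n ℕ.+ suc n) ℚ.+ 1/suc (n ℕ.+ suc n) ≡ 1/suc n
1/suc-double n = trans (/-add 1 1 (n ℕ.+ suc n))
  (ℚ.≤-antisym
    (/-mono-≤ 2 1 (n ℕ.+ suc n) n (ℕ.≤-reflexive (e n)))
    (/-mono-≤ 1 2 n (n ℕ.+ suc n) (ℕ.≤-reflexive (sym (e n)))))
  where
  e : ∀ n → 2 ℕ.* suc n ≡ 1 ℕ.* suc (n ℕ.+ suc n)
  e = solve-∀

+-cancelˡ-≤ : ∀ p q r → p ℚ.+ q ℚ.≤ p ℚ.+ r → q ℚ.≤ r
+-cancelˡ-≤ p q r h = subst₂ ℚ._≤_ (eq p q) (eq p r) (ℚ.+-monoʳ-≤ (ℚ.- p) h)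
  where
  open +-*-Solver
  eq : ∀ p q → (ℚ.- p) ℚ.+ (p ℚ.+ q) ≡ q
  eq = solve 2 (λ p q → (:- p) :+ (p :+ q) := q) refl

ln2-increasing : ∀ n → ln2Approx n ℚ.≤ ln2Approx (suc n)
ln2-increasing n =
  +-cancelˡ-≤ (1/suc (suc n)) (ln2Approx n) (ln2Approx (suc n)) (begin
    1/suc (suc n) ℚ.+ ln2Approx n
      ≡⟨ ℚ.+-comm (1/suc (suc n)) (ln2Approx n) ⟩
    ln2Approx n ℚ.+ 1/suc (suc n)
      ≡⟨ cong (ln2Approx n ℚ.+_) (1/suc-double (suc n)) ⟨
    ln2Approx n ℚ.+ (1/suc b ℚ.+ 1/suc b)
      ≤⟨ ℚ.+-monoʳ-≤ (ln2Approx n) (ℚ.+-monoˡ-≤ (1/suc b)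
           (1/suc-anti a b (ℕ.+-monoʳ-≤ (suc n) (ℕ.n≤1+n (suc n))))) ⟩
    ln2Approx n ℚ.+ (1/suc a ℚ.+ 1/suc b)
      ≡⟨ ln2-step n ⟨
    1/suc (suc n) ℚ.+ ln2Approx (suc n) ∎)
  where
  open ℚ.≤-Reasoning
  a = suc n ℕ.+ suc n
  b = suc n ℕ.+ suc (suc n)

ln2-upper-decreasing : ∀ n →
  ln2Approx (suc n) ℚ.+ 1/suc (suc n) ℚ.≤ ln2Approx n ℚ.+ 1/suc n
ln2-upper-decreasing n = begin
  ln2Approx (suc n) ℚ.+ 1/suc (suc n)
    ≡⟨ ℚ.+-comm (ln2Approx (suc n)) (1/suc (suc n)) ⟩
  1/suc (suc n) ℚ.+ ln2Approx (suc n)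
    ≡⟨ ln2-step n ⟩
  ln2Approx n ℚ.+ (1/suc a ℚ.+ 1/suc b)
    ≤⟨ ℚ.+-monoʳ-≤ (ln2Approx n) (ℚ.+-mono-≤
         (1/suc-anti c a (ℕ.n≤1+n c)) (1/suc-anti c b c≤b)) ⟩
  ln2Approx n ℚ.+ (1/suc c ℚ.+ 1/suc c)
    ≡⟨ cong (ln2Approx n ℚ.+_) (1/suc-double n) ⟩
  ln2Approx n ℚ.+ 1/suc n ∎
  where
  open ℚ.≤-Reasoning
  a = suc n ℕ.+ suc n
  b = suc n ℕ.+ suc (suc n)
  c = n ℕ.+ suc n
  c≤b : c ℕ.≤ b
  c≤b = ℕ.+-mono-≤ (ℕ.n≤1+n n) (ℕ.n≤1+n (suc n))

ln2-below-upper : ∀ k → ln2Approx k ℚ.≤ ln2Approx k ℚ.+ 1/suc k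
ln2-below-upper k = subst (ℚ._≤ ln2Approx k ℚ.+ 1/suc k)
  (ℚ.+-identityʳ (ln2Approx k))
  (ℚ.+-monoʳ-≤ (ln2Approx k) (/-mono-≤ 0 1 0 k ℕ.z≤n))

ln2Approx-rate : ∀ m n → ln2Approx m ℚ.≤ ln2Approx n ℚ.+ 1/suc n
ln2Approx-rate m n with ℕ.≤-total m n
... | inj₁ m≤n = ℚ.≤-trans (up (ℕ.≤⇒≤′ m≤n)) (ln2-below-upper n)
  where
  up : ∀ {m n} → m ℕ.≤′ n → ln2Approx m ℚ.≤ ln2Approx n
  up ℕ.≤′-refl         = ℚ.≤-refl
  up {n = suc n} (ℕ.≤′-step h) = ℚ.≤-trans (up h) (ln2-increasing n)
... | inj₂ n≤m = ℚ.≤-trans (ln2-below-upper m) (down (ℕ.≤⇒≤′ n≤m))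
  where
  down : ∀ {n m} → n ℕ.≤′ m →
    ln2Approx m ℚ.+ 1/suc m ℚ.≤ ln2Approx n ℚ.+ 1/suc n
  down ℕ.≤′-refl         = ℚ.≤-refl
  down {m = suc m} (ℕ.≤′-step h) = ℚ.≤-trans (ln2-upper-decreasing m) (down h)

ln2 : ℝ
ln2 = limit ln2Approx ln2Approx-rate

{-# OPTIONS --safe #-}
-- Upper bound. A vertex splits the rest of a vertex set without threshold
-- subgraphs of order s + 1 into two sides without threshold subgraphs of
-- order s. Hence the maximal size c becomes at most 2c + 1, and at most 2c if
-- c is odd (handshake lemma); starting from 17 for order 6 this gives
-- ⌈13·2ˢ/48⌉. On 18 vertices without a threshold subgraph of order 6, Goodman's
-- count of monochromatic triangles is tight at every vertex: one side is the
-- Paley graph on 9 vertices, the other is an 8-vertex graph with the least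
-- possible number of edges. Two adjacent vertices of different type have
-- incompatible codegrees, so the graph is regular, and then two vertices have
-- 5 common neighbours spanning a 5-cycle, which the Paley graph does not contain.
--
-- Lower bound. Colour the pairs of [n] at random. A threshold graph on an s-set
-- is an ordered partition of the s-set together with the colour of the first
-- block, and there are at most s!/(ln 2)ˢ ordered partitions, because
-- e^{ln 2} - 1 ≤ 1. The local lemma, in a form that counts colourings, then
-- avoids all of them for n up to (√2 ln 2 - o(1)) 2^{s/2}.
module Submission where

open import Data.Nat.Base using (ℕ; _^_; _≤_)
open import Data.Integer.Base as ℤ using (+_)
open import Data.Rational.Base as ℚ using (ceiling)
open import Data.Product using (Σ-syntax; ∃-syntax; _×_)
open import Defs

open import Data.Bool.Base using (Bool; true; false; T; not; _∧_; _∨_; if_then_else_)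
import Data.Bool.Properties as Bool
open import Data.Empty using (⊥; ⊥-elim)
open import Data.Fin.Base as Fin using (Fin; zero; suc; combine; remQuot)
import Data.Fin.Properties as Fin
open import Data.Integer.Base using (-[1+_])
import Data.Integer.DivMod as ℤ
import Data.Integer.Properties as ℤ
open import Data.List.Base using (List; []; _∷_; _++_; length; filterᵇ; map; concatMap; zip; tabulate; allFin)
open import Data.List.Properties using (length-++; length-map; length-tabulate)
open import Data.List.Membership.Propositional using (_∈_)
open import Data.List.Membership.Propositional.Properties
  using (∈-++⁺ˡ; ∈-++⁺ʳ; ∈-++⁻; ∈-map⁺; ∈-map⁻; ∈-concatMap⁺; ∈-allFin)
open import Data.List.Relation.Unary.Any as Any using (here; there)
open import Data.List.Relation.Unary.All as All using (All; []; _∷_)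
import Data.List.Relation.Unary.All.Properties as All
open import Data.List.Relation.Unary.AllPairs as AllPairs using (AllPairs; []; _∷_)
import Data.List.Relation.Unary.AllPairs.Properties as AllPairs
open import Data.Nat.Base as ℕ hiding (parity)
open import Data.Nat.DivMod using (m≡m%n+[m/n]*n; m%n<n)
open import Data.Nat.Properties as ℕ hiding (+-cancelˡ-≤)
open import Data.Nat.Tactic.RingSolver using (solve-∀)
open import Data.Product using (_,_; proj₁; proj₂)
open import Data.Rational.Base using (ℚ; 0ℚ; 1ℚ; ½)
import Data.Rational.Properties as ℚ
open import Data.Rational.Solver using (module +-*-Solver)
open import Data.Rational.Unnormalised.Base as ℚᵘ using (mkℚᵘ)
import Data.Rational.Unnormalised.Properties as ℚᵘ
open import Data.Sum.Base using (_⊎_; inj₁; inj₂; [_,_]′)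
open import Data.Unit.Base using (tt)
open import Data.Vec.Base as Vec using (Vec; []; _∷_; lookup; updateAt)
open import Data.Vec.Properties using (lookup∘tabulate; lookup∘updateAt; lookup∘updateAt′)
open import Function.Base using (_∘_)
open import Function.Bundles using (mk↣; Injection; Inverse; mk↔ₛ′)
open import Function.Properties.Inverse using (Inverse⇒Injection)
open import Relation.Binary.Definitions using (tri<; tri≈; tri>)
open import Relation.Binary.PropositionalEquality hiding (J)
open import Relation.Nullary using (¬_; Dec; yes; no; does; contradiction)
open import Relation.Nullary.Decidable
  using (_×-dec_; dec-true; dec-false; decidable-stable; map′; toWitness)
open import Algebra.Properties.CommutativeMonoid.Sum +-0-commutativeMonoid
  using (sum; sum-cong-≗; sum-replicate-zero; ∑-distrib-+; ∑-comm)
open import Algebra.Properties.Semiring.Sum +-*-semiring using (*-distribˡ-sum)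

-- Sums over vertex sets

-- From order 6 on the upper bound on the size runs through 17, 34, 69, 138, ...; 13/48 is the slope
-- of this recurrence, and one more than each term is exactly the ceiling. Plain doubling would give
-- 5, 10, 21 for orders 4, 5, 6, so order 5 needs its own improvement, from 10 to 9.
--
-- In the lower bound, dependent patterns share two vertices. The local lemma therefore weighs about
-- n^(s-2)/(s-2)! · s!/(ln 2)^s, up to polynomial factors, against 2^(s(s-1)/2). This allows n near
-- (ln 2) 2^((s+1)/2 + 1/(s-2)), which is where √2 comes from; a union bound has n^s instead and
-- loses a factor 2.
--
-- Real numbers enter only at the end. The estimates live in ℕ, with a fraction a/b in place of ln 2
-- and a slack factor j/(j + 1), whose (s-2)-th power absorbs the polynomial factors once s is
-- large. How large depends on j, so j grows with s by a diagonal choice, which defines ε. The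
-- minimum has to be exhibited, hence unavoidability is decided by a finite search.

⟦_⟧ : Bool → ℕ
⟦ true  ⟧ = 1
⟦ false ⟧ = 0

∧-intro : ∀ {a b} → a ≡ true → b ≡ true → a ∧ b ≡ true
∧-intro refl refl = refl

∧-elimˡ : ∀ {a b} → a ∧ b ≡ true → a ≡ true
∧-elimˡ {true} _ = refl

∧-elimʳ : ∀ {a b} → a ∧ b ≡ true → b ≡ true
∧-elimʳ {true} h = h

⟦∧⟧ : ∀ a b → ⟦ a ∧ b ⟧ ≡ ⟦ a ⟧ * ⟦ b ⟧
⟦∧⟧ true  b = sym (+-identityʳ ⟦ b ⟧)
⟦∧⟧ false b = refl

sum-mono : ∀ {n} {f g : Fin n → ℕ} → (∀ i → f i ≤ g i) → sum f ≤ sum g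
sum-mono {zero}  h = z≤n
sum-mono {suc n} h = +-mono-≤ (h zero) (sum-mono (λ i → h (suc i)))

-- The equality case of termwise inequalities: this turns a count that is tight on average into an
-- equality at every vertex.
sum-tight : ∀ {n} {f g : Fin n → ℕ} → (∀ i → f i ≤ g i) → sum g ≤ sum f → ∀ i → f i ≡ g i
sum-tight {suc n} {f} {g} h ∑g≤∑f = λ
  { zero    → ≤-antisym (h zero) (+-cancelʳ-≤ (sum (λ i → f (suc i))) _ _
      (≤-trans (+-monoʳ-≤ (g zero) tail≤) ∑g≤∑f))
  ; (suc i) → sum-tight (λ i → h (suc i))
      (ℕ.+-cancelˡ-≤ (g zero) _ _ (≤-trans ∑g≤∑f (+-monoˡ-≤ _ (h zero)))) i }
  where tail≤ = sum-mono (λ i → h (suc i))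

size-singleton : ∀ {n} (v : Fin n) → sum (λ u → ⟦ does (v Fin.≟ u) ⟧) ≡ 1
size-singleton {suc n} zero    = cong suc (sum-replicate-zero n)
size-singleton {suc n} (suc v) = size-singleton v

module _ {n : ℕ} where

  VertexSet : Set
  VertexSet = Fin n → Bool

  infixl 7 _∩_ _∖_

  _∩_ _∖_ : VertexSet → VertexSet → VertexSet
  (X ∩ Y) v = X v ∧ Y v
  (X ∖ Y) v = X v ∧ not (Y v)

  ∑∈ : VertexSet → (Fin n → ℕ) → ℕ
  ∑∈ X f = sum (λ v → ⟦ X v ⟧ * f v)

  size : VertexSet → ℕ
  size X = sum (λ v → ⟦ X v ⟧)

  ∑∈-mono : ∀ X {f g} → (∀ v → X v ≡ true → f v ≤ g v) → ∑∈ X f ≤ ∑∈ X g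
  ∑∈-mono X {f} {g} h = sum-mono pointwise
    where
    pointwise : ∀ v → ⟦ X v ⟧ * f v ≤ ⟦ X v ⟧ * g v
    pointwise v with X v | h v
    ... | true  | k = *-monoʳ-≤ 1 (k refl)
    ... | false | _ = z≤n

  ∑∈-cong : ∀ X {f g} → (∀ v → X v ≡ true → f v ≡ g v) → ∑∈ X f ≡ ∑∈ X g
  ∑∈-cong X h = ≤-antisym (∑∈-mono X (λ v p → ≤-reflexive (h v p)))
    (∑∈-mono X (λ v p → ≤-reflexive (sym (h v p))))

  ∑∈-const : ∀ X c → ∑∈ X (λ _ → c) ≡ c * size X
  ∑∈-const X c = trans (sum-cong-≗ (λ v → *-comm ⟦ X v ⟧ c))
    (sym (*-distribˡ-sum c (λ v → ⟦ X v ⟧)))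

  ∑∈-1 : ∀ X → ∑∈ X (λ _ → 1) ≡ size X
  ∑∈-1 X = trans (∑∈-const X 1) (*-identityˡ (size X))

  ∑∈-+ : ∀ X f g → ∑∈ X (λ v → f v + g v) ≡ ∑∈ X f + ∑∈ X g
  ∑∈-+ X f g = trans (sum-cong-≗ (λ v → *-distribˡ-+ ⟦ X v ⟧ (f v) (g v)))
    (∑-distrib-+ (λ v → ⟦ X v ⟧ * f v) (λ v → ⟦ X v ⟧ * g v))

  ∑∈-* : ∀ X c f → ∑∈ X (λ v → c * f v) ≡ c * ∑∈ X f
  ∑∈-* X c f = trans (sum-cong-≗ (λ v → eq ⟦ X v ⟧ c (f v)))
    (sym (*-distribˡ-sum c (λ v → ⟦ X v ⟧ * f v)))
    where
    eq : ∀ a b c → a * (b * c) ≡ b * (a * c)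
    eq = solve-∀

  ∑∈-≥ : ∀ X {f} c → (∀ v → X v ≡ true → c ≤ f v) → c * size X ≤ ∑∈ X f
  ∑∈-≥ X c h = subst (_≤ _) (∑∈-const X c) (∑∈-mono X h)

  ∑∈-≤ : ∀ X {f} c → (∀ v → X v ≡ true → f v ≤ c) → ∑∈ X f ≤ c * size X
  ∑∈-≤ X c h = subst (_ ≤_) (∑∈-const X c) (∑∈-mono X h)

  ∑∈-≡ : ∀ X {f} c → (∀ v → X v ≡ true → f v ≡ c) → ∑∈ X f ≡ c * size X
  ∑∈-≡ X c h = trans (∑∈-cong X h) (∑∈-const X c)

  ∑∈-tight : ∀ X {f g} → (∀ v → X v ≡ true → f v ≤ g v) → ∑∈ X g ≤ ∑∈ X f →
    ∀ v → X v ≡ true → f v ≡ g v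
  ∑∈-tight X {f} {g} h le v Xv = trans (lemma (f v)) (trans (sum-tight pointwise le v) (sym (lemma (g v))))
    where
    pointwise : ∀ v → ⟦ X v ⟧ * f v ≤ ⟦ X v ⟧ * g v
    pointwise v with X v | h v
    ... | true  | k = *-monoʳ-≤ 1 (k refl)
    ... | false | _ = z≤n
    lemma : ∀ m → m ≡ ⟦ X v ⟧ * m
    lemma m rewrite Xv = sym (+-identityʳ m)

  size-cong : ∀ {X Y} → (∀ v → X v ≡ Y v) → size X ≡ size Y
  size-cong h = sum-cong-≗ (λ v → cong ⟦_⟧ (h v))

  size-mono : ∀ {X Y} → (∀ v → X v ≡ true → Y v ≡ true) → size X ≤ size Y
  size-mono {X} {Y} h = sum-mono pointwise
    where
    pointwise : ∀ v → ⟦ X v ⟧ ≤ ⟦ Y v ⟧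
    pointwise v with X v | h v
    ... | true  | k rewrite k refl = ≤-refl
    ... | false | _ = z≤n

  ∑∈-split : ∀ X Y f → ∑∈ X f ≡ ∑∈ (X ∩ Y) f + ∑∈ (X ∖ Y) f
  ∑∈-split X Y f = trans (sum-cong-≗ (λ v → pointwise (X v) (Y v) (f v)))
    (∑-distrib-+ (λ v → ⟦ (X ∩ Y) v ⟧ * f v) (λ v → ⟦ (X ∖ Y) v ⟧ * f v))
    where
    pointwise : ∀ a b m → ⟦ a ⟧ * m ≡ ⟦ a ∧ b ⟧ * m + ⟦ a ∧ not b ⟧ * m
    pointwise true  true  m = sym (+-identityʳ (m + 0))
    pointwise true  false m = refl
    pointwise false _     m = refl

  size-split : ∀ X Y → size X ≡ size (X ∩ Y) + size (X ∖ Y)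
  size-split X Y = trans (sum-cong-≗ (λ v → pointwise (X v) (Y v)))
    (∑-distrib-+ (λ v → ⟦ (X ∩ Y) v ⟧) (λ v → ⟦ (X ∖ Y) v ⟧))
    where
    pointwise : ∀ a b → ⟦ a ⟧ ≡ ⟦ a ∧ b ⟧ + ⟦ a ∧ not b ⟧
    pointwise true  true  = refl
    pointwise true  false = refl
    pointwise false _     = refl

  ∑∈-∃ : ∀ X {f} c → c * size X < ∑∈ X f → ∃[ v ] X v ≡ true × c < f v
  ∑∈-∃ X {f} c lt with Fin.any? (λ v → (X v Bool.≟ true) ×-dec (c <? f v))
  ... | yes h = h
  ... | no ¬h = ⊥-elim (<⇒≱ lt (∑∈-≤ X c (λ v p → ≮⇒≥ (λ q → ¬h (v , p , q)))))

  size-∃ : ∀ X → 0 < size X → ∃[ v ] X v ≡ true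
  size-∃ X lt with ∑∈-∃ X {λ _ → 1} 0 (subst (0 <_) (sym (∑∈-1 X)) lt)
  ... | v , p , _ = v , p

  size-∃∖ : ∀ X Y → size (X ∩ Y) < size X → ∃[ v ] X v ≡ true × Y v ≡ false
  size-∃∖ X Y lt with size-∃ (X ∖ Y) (+-cancelˡ-< (size (X ∩ Y)) 0 (size (X ∖ Y))
    (subst₂ _<_ (sym (+-identityʳ (size (X ∩ Y)))) (size-split X Y) lt))
  ... | v , p = v , ∧-elimˡ p , Bool.not-injective (∧-elimʳ p)

  ∑∈-size : ∀ X (Y : Fin n → VertexSet) →
    ∑∈ X (λ v → size (Y v)) ≡ sum (λ w → sum (λ v → ⟦ X v ⟧ * ⟦ Y v w ⟧))
  ∑∈-size X Y = trans (sum-cong-≗ (λ v → *-distribˡ-sum ⟦ X v ⟧ (λ w → ⟦ Y v w ⟧)))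
    (∑-comm (λ v w → ⟦ X v ⟧ * ⟦ Y v w ⟧))

  -- Neighbourhoods and degrees in a two-coloured complete graph

  module Coloured (colour : Fin n → Fin n → Bool)
                  (colour-sym : ∀ u v → colour u v ≡ colour v u) where

    -- Excluding `u` itself hides the diagonal of `colour`, so that adjacency and nonadjacency
    -- become two symmetric colours whose neighbourhoods partition the other vertices.
    N : Bool → Fin n → VertexSet
    N b u v = not (does (u Fin.≟ v)) ∧ does (colour u v Bool.≟ b)

    N-intro : ∀ {u v} → u ≢ v → N (colour u v) u v ≡ true
    N-intro {u} {v} u≢v rewrite dec-false (u Fin.≟ v) u≢v
      | dec-true (colour u v Bool.≟ colour u v) refl = refl

    N-colour : ∀ {b} u v → N b u v ≡ true → colour u v ≡ b
    N-colour {b} u v h with colour u v Bool.≟ b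
    ... | yes p = p
    ... | no  _ with () ← ∧-elimʳ {not (does (u Fin.≟ v))} h

    N-≢ : ∀ {b} u v → N b u v ≡ true → u ≢ v
    N-≢ {b} u v h u≡v with u Fin.≟ v
    N-≢ {b} u v () u≡v | yes p
    ... | no ¬p = ¬p u≡v

    N-sym : ∀ b u v → N b u v ≡ N b v u
    N-sym b u v = cong₂ _∧_ (cong not eq) (cong (λ c → does (c Bool.≟ b)) (colour-sym u v))
      where
      eq : does (u Fin.≟ v) ≡ does (v Fin.≟ u)
      eq with u Fin.≟ v
      ... | yes p = sym (dec-true (v Fin.≟ u) (sym p))
      ... | no ¬p = sym (dec-false (v Fin.≟ u) (λ q → ¬p (sym q)))

    N-irrefl : ∀ b v → N b v v ≡ false
    N-irrefl b v rewrite dec-true (v Fin.≟ v) refl = refl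

    N-disjoint : ∀ {b} u v → N b u v ≡ true → N (not b) u v ≡ false
    N-disjoint {b} u v h with N (not b) u v in eq
    ... | false = refl
    ... | true  = ⊥-elim (Bool.not-¬ {b} refl (trans (sym (N-colour u v h)) (N-colour u v eq)))

    N-complement : ∀ b {u v} → u ≢ v → N b u v ≡ false → N (not b) u v ≡ true
    N-complement b {u} {v} u≢v h = subst (λ c → N c u v ≡ true) (≢⇒not b λ e →
        contradiction (trans (sym (N-intro u≢v)) (trans (cong (λ c → N c u v) e) h)) λ ())
      (N-intro u≢v)
      where
      ≢⇒not : ∀ b {c} → c ≢ b → c ≡ not b
      ≢⇒not b c≢b = Bool.¬-not c≢b

    deg : Bool → Fin n → VertexSet → ℕ
    deg b v X = size (X ∩ N b v)

    -- Double counting of the pairs of colour `c` between `X` and `Y`.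
    deg-comm : ∀ c {X Y} → ∑∈ X (λ x → deg c x Y) ≡ ∑∈ Y (λ y → deg c y X)
    deg-comm c {X} {Y} = trans (∑∈-size X (λ x → Y ∩ N c x))
      (sum-cong-≗ λ y → trans (sum-cong-≗ (λ x → eq x y)) (sym (*-distribˡ-sum ⟦ Y y ⟧ (λ x → ⟦ X x ∧ N c y x ⟧))))
      where
      swap : ∀ a b c → a * (b * c) ≡ b * (a * c)
      swap = solve-∀
      eq : ∀ x y → ⟦ X x ⟧ * ⟦ Y y ∧ N c x y ⟧ ≡ ⟦ Y y ⟧ * ⟦ X x ∧ N c y x ⟧
      eq x y rewrite ⟦∧⟧ (Y y) (N c x y) | ⟦∧⟧ (X x) (N c y x) | N-sym c x y = swap ⟦ X x ⟧ ⟦ Y y ⟧ ⟦ N c y x ⟧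

    ∑∈-N-comm : ∀ c X Y (f : Fin n → Fin n → ℕ) →
      ∑∈ X (λ x → ∑∈ (Y ∩ N c x) (λ y → f x y)) ≡ ∑∈ Y (λ y → ∑∈ (X ∩ N c y) (λ x → f x y))
    ∑∈-N-comm c X Y f = begin
      ∑∈ X (λ x → ∑∈ (Y ∩ N c x) (λ y → f x y))
        ≡⟨ sum-cong-≗ (λ x → *-distribˡ-sum ⟦ X x ⟧ (λ y → ⟦ (Y ∩ N c x) y ⟧ * f x y)) ⟩
      sum (λ x → sum (λ y → ⟦ X x ⟧ * (⟦ (Y ∩ N c x) y ⟧ * f x y)))
        ≡⟨ ∑-comm (λ x y → ⟦ X x ⟧ * (⟦ (Y ∩ N c x) y ⟧ * f x y)) ⟩
      sum (λ y → sum (λ x → ⟦ X x ⟧ * (⟦ (Y ∩ N c x) y ⟧ * f x y)))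
        ≡⟨ sum-cong-≗ (λ y → sum-cong-≗ (λ x → eq x y)) ⟩
      sum (λ y → sum (λ x → ⟦ Y y ⟧ * (⟦ (X ∩ N c y) x ⟧ * f x y)))
        ≡⟨ sum-cong-≗ (λ y → *-distribˡ-sum ⟦ Y y ⟧ (λ x → ⟦ (X ∩ N c y) x ⟧ * f x y)) ⟨
      ∑∈ Y (λ y → ∑∈ (X ∩ N c y) (λ x → f x y)) ∎
      where
      open ≡-Reasoning
      swap : ∀ a b c d → a * (b * c * d) ≡ b * (a * c * d)
      swap = solve-∀
      eq : ∀ x y → ⟦ X x ⟧ * (⟦ Y y ∧ N c x y ⟧ * f x y) ≡ ⟦ Y y ⟧ * (⟦ X x ∧ N c y x ⟧ * f x y)
      eq x y rewrite ⟦∧⟧ (Y y) (N c x y) | ⟦∧⟧ (X x) (N c y x) | N-sym c x y = swap ⟦ X x ⟧ ⟦ Y y ⟧ ⟦ N c y x ⟧ (f x y)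

    ∑∈-outside : ∀ b X v f → X v ≡ false → ∑∈ X f ≡ ∑∈ (X ∩ N b v) f + ∑∈ (X ∩ N (not b) v) f
    ∑∈-outside b X v f Xv = trans (∑∈-split X (N b v) f)
      (cong (λ t → ∑∈ (X ∩ N b v) f + t) (sum-cong-≗ (λ u → cong (λ c → ⟦ c ⟧ * f u) (eq u))))
      where
      eq : ∀ u → X u ∧ not (N b v u) ≡ X u ∧ N (not b) v u
      eq u with X u in Xu
      ... | false = refl
      ... | true with N b v u in Nu
      ...   | true  = sym (N-disjoint v u Nu)
      ...   | false = sym (N-complement b (λ e → contradiction (trans (sym Xu) (trans (cong X (sym e)) Xv)) λ ()) Nu)

    ∑∈-inside : ∀ b X v f → X v ≡ true →
      ∑∈ X f ≡ f v + (∑∈ (X ∩ N b v) f + ∑∈ (X ∩ N (not b) v) f)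
    ∑∈-inside b X v f Xv = begin
      ∑∈ X f
        ≡⟨ ∑∈-split X ｛v｝ f ⟩
      ∑∈ (X ∩ ｛v｝) f + ∑∈ X′ f
        ≡⟨ cong₂ _+_ (trans (sum-cong-≗ only-v) (trans (sym (*-distribˡ-sum (f v) (λ u → ⟦ ｛v｝ u ⟧)))
             (trans (cong (f v *_) (size-singleton v)) (*-identityʳ (f v)))))
             (∑∈-outside b X′ v f (trans (cong (λ d → X v ∧ not d) (dec-true (v Fin.≟ v) refl)) (Bool.∧-zeroʳ (X v)))) ⟩
      f v + (∑∈ (X′ ∩ N b v) f + ∑∈ (X′ ∩ N (not b) v) f)
        ≡⟨ cong (λ t → f v + t) (cong₂ _+_ (sum-cong-≗ (drop b)) (sum-cong-≗ (drop (not b)))) ⟩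
      f v + (∑∈ (X ∩ N b v) f + ∑∈ (X ∩ N (not b) v) f) ∎
      where
      open ≡-Reasoning
      ｛v｝ X′ : VertexSet
      ｛v｝ u = does (v Fin.≟ u)
      X′ = X ∖ ｛v｝
      only-v : ∀ u → ⟦ (X ∩ ｛v｝) u ⟧ * f u ≡ f v * ⟦ ｛v｝ u ⟧
      only-v u with v Fin.≟ u
      ... | yes refl rewrite Xv = *-comm 1 (f v)
      ... | no _ rewrite Bool.∧-zeroʳ (X u) = sym (*-zeroʳ (f v))
      drop : ∀ c u → ⟦ (X′ ∩ N c v) u ⟧ * f u ≡ ⟦ (X ∩ N c v) u ⟧ * f u
      drop c u with v Fin.≟ u
      ... | yes refl = cong (λ d → ⟦ d ⟧ * f u) (trans (Bool.∧-zeroʳ (X v ∧ not true)) (sym (Bool.∧-zeroʳ (X v))))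
      ... | no _ = cong (λ d → ⟦ d ∧ does (colour v u Bool.≟ c) ⟧ * f u) (Bool.∧-identityʳ (X u))

    deg-inside : ∀ b X v → X v ≡ true → size X ≡ suc (deg b v X + deg (not b) v X)
    deg-inside b X v Xv = begin
      size X                                                      ≡⟨ ∑∈-1 X ⟨
      ∑∈ X (λ _ → 1)                                              ≡⟨ ∑∈-inside b X v (λ _ → 1) Xv ⟩
      suc (∑∈ (X ∩ N b v) (λ _ → 1) + ∑∈ (X ∩ N (not b) v) (λ _ → 1))
        ≡⟨ cong suc (cong₂ _+_ (∑∈-1 (X ∩ N b v)) (∑∈-1 (X ∩ N (not b) v))) ⟩
      suc (deg b v X + deg (not b) v X)                           ∎
      where open ≡-Reasoning

    size-outside : ∀ b X v → X v ≡ false → size X ≡ deg b v X + deg (not b) v X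
    size-outside b X v Xv = trans (sym (∑∈-1 X)) (trans (∑∈-outside b X v (λ _ → 1) Xv)
      (cong₂ _+_ (∑∈-1 (X ∩ N b v)) (∑∈-1 (X ∩ N (not b) v))))

    deg-∑∈ : ∀ c w X → ∑∈ X (λ u → ⟦ N c w u ⟧) ≡ deg c w X
    deg-∑∈ c w X = sum-cong-≗ (λ u → sym (⟦∧⟧ (X u) (N c w u)))

    -- Bookkeeping for codegrees: seen from `v`, a neighbour of `w` is `v` itself or lies on one of
    -- the two sides of `v`.
    deg-via : ∀ b c w X v → X v ≡ true →
      deg c w X ≡ ⟦ N c w v ⟧ + (deg c w (X ∩ N b v) + deg c w (X ∩ N (not b) v))
    deg-via b c w X v Xv = begin
      deg c w X
        ≡⟨ deg-∑∈ c w X ⟨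
      ∑∈ X (λ u → ⟦ N c w u ⟧)
        ≡⟨ ∑∈-inside b X v (λ u → ⟦ N c w u ⟧) Xv ⟩
      ⟦ N c w v ⟧ + (∑∈ (X ∩ N b v) (λ u → ⟦ N c w u ⟧) + ∑∈ (X ∩ N (not b) v) (λ u → ⟦ N c w u ⟧))
        ≡⟨ cong (λ t → ⟦ N c w v ⟧ + t) (cong₂ _+_ (deg-∑∈ c w (X ∩ N b v)) (deg-∑∈ c w (X ∩ N (not b) v))) ⟩
      ⟦ N c w v ⟧ + (deg c w (X ∩ N b v) + deg c w (X ∩ N (not b) v)) ∎
      where open ≡-Reasoning

    deg-via-outside : ∀ b c w X v → X v ≡ false →
      deg c w X ≡ deg c w (X ∩ N b v) + deg c w (X ∩ N (not b) v)
    deg-via-outside b c w X v Xv = trans (sym (deg-∑∈ c w X)) (trans (∑∈-outside b X v (λ u → ⟦ N c w u ⟧) Xv)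
      (cong₂ _+_ (deg-∑∈ c w (X ∩ N b v)) (deg-∑∈ c w (X ∩ N (not b) v))))

    N-disjoint′ : ∀ {b} u v → N (not b) u v ≡ true → N b u v ≡ false
    N-disjoint′ {b} u v h = subst (λ c → N c u v ≡ false) (Bool.not-involutive b) (N-disjoint {not b} u v h)

    deg-swap : ∀ c w (X Y Z : VertexSet) → deg c w (X ∩ Y ∩ Z) ≡ deg c w (X ∩ Z ∩ Y)
    deg-swap c w X Y Z = size-cong (λ u → cong (_∧ N c w u) (trans (Bool.∧-assoc (X u) (Y u) (Z u))
      (trans (cong (X u ∧_) (Bool.∧-comm (Y u) (Z u))) (sym (Bool.∧-assoc (X u) (Z u) (Y u))))))

    deg-mono : ∀ c w {X Y} → (∀ u → X u ≡ true → Y u ≡ true) → deg c w X ≤ deg c w Y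
    deg-mono c w {X} h = size-mono (λ u p → ∧-intro (h u (∧-elimˡ p)) (∧-elimʳ {X u} p))

-- Vertex sets without threshold subgraphs of small order

+-lower : ∀ {a b p q} → a + b ≡ p + q → b ≤ q → p ≤ a
+-lower {a} {b} {p} {q} e b≤q = +-cancelʳ-≤ q p a (subst (_≤ a + q) e (+-monoʳ-≤ a b≤q))

p≤d≤1+p : ∀ {p d} → p ≤ d → d ≤ suc p → d ≡ p ⊎ d ≡ suc p
p≤d≤1+p {p} {d} lo hi with m≤n⇒m<n∨m≡n lo
... | inj₁ lt = inj₂ (≤-antisym hi lt)
... | inj₂ e  = inj₁ (sym e)

symmetric-sum-even : ∀ {n} (g : Fin n → Fin n → ℕ) → (∀ i j → g i j ≡ g j i) → (∀ i → g i i ≡ 0) →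
  ∃[ m ] sum (λ i → sum (g i)) ≡ 2 * m
symmetric-sum-even {zero}  g _ _ = 0 , refl
symmetric-sum-even {suc n} g g-sym g-irr with symmetric-sum-even (λ i j → g (suc i) (suc j))
  (λ i j → g-sym (suc i) (suc j)) (λ i → g-irr (suc i))
... | m , e = row + m , (begin
  (g zero zero + row) + sum (λ i → g (suc i) zero + sum (λ j → g (suc i) (suc j)))
    ≡⟨ cong₂ _+_ (cong (_+ row) (g-irr zero)) (∑-distrib-+ (λ i → g (suc i) zero) (λ i → sum (λ j → g (suc i) (suc j)))) ⟩
  row + (sum (λ i → g (suc i) zero) + sum (λ i → sum (λ j → g (suc i) (suc j))))
    ≡⟨ cong (λ t → row + t) (cong₂ _+_ (sum-cong-≗ (λ i → g-sym (suc i) zero)) e) ⟩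
  row + (row + 2 * m)
    ≡⟨ eq row m ⟩
  2 * (row + m) ∎)
  where
  open ≡-Reasoning
  row = sum (λ j → g zero (suc j))
  eq : ∀ a b → a + (a + 2 * b) ≡ 2 * (a + b)
  eq = solve-∀

≡ᵇ0⇒≡0 : ∀ m → (m ≡ᵇ 0) ≡ true → m ≡ 0
≡ᵇ0⇒≡0 zero _ = refl

not≡ᵇ0⇒>0 : ∀ m → not (m ≡ᵇ 0) ≡ true → 0 < m
not≡ᵇ0⇒>0 (suc m) _ = z<s

both-colours : ∀ {P : Bool → Set} b → P b → P (not b) → ∀ c → P c
both-colours true  p q true  = p
both-colours true  p q false = q
both-colours false p q true  = q
both-colours false p q false = p

module Ramsey {n : ℕ} (colour : Fin n → Fin n → Bool) (colour-sym : ∀ u v → colour u v ≡ colour v u) where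

  open Coloured colour colour-sym

  -- The vertex of `more` is the one added last in the threshold construction, and `b` is its colour
  -- to all earlier vertices, which are then sought inside `N b v`.
  data Emb : ℕ → VertexSet {n} → Set where
    one  : ∀ {X} v → X v ≡ true → Emb 1 X
    more : ∀ {k X} v b → X v ≡ true → Emb k (X ∩ N b v) → Emb (suc k) X

  Free : ℕ → VertexSet → Set
  Free k X = ¬ Emb k X

  Cap : ℕ → ℕ → Set
  Cap k c = ∀ X → Free k X → size X ≤ c

  Emb? : ∀ k X → Dec (Emb k X)
  Emb? zero X = no λ ()
  Emb? (suc zero) X with Fin.any? (λ v → X v Bool.≟ true)
  ... | yes (v , p) = yes (one v p)
  ... | no ¬p = no λ { (one v p) → ¬p (v , p) ; (more _ _ _ ()) }
  Emb? (suc k@(suc _)) X with Fin.any? (λ v → (X v Bool.≟ true) ×-dec Emb? k (X ∩ N true v))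
                            | Fin.any? (λ v → (X v Bool.≟ true) ×-dec Emb? k (X ∩ N false v))
  ... | yes (v , p , e) | _ = yes (more v true p e)
  ... | no _ | yes (v , p , e) = yes (more v false p e)
  ... | no ¬t | no ¬f = no λ { (more v true p e) → ¬t (v , p , e) ; (more v false p e) → ¬f (v , p , e) }

  side-free : ∀ {k X} → Free (suc k) X → ∀ {v} → X v ≡ true → ∀ b → Free k (X ∩ N b v)
  side-free free Xv b e = free (more _ b Xv e)

  cap-double : ∀ {k c} → Cap k c → Cap (suc k) (suc (c + c))
  cap-double {k} {c} cap X free with size X in eq
  ... | zero = z≤n
  ... | suc m with size-∃ X (subst (0 <_) (sym eq) z<s)
  ...   | v , Xv = subst (_≤ suc (c + c)) (trans (sym (deg-inside true X v Xv)) eq)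
          (s≤s (+-mono-≤ (cap _ (side-free free Xv true)) (cap _ (side-free free Xv false))))

  handshake : ∀ b X → ∃[ m ] ∑∈ X (λ v → deg b v X) ≡ 2 * m
  handshake b X with symmetric-sum-even (λ v u → ⟦ X v ⟧ * ⟦ X u ∧ N b v u ⟧) g-sym
    (λ v → trans (cong (λ c → ⟦ X v ⟧ * ⟦ X v ∧ c ⟧) (N-irrefl b v))
      (trans (cong (λ c → ⟦ X v ⟧ * ⟦ c ⟧) (Bool.∧-zeroʳ (X v))) (*-zeroʳ ⟦ X v ⟧)))
    where
    swap : ∀ a b c → a * (b * c) ≡ b * (a * c)
    swap = solve-∀
    g-sym : ∀ v u → ⟦ X v ⟧ * ⟦ X u ∧ N b v u ⟧ ≡ ⟦ X u ⟧ * ⟦ X v ∧ N b u v ⟧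
    g-sym v u rewrite ⟦∧⟧ (X u) (N b v u) | ⟦∧⟧ (X v) (N b u v) | N-sym b u v = swap ⟦ X v ⟧ ⟦ X u ⟧ ⟦ N b v u ⟧
  ... | m , e = m , trans (sum-cong-≗ (λ v → *-distribˡ-sum ⟦ X v ⟧ (λ u → ⟦ X u ∧ N b v u ⟧))) e

  cap-double-odd : ∀ {k} c → Cap k (suc (c + c)) → Cap (suc k) (suc (c + c) + suc (c + c))
  cap-double-odd {k} c cap X free = s≤s⁻¹ (≤∧≢⇒< (cap-double cap X free) ≢)
    where
    d = suc (c + c)
    -- On 2d + 1 vertices both sides of every vertex would be full, so colour `true` would be
    -- regular of odd degree d on an odd number of vertices.
    ≢ : size X ≢ suc (d + d)
    ≢ e = even≢odd m (d * d + c) (trans (sym h) (trans (trans (∑∈-≡ X d regular) (cong (d *_) e)) (odd c)))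
      where
      m = proj₁ (handshake true X)
      h = proj₂ (handshake true X)
      regular : ∀ v → X v ≡ true → deg true v X ≡ d
      regular v Xv = ≤-antisym (cap _ (side-free free Xv true))
        (+-lower (suc-injective (trans (sym (deg-inside true X v Xv)) e)) (cap _ (side-free free Xv false)))
      odd : ∀ c → suc (c + c) * suc (suc (c + c) + suc (c + c)) ≡ suc (2 * (suc (c + c) * suc (c + c) + c))
      odd = solve-∀

  -- Ordered pairs are counted: twice the number of triangles of colour b at v.
  mono : Bool → Fin n → VertexSet → ℕ
  mono b v X = ∑∈ (X ∩ N b v) (λ u → deg b u (X ∩ N b v))

  -- The weights make every triangle count 6 in the sum over all vertices: a monochromatic one
  -- counts 2 at each of its vertices, any other counts 3 at the two vertices where its colours
  -- differ.
  goodmanTerm : VertexSet → Fin n → ℕ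
  goodmanTerm X v = mono true v X + mono false v X + 3 * (deg true v X * deg false v X)

  size-swap : ∀ (X Y Z : VertexSet {n}) → size (X ∩ Y ∩ Z) ≡ size (X ∩ Z ∩ Y)
  size-swap X Y Z = size-cong (λ u → trans (Bool.∧-assoc (X u) (Y u) (Z u))
    (trans (cong (X u ∧_) (Bool.∧-comm (Y u) (Z u))) (sym (Bool.∧-assoc (X u) (Z u) (Y u)))))

  private
    -- Ordered triples x, y, z whose pairs xy, xz, yz have the colours b, c, d. The two swaps below
    -- exchange x with y and y with z.
    triples : Bool → Bool → Bool → VertexSet → ℕ
    triples b c d X = ∑∈ X (λ x → ∑∈ (X ∩ N b x) (λ y → deg d y (X ∩ N c x)))

    triples-swap₁ : ∀ b c d X → triples b c d X ≡ triples b d c X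
    triples-swap₁ b c d X = trans (∑∈-N-comm b X X (λ x y → deg d y (X ∩ N c x)))
      (∑∈-cong X (λ y _ → ∑∈-cong (X ∩ N b y) (λ x _ → size-swap X (N c x) (N d y))))

    triples-swap₂ : ∀ b c d X → triples b c d X ≡ triples c b d X
    triples-swap₂ b c d X = ∑∈-cong X (λ x _ → deg-comm d {X ∩ N b x} {X ∩ N c x})

    squares : ∀ b X → ∑∈ X (λ v → mono b v X) + triples b b (not b) X + ∑∈ X (λ v → deg b v X)
      ≡ ∑∈ X (λ v → deg b v X * deg b v X)
    squares b X = begin
      ∑∈ X (λ v → mono b v X) + triples b b (not b) X + ∑∈ X (λ v → deg b v X)
        ≡⟨ cong (_+ ∑∈ X (λ v → deg b v X)) (∑∈-+ X _ _) ⟨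
      ∑∈ X (λ v → mono b v X + ∑∈ (X ∩ N b v) (λ y → deg (not b) y (X ∩ N b v))) + ∑∈ X (λ v → deg b v X)
        ≡⟨ ∑∈-+ X _ _ ⟨
      ∑∈ X (λ v → mono b v X + ∑∈ (X ∩ N b v) (λ y → deg (not b) y (X ∩ N b v)) + deg b v X)
        ≡⟨ ∑∈-cong X (λ v _ → at v) ⟩
      ∑∈ X (λ v → deg b v X * deg b v X) ∎
      where
      open ≡-Reasoning
      at : ∀ v → mono b v X + ∑∈ (X ∩ N b v) (λ y → deg (not b) y (X ∩ N b v)) + deg b v X ≡ deg b v X * deg b v X
      at v = begin
        mono b v X + ∑∈ Y (λ y → deg (not b) y Y) + size Y
          ≡⟨ cong₂ _+_ (∑∈-+ Y _ _) (∑∈-1 Y) ⟨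
        ∑∈ Y (λ y → deg b y Y + deg (not b) y Y) + ∑∈ Y (λ _ → 1)
          ≡⟨ ∑∈-+ Y _ _ ⟨
        ∑∈ Y (λ y → deg b y Y + deg (not b) y Y + 1)
          ≡⟨ ∑∈-≡ Y (size Y) (λ y p → trans (+-comm _ 1) (sym (deg-inside b Y y p))) ⟩
        size Y * size Y ∎
        where Y = X ∩ N b v

    products : ∀ b X → triples b (not b) b X + triples b (not b) (not b) X ≡ ∑∈ X (λ v → deg b v X * deg (not b) v X)
    products b X = trans (sym (∑∈-+ X _ _)) (∑∈-cong X (λ v _ → at v))
      where
      at : ∀ v → ∑∈ (X ∩ N b v) (λ y → deg b y (X ∩ N (not b) v)) +
        ∑∈ (X ∩ N b v) (λ y → deg (not b) y (X ∩ N (not b) v)) ≡ deg b v X * deg (not b) v X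
      at v = trans (sym (∑∈-+ (X ∩ N b v) _ _)) (trans
        (∑∈-≡ (X ∩ N b v) (deg (not b) v X) (λ y p → sym (size-outside b (X ∩ N (not b) v) y
          (trans (cong (X y ∧_) (N-disjoint v y (∧-elimʳ {X y} p))) (Bool.∧-zeroʳ (X y))))))
        (*-comm (deg (not b) v X) (deg b v X)))

  -- The sum is 6 times the number of triples, (m + 1) m (m - 1), stated without subtraction. The
  -- proof expands the square of the total degree m at each vertex and sorts pairs of neighbours by
  -- the colour between them.
  goodman : ∀ X m → size X ≡ suc m → ∑∈ X (goodmanTerm X) + m * suc m ≡ m * m * suc m
  goodman X m e = begin
    ∑∈ X (goodmanTerm X) + m * suc m
      ≡⟨ cong₂ _+_ (trans (∑∈-+ X _ _) (cong₂ _+_ (∑∈-+ X _ _) (∑∈-* X 3 _)))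
           (trans (cong (m *_) (sym e)) (trans (sym (∑∈-≡ X m degrees)) (∑∈-+ X _ _))) ⟩
    (M + M′) + 3 * P + (D + D′)
      ≡⟨ cong (λ p → (M + M′) + (p + 2 * P) + (D + D′)) (sym (products true X)) ⟩
    (M + M′) + ((triples true false true X + triples true false false X) + 2 * P) + (D + D′)
      ≡⟨ cong₂ (λ t t′ → (M + M′) + ((t + t′) + 2 * P) + (D + D′))
           (triples-swap₁ true false true X) (trans (triples-swap₂ true false false X) (triples-swap₁ false true false X)) ⟩
    (M + M′) + ((triples true true false X + triples false false true X) + 2 * P) + (D + D′)
      ≡⟨ arrange M M′ (triples true true false X) (triples false false true X) P D D′ ⟩
    (M + triples true true false X + D) + (M′ + triples false false true X + D′) + 2 * P
      ≡⟨ cong₂ (λ a b → a + b + 2 * P) (squares true X) (squares false X) ⟩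
    ∑∈ X (λ v → deg true v X * deg true v X) + ∑∈ X (λ v → deg false v X * deg false v X) + 2 * P
      ≡⟨ trans (∑∈-+ X _ _) (cong₂ _+_ (∑∈-+ X _ _) (∑∈-* X 2 _)) ⟨
    ∑∈ X (λ v → deg true v X * deg true v X + deg false v X * deg false v X + 2 * (deg true v X * deg false v X))
      ≡⟨ ∑∈-≡ X (m * m) (λ v p → trans (square (deg true v X) (deg false v X))
           (cong (λ d → d * d) (degrees v p))) ⟩
    m * m * size X
      ≡⟨ cong (m * m *_) e ⟩
    m * m * suc m ∎
    where
    open ≡-Reasoning
    M = ∑∈ X (λ v → mono true v X)
    M′ = ∑∈ X (λ v → mono false v X)
    P = ∑∈ X (λ v → deg true v X * deg false v X)
    D = ∑∈ X (λ v → deg true v X)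
    D′ = ∑∈ X (λ v → deg false v X)
    degrees : ∀ v → X v ≡ true → deg true v X + deg false v X ≡ m
    degrees v p = suc-injective (trans (sym (deg-inside true X v p)) e)
    arrange : ∀ a b t u p d e → (a + b) + ((t + u) + 2 * p) + (d + e) ≡ (a + t + d) + (b + u + e) + 2 * p
    arrange = solve-∀
    square : ∀ a b → a * a + b * b + 2 * (a * b) ≡ (a + b) * (a + b)
    square = solve-∀

  -- The equation for `c` makes it m (m - 1), the average term in Goodman's identity; a lower bound
  -- equal to the average is attained everywhere.
  goodman-tight : ∀ X c m → size X ≡ suc m → c * suc m + m * suc m ≡ m * m * suc m →
    (∀ v → X v ≡ true → c ≤ goodmanTerm X v) → ∀ v → X v ≡ true → c ≡ goodmanTerm X v
  goodman-tight X c m e c-eq lower = ∑∈-tight X lower (≤-reflexive (trans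
    (+-cancelʳ-≡ (m * suc m) _ _ (trans (goodman X m e) (sym c-eq)))
    (sym (trans (∑∈-const X c) (cong (c *_) e)))))

  other-side : ∀ {m X} b v → X v ≡ true → size X ≡ suc m → deg b v X + deg (not b) v X ≡ m
  other-side {X = X} b v Xv e = suc-injective (trans (sym (deg-inside b X v Xv)) e)

  deg-other : ∀ p {q} {X} b v → X v ≡ true → size X ≡ suc (p + q) → deg b v X ≡ p → deg (not b) v X ≡ q
  deg-other p {q} {X} b v Xv e d = +-cancelˡ-≡ p _ q (trans (cong (_+ deg (not b) v X) (sym d)) (other-side b v Xv e))

  ∑∈-zero : ∀ (X : VertexSet {n}) {f} → ∑∈ X f ≡ 0 → ∀ v → X v ≡ true → f v ≡ 0
  ∑∈-zero X {f} e v Xv = sym (∑∈-tight X {λ _ → 0} (λ _ _ → z≤n)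
    (subst₂ _≤_ (sym e) (sym (∑∈-const X 0)) z≤n) v Xv)

  side-lower : ∀ {k c X} p → Cap k c → Free (suc k) X → size X ≡ suc (p + c) →
    ∀ v → X v ≡ true → ∀ b → p ≤ deg b v X
  side-lower p cap free e v Xv b = +-lower (other-side b v Xv e) (cap _ (side-free free Xv (not b)))

  deg-pos : ∀ {b X} v u → X u ≡ true → N b v u ≡ true → 0 < deg b v X
  deg-pos {b} {X} v u Xu Nu = subst (0 <_) (sym (deg-inside true (X ∩ N b v) u (∧-intro {X u} Xu Nu))) z<s

  deg-zero : ∀ {b X} v u → deg b v X ≡ 0 → X u ≡ true → N b v u ≡ true → ⊥
  deg-zero {b} {X} v u e Xu Nu = <⇒≢ (deg-pos {b} {X} v u Xu Nu) (sym e)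

  cap₁ : Cap 1 0
  cap₁ X free = ≮⇒≥ λ lt → free (one _ (proj₂ (size-∃ X lt)))

  cap₂ : Cap 2 1
  cap₂ = cap-double cap₁

  cap₃ : Cap 3 2
  cap₃ = cap-double-odd 0 cap₂

  cap₄ : Cap 4 5
  cap₄ = cap-double cap₃

  deg-in-4 : ∀ {X} → Free 4 X → size X ≡ 4 → ∀ v → X v ≡ true → ∀ b → 1 ≤ deg b v X
  deg-in-4 = side-lower 1 cap₃

  deg-in-5 : ∀ {X} → Free 4 X → size X ≡ 5 → ∀ v → X v ≡ true → ∀ b → deg b v X ≡ 2
  deg-in-5 free e v Xv b = ≤-antisym (cap₃ _ (side-free free Xv b)) (side-lower 2 cap₃ free e v Xv b)

  -- The mixed part 3·2·2 alone already equals the average 4·3, so nothing is left for monochromatic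
  -- triangles: both colours form a 5-cycle.
  triangle-free-5 : ∀ {X} → size X ≡ 5 → (∀ v → X v ≡ true → ∀ b → deg b v X ≡ 2) →
    ∀ v → X v ≡ true → ∀ b u → (X ∩ N b v) u ≡ true → deg b u (X ∩ N b v) ≡ 0
  triangle-free-5 {X} e degs v Xv b u h = ∑∈-zero (X ∩ N b v) (no-mono b) u h
    where
    twelve : ∀ v → X v ≡ true → 12 ≤ goodmanTerm X v
    twelve v Xv rewrite degs v Xv true | degs v Xv false = m≤n+m 12 _
    tight : 12 ≡ goodmanTerm X v
    tight = goodman-tight X 12 4 e refl twelve v Xv
    both : mono true v X + mono false v X ≡ 0
    both = +-cancelʳ-≡ 12 _ 0 (trans (cong₂ (λ a b → mono true v X + mono false v X + 3 * (a * b))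
      (sym (degs v Xv true)) (sym (degs v Xv false))) (sym tight))
    no-mono : ∀ b → mono b v X ≡ 0
    no-mono true  = m+n≡0⇒m≡0 _ both
    no-mono false = m+n≡0⇒n≡0 (mono true v X) both

  mono-4 : ∀ {X} → Free 5 X → ∀ v → X v ≡ true → ∀ b → deg b v X ≡ 4 → 4 ≤ mono b v X
  mono-4 {X} free v Xv b e = subst (_≤ mono b v X) (cong (1 *_) e)
    (∑∈-≥ (X ∩ N b v) 1 (λ u p → deg-in-4 (side-free free Xv b) e u p b))

  mono-5 : ∀ {X} → Free 5 X → ∀ v → X v ≡ true → ∀ b → deg b v X ≡ 5 → mono b v X ≡ 10
  mono-5 {X} free v Xv b e = trans (∑∈-≡ (X ∩ N b v) 2 (λ u p → deg-in-5 (side-free free Xv b) e u p b))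
    (cong (2 *_) e)

  -- The handshake argument leaves only 10 vertices to exclude. There every vertex has degrees 4 and
  -- 5 and contributes at least 4 + 10 + 3·20 = 74, while Goodman's sum is 10·9·8 = 720.
  cap₅ : Cap 5 9
  cap₅ X free = s≤s⁻¹ (≤∧≢⇒< (cap-double-odd 2 cap₄ X free) λ e →
    <⇒≱ (≤ᵇ⇒≤ 721 740 tt) (subst₂ _≤_ (cong (74 *_) e) (+-cancelʳ-≡ 90 _ 720 (goodman X 9 e))
      (∑∈-≥ X 74 (bound e))))
    where
    bound : size X ≡ 10 → ∀ v → X v ≡ true → 74 ≤ goodmanTerm X v
    bound e v Xv with p≤d≤1+p (side-lower 4 cap₄ free e v Xv true) (cap₄ _ (side-free free Xv true))
    ... | inj₁ d = subst (λ t → 74 ≤ mono true v X + mono false v X + 3 * t) (sym (cong₂ _*_ d d′))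
          (+-monoˡ-≤ 60 (+-mono-≤ (mono-4 free v Xv true d) (≤-reflexive (sym (mono-5 free v Xv false d′)))))
      where d′ = deg-other 4 true v Xv e d
    ... | inj₂ d = subst (λ t → 74 ≤ mono true v X + mono false v X + 3 * t) (sym (cong₂ _*_ d d′))
          (+-monoˡ-≤ 60 (+-mono-≤ (≤-reflexive (sym (mono-5 free v Xv true d))) (mono-4 free v Xv false d′)))
      where d′ = deg-other 5 true v Xv e d

  deg-other′ : ∀ {p} q {X} b v → X v ≡ true → size X ≡ suc (p + q) → deg (not b) v X ≡ q → deg b v X ≡ p
  deg-other′ {p} q {X} b v Xv e d =
    +-cancelʳ-≡ q _ p (trans (cong (λ t → deg b v X + t) (sym d)) (other-side b v Xv e))

  N-flip : ∀ {b u v c} → N b u v ≡ c → N b v u ≡ c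
  N-flip {b} {u} {v} h = trans (N-sym b v u) h

  -- This is (i - 1)(i - 2) ≥ 0, valid for every natural number i; it is sharp at 1 and 2.
  3i≤i²+2 : ∀ i → 3 * i ≤ i * i + 2
  3i≤i²+2 0 = z≤n
  3i≤i²+2 1 = ≤-refl
  3i≤i²+2 (suc (suc k)) = subst (3 * (2 + k) ≤_) (eq k) (m≤m+n (3 * (2 + k)) ((1 + k) * k))
    where
    eq : ∀ k → 3 * (2 + k) + (1 + k) * k ≡ (2 + k) * (2 + k) + 2
    eq = solve-∀

  -- Otherwise every ρ in the 3-vertex side R has 5 neighbours of colour b, and
  -- the b-degrees i of the 5-vertex side C into R satisfy ∑i = 9 and ∑i² ≤ 15.
  mono-3 : ∀ {X} → Free 5 X → size X ≡ 9 → ∀ v → X v ≡ true → ∀ b → deg b v X ≡ 5 → 2 ≤ mono (not b) v X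
  mono-3 {X} free size≡9 v Xv b blue≡5 with mono (not b) v X in mono≡ | handshake (not b) (X ∩ N (not b) v)
  ... | suc m | suc k , e = subst (2 ≤_) (sym e) (*-monoʳ-≤ 2 (s≤s z≤n))
  ... | zero | _ = ⊥-elim (<⇒≱ (≤ᵇ⇒≤ 26 27 tt) 27≤25)
    where
    r = not b
    R C : VertexSet
    R = X ∩ N r v
    C = X ∩ N b v
    sizeR : size R ≡ 3
    sizeR = deg-other 5 b v Xv size≡9 blue≡5
    isolated : ∀ ρ → R ρ ≡ true → deg r ρ R ≡ 0
    isolated = ∑∈-zero R mono≡
    module _ (ρ : Fin n) (Rρ : R ρ ≡ true) where
      Xρ : X ρ ≡ true
      Xρ = ∧-elimˡ Rρ
      Nρv : N r ρ v ≡ true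
      Nρv = N-flip {r} {v} {ρ} (∧-elimʳ {X ρ} Rρ)
      v-isolated : deg r v (X ∩ N r ρ) ≡ 0
      v-isolated = trans (size-swap X (N r ρ) (N r v)) (isolated ρ Rρ)
      -- With 4 or 5 neighbours of colour r, the side of ρ containing `v` would give `v` a neighbour
      -- of colour r, contrary to `v-isolated`.
      red≡3 : deg r ρ X ≡ 3
      red≡3 with m≤n⇒m<n∨m≡n (side-lower 3 cap₄ free size≡9 ρ Xρ r)
      ... | inj₂ e = sym e
      ... | inj₁ lt with p≤d≤1+p lt (cap₄ _ (side-free free Xρ r))
      ...   | inj₁ e = contradiction (deg-in-4 (side-free free Xρ r) e v (∧-intro Xv Nρv) r)
                (subst (λ d → ¬ 1 ≤ d) (sym v-isolated) λ ())
      ...   | inj₂ e with () ← trans (sym v-isolated) (deg-in-5 (side-free free Xρ r) e v (∧-intro Xv Nρv) r)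
      blue≡5ρ : deg b ρ X ≡ 5
      blue≡5ρ = deg-other′ 3 b ρ Xρ size≡9 red≡3
      blueR≡2 : deg b ρ R ≡ 2
      blueR≡2 = deg-other′ 0 b ρ Rρ sizeR (isolated ρ Rρ)
      blueC≡3 : deg b ρ C ≡ 3
      blueC≡3 = +-cancelʳ-≡ 2 _ 3 (sym (trans (sym blue≡5ρ) (trans (deg-via b b ρ X v Xv)
        (cong₂ (λ a d → ⟦ a ⟧ + (deg b ρ C + d)) (N-disjoint′ ρ v Nρv) blueR≡2))))
      -- Among the 5 b-neighbours of ρ, which form a 5-cycle, σ has 2 b-neighbours. One of them is
      -- the third vertex of `R`, so exactly one lies in `C`.
      common≡1 : ∀ σ → (R ∩ N b ρ) σ ≡ true → deg b σ (C ∩ N b ρ) ≡ 1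
      common≡1 σ h = +-cancelʳ-≡ 1 _ 1 (sym (begin
        2
          ≡⟨ deg-in-5 (side-free free Xρ b) blue≡5ρ σ (∧-intro (∧-elimˡ {X σ} (∧-elimˡ h)) (∧-elimʳ {R σ} h)) b ⟨
        deg b σ (X ∩ N b ρ)
          ≡⟨ deg-via-outside b b σ (X ∩ N b ρ) v
               (trans (cong (X v ∧_) (N-disjoint′ ρ v Nρv)) (Bool.∧-zeroʳ (X v))) ⟩
        deg b σ (X ∩ N b ρ ∩ N b v) + deg b σ (X ∩ N b ρ ∩ N r v)
          ≡⟨ cong₂ _+_ (deg-swap b σ X (N b ρ) (N b v)) (trans (deg-swap b σ X (N b ρ) (N r v)) inR) ⟩
        deg b σ (C ∩ N b ρ) + 1 ∎))
        where
        open ≡-Reasoning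
        inR : deg b σ (R ∩ N b ρ) ≡ 1
        inR = deg-other′ 0 b σ h blueR≡2 (n≤0⇒n≡0 (subst (deg r σ (R ∩ N b ρ) ≤_) (isolated σ (∧-elimˡ h))
          (deg-mono r σ (λ u → ∧-elimˡ {R u}))))
      ∑common≡5 : ∑∈ R (λ σ → deg b σ (C ∩ N b ρ)) ≤ 5
      ∑common≡5 = begin
        ∑∈ R f
          ≡⟨ ∑∈-inside b R ρ f Rρ ⟩
        f ρ + (∑∈ (R ∩ N b ρ) f + ∑∈ (R ∩ N r ρ) f)
          ≤⟨ +-mono-≤ (≤-trans (size-mono {X = C ∩ N b ρ ∩ N b ρ} {C ∩ N b ρ} (λ u → ∧-elimˡ)) (≤-reflexive blueC≡3))
               (≤-reflexive (cong₂ _+_ (trans (∑∈-≡ (R ∩ N b ρ) 1 common≡1) (cong (1 *_) blueR≡2))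
                 (∑∈-≡ (R ∩ N r ρ) 0 (λ u h → ⊥-elim (deg-zero {r} {R} ρ u (isolated ρ Rρ) (∧-elimˡ h) (∧-elimʳ {R u} h)))))) ⟩
        5 ∎
        where
        open ≤-Reasoning
        f = λ σ → deg b σ (C ∩ N b ρ)
    i : Fin n → ℕ
    i c = deg b c R
    ∑i : ∑∈ C i ≡ 9
    ∑i = trans (deg-comm b {C} {R}) (trans (∑∈-≡ R 3 blueC≡3) (cong (3 *_) sizeR))
    -- The left side counts the vertices of `C` together with ordered pairs of b-neighbours in `R`.
    -- Regrouped by ρ it has 3 rows, each at most 3 + 1 + 1.
    ∑i² : ∑∈ C (λ c → i c * i c) ≤ 15
    ∑i² = begin
      ∑∈ C (λ c → i c * i c)
        ≡⟨ ∑∈-cong C (λ c _ → ∑∈-const (R ∩ N b c) (i c)) ⟨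
      ∑∈ C (λ c → ∑∈ (R ∩ N b c) (λ _ → i c))
        ≡⟨ ∑∈-N-comm b C R (λ c _ → i c) ⟩
      ∑∈ R (λ ρ → ∑∈ (C ∩ N b ρ) i)
        ≡⟨ ∑∈-cong R (λ ρ _ → deg-comm b {C ∩ N b ρ} {R}) ⟩
      ∑∈ R (λ ρ → ∑∈ R (λ σ → deg b σ (C ∩ N b ρ)))
        ≤⟨ ∑∈-≤ R 5 ∑common≡5 ⟩
      5 * size R
        ≡⟨ cong (5 *_) sizeR ⟩
      15 ∎
      where open ≤-Reasoning
    27≤25 : 27 ≤ 25
    27≤25 = begin
      27                                ≡⟨ cong (3 *_) ∑i ⟨
      3 * ∑∈ C i                        ≡⟨ ∑∈-* C 3 i ⟨
      ∑∈ C (λ c → 3 * i c)              ≤⟨ ∑∈-mono C (λ c _ → 3i≤i²+2 (i c)) ⟩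
      ∑∈ C (λ c → i c * i c + 2)        ≡⟨ ∑∈-+ C _ _ ⟩
      ∑∈ C (λ c → i c * i c) + ∑∈ C (λ _ → 2)
        ≤⟨ +-mono-≤ ∑i² (≤-reflexive (trans (∑∈-const C 2) (cong (2 *_) blue≡5))) ⟩
      25 ∎
      where open ≤-Reasoning

  -- X is the Paley graph on 9 vertices; only these regularity properties are needed.
  module Nine {X} (free : Free 5 X) (size≡9 : size X ≡ 9) where

    -- Degrees 3 and 5 give at least 10 + 2 + 3·15 = 57, above the average 8·7 = 56; the 2 comes
    -- from `mono-3`. Only the degrees 4 and 4 remain possible.
    57≤⊎4 : ∀ v → X v ≡ true → 57 ≤ goodmanTerm X v ⊎ deg true v X ≡ 4
    57≤⊎4 v Xv with m≤n⇒m<n∨m≡n (side-lower 3 cap₄ free size≡9 v Xv true)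
    ... | inj₂ 3≡ = inj₁ (subst₂ (λ d d′ → 57 ≤ mono true v X + mono false v X + 3 * (d * d′)) 3≡ (sym 5≡)
        (+-monoˡ-≤ 45 (+-mono-≤ (mono-3 free size≡9 v Xv false 5≡) (≤-reflexive (sym (mono-5 free v Xv false 5≡))))))
      where
      5≡ : deg false v X ≡ 5
      5≡ = deg-other 3 true v Xv size≡9 (sym 3≡)
    ... | inj₁ lt with p≤d≤1+p lt (cap₄ _ (side-free free Xv true))
    ...   | inj₁ 4≡ = inj₂ 4≡
    ...   | inj₂ 5≡ = inj₁ (subst₂ (λ d d′ → 57 ≤ mono true v X + mono false v X + 3 * (d * d′)) (sym 5≡) (sym (deg-other 5 true v Xv size≡9 5≡))
        (+-monoˡ-≤ 45 (+-mono-≤ (≤-reflexive (sym (mono-5 free v Xv true 5≡))) (mono-3 free size≡9 v Xv true 5≡))))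

    8≤mono : ∀ v → X v ≡ true → deg true v X ≡ 4 → 8 ≤ mono true v X + mono false v X
    8≤mono v Xv 4≡ = +-mono-≤ (mono-4 free v Xv true 4≡) (mono-4 free v Xv false (deg-other 4 true v Xv size≡9 4≡))

    56≤ : ∀ v → X v ≡ true → 56 ≤ goodmanTerm X v
    56≤ v Xv with 57≤⊎4 v Xv
    ... | inj₁ h  = ≤-trans (n≤1+n 56) h
    ... | inj₂ 4≡ = subst₂ (λ d d′ → 56 ≤ mono true v X + mono false v X + 3 * (d * d′)) (sym 4≡)
        (sym (deg-other 4 true v Xv size≡9 4≡)) (+-monoˡ-≤ 48 (8≤mono v Xv 4≡))

    56≡ : ∀ v → X v ≡ true → 56 ≡ goodmanTerm X v
    56≡ = goodman-tight X 56 8 size≡9 refl 56≤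

    4-regular : ∀ v → X v ≡ true → ∀ b → deg b v X ≡ 4
    4-regular v Xv b = both b
      where
      red : deg true v X ≡ 4
      red with 57≤⊎4 v Xv
      ... | inj₁ h  = ⊥-elim (<⇒≢ h (56≡ v Xv))
      ... | inj₂ 4≡ = 4≡
      both : ∀ b → deg b v X ≡ 4
      both true  = red
      both false = deg-other 4 true v Xv size≡9 red

    -- Of the term 56 the mixed part takes 3·16 = 48. The remaining 8 is shared by two sides that
    -- need at least 4 each, one neighbour for each of their 4 vertices, so all these bounds are
    -- equalities.
    sides-1-regular : ∀ v → X v ≡ true → ∀ b u → (X ∩ N b v) u ≡ true → deg b u (X ∩ N b v) ≡ 1
    sides-1-regular v Xv b u h = sym (∑∈-tight (X ∩ N b v) {λ _ → 1}
      (λ w p → deg-in-4 (side-free free Xv b) (4-regular v Xv b) w p b)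
      (≤-reflexive (trans (mono≡4 b) (sym (trans (∑∈-1 (X ∩ N b v)) (4-regular v Xv b))))) u h)
      where
      mono≡8 : mono true v X + mono false v X ≡ 8
      mono≡8 = +-cancelʳ-≡ 48 _ 8 (trans (cong₂ (λ d d′ → mono true v X + mono false v X + 3 * (d * d′))
        (sym (4-regular v Xv true)) (sym (4-regular v Xv false))) (sym (56≡ v Xv)))
      4≤ : ∀ b → 4 ≤ mono b v X
      4≤ b = mono-4 free v Xv b (4-regular v Xv b)
      mono≡4 : ∀ b → mono b v X ≡ 4
      mono≡4 true  = ≤-antisym (+-lower (sym mono≡8) (4≤ false)) (4≤ true)
      mono≡4 false = ≤-antisym (+-lower (sym (trans (+-comm (mono false v X) _) mono≡8)) (4≤ true)) (4≤ false)

  -- A third vertex would close a monochromatic triangle in the 5-cycle.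
  clique-≤2 : ∀ {C} b → size C ≡ 5 → (∀ v → C v ≡ true → ∀ b → deg b v C ≡ 2) →
    ∀ Z → (∀ v → Z v ≡ true → C v ≡ true) → (∀ v → Z v ≡ true → deg (not b) v Z ≡ 0) → size Z ≤ 2
  clique-≤2 {C} b e degs Z Z⊆C clique = ≮⇒≥ λ 3≤Z →
    let (z , Zz) = size-∃ Z (<-trans z<s 3≤Z)
        2≤ = s≤s⁻¹ (subst (3 ≤_) (trans (deg-inside b Z z Zz) (cong (λ d → suc (deg b z Z + d)) (clique z Zz))) 3≤Z)
        (y , h) = size-∃ (Z ∩ N b z) (<-≤-trans z<s (subst (2 ≤_) (+-identityʳ _) 2≤))
        Zy = ∧-elimˡ {Z y} h
        deg₀ = λ c (le : deg c y (Z ∩ N b z) ≤ 0) → n≤0⇒n≡0 le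
    in <⇒≱ (subst (1 <_) (trans (+-identityʳ _) (trans (deg-inside b (Z ∩ N b z) y h) (cong₂ (λ d d′ → suc (d + d′))
      (deg₀ b (subst (deg b y (Z ∩ N b z) ≤_) (triangle-free-5 e degs z (Z⊆C z Zz) b y (∧-intro (Z⊆C y Zy) (∧-elimʳ {Z y} h)))
        (deg-mono b y (λ u p → ∧-intro (Z⊆C u (∧-elimˡ p)) (∧-elimʳ {Z u} p)))))
      (deg₀ (not b) (subst (deg (not b) y (Z ∩ N b z) ≤_) (clique y Zy) (deg-mono (not b) y (λ u → ∧-elimˡ {Z u}))))))) 2≤) ≤-refl

  module Eight {X} (free : Free 5 X) (size≡8 : size X ≡ 8) (b : Bool) where

    degree-sum : ℕ
    degree-sum = ∑∈ X (λ v → deg b v X)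

    -- Two vertices of the 5-vertex side C that have no b-neighbours in the other
    -- side R must be b-adjacent. As C has no triangles, there are at most two of them.
    module _ (v : Fin n) (Xv : X v ≡ true) (deg≡2 : deg b v X ≡ 2) where
      r = not b
      C R Z : VertexSet
      C = X ∩ N r v
      R = X ∩ N b v
      sizeC : size C ≡ 5
      sizeC = deg-other 2 b v Xv size≡8 deg≡2
      freeC : Free 4 C
      freeC = side-free free Xv r
      degC : ∀ c → C c ≡ true → ∀ b → deg b c C ≡ 2
      degC = deg-in-5 freeC sizeC
      j : Fin n → ℕ
      j c = deg b c R
      lonely : VertexSet
      lonely c = j c ≡ᵇ 0
      Z = C ∩ lonely
      NCv : ∀ c → C c ≡ true → N b c v ≡ false
      NCv c Cc = N-flip {b} {v} {c} (N-disjoint′ v c (∧-elimʳ {X c} Cc))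
      deg-C : ∀ c → C c ≡ true → deg b c X ≡ j c + 2
      deg-C c Cc = trans (deg-via b b c X v Xv) (cong₂ (λ a d → ⟦ a ⟧ + (j c + d)) (NCv c Cc) (degC c Cc b))
      deg-R : ∀ ρ → R ρ ≡ true → deg b ρ X ≡ 1 + (deg b ρ R + deg b ρ C)
      deg-R ρ Rρ = trans (deg-via b b ρ X v Xv) (cong (λ a → ⟦ a ⟧ + (deg b ρ R + deg b ρ C))
        (N-flip {b} {v} {ρ} (∧-elimʳ {X ρ} Rρ)))
      Z-j : ∀ c → Z c ≡ true → j c ≡ 0
      Z-j c Zc = ≡ᵇ0⇒≡0 (j c) (∧-elimʳ {C c} Zc)
      Z-clique : ∀ c → Z c ≡ true → deg r c Z ≡ 0
      Z-clique c Zc = n≤0⇒n≡0 (≮⇒≥ λ lt → let (c′ , h) = size-∃ (Z ∩ N r c) lt in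
          <⇒≱ (≤ᵇ⇒≤ 2 2 tt) (impossible c′ (∧-elimˡ h) (∧-elimʳ {Z c′} h)))
        where
        Cc : C c ≡ true
        Cc = ∧-elimˡ Zc
        Xc : X c ≡ true
        Xc = ∧-elimˡ Cc
        size-side : deg r c X ≡ 5
        size-side = deg-other 2 b c Xc size≡8 (trans (deg-C c Cc) (cong (_+ 2) (Z-j c Zc)))
        -- As c has b-degree 2, its r-side is a 5-cycle, where c′ needs 2 b-neighbours. Neither `v`
        -- nor `R` supplies any, and `C ∩ N r c` has only one vertex besides c′.
        impossible : ∀ c′ → Z c′ ≡ true → N r c c′ ≡ true → 2 ≤ 1
        impossible c′ Zc′ Ncc′ = begin
          2
            ≡⟨ deg-in-5 (side-free free Xc r) size-side c′ (∧-intro {X c′} (∧-elimˡ (∧-elimˡ {C c′} Zc′)) Ncc′) b ⟨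
          deg b c′ (X ∩ N r c)
            ≡⟨ deg-via b b c′ (X ∩ N r c) v (∧-intro Xv (N-flip {r} {v} {c} (∧-elimʳ {X c} Cc))) ⟩
          ⟦ N b c′ v ⟧ + (deg b c′ (X ∩ N r c ∩ N b v) + deg b c′ (X ∩ N r c ∩ N r v))
            ≡⟨ cong₂ (λ a d → ⟦ a ⟧ + d) (NCv c′ (∧-elimˡ Zc′))
                 (cong₂ _+_ (deg-swap b c′ X (N r c) (N b v)) (deg-swap b c′ X (N r c) (N r v))) ⟩
          deg b c′ (R ∩ N r c) + deg b c′ (C ∩ N r c)
            ≤⟨ +-mono-≤ (≤-trans (deg-mono b c′ (λ u → ∧-elimˡ {R u})) (≤-reflexive (Z-j c′ Zc′)))
                 (s≤s⁻¹ (≤-trans (s≤s (m≤m+n _ (deg r c′ (C ∩ N r c)))) (≤-reflexive (trans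
                   (sym (deg-inside b (C ∩ N r c) c′ (∧-intro {C c′} (∧-elimˡ Zc′) Ncc′))) (degC c Cc r))))) ⟩
          1 ∎
          where open ≤-Reasoning
      3≤C∖Z : 3 ≤ size (C ∖ lonely)
      3≤C∖Z = +-lower {b = size Z} {3} {2} (trans (+-comm _ (size Z)) (trans (sym (size-split C lonely)) sizeC))
        (clique-≤2 b sizeC degC Z (λ u → ∧-elimˡ) Z-clique)
      1≤j : ∀ c → (C ∖ lonely) c ≡ true → 1 ≤ j c
      1≤j c h = not≡ᵇ0⇒>0 (j c) (∧-elimʳ {C c} h)
      ∑j-split : ∑∈ C j ≡ ∑∈ (C ∖ lonely) j
      ∑j-split = trans (∑∈-split C lonely j) (cong (_+ ∑∈ (C ∖ lonely) j) (∑∈-≡ Z 0 Z-j))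
      C∖Z≤∑j : size (C ∖ lonely) ≤ ∑∈ C j
      C∖Z≤∑j = subst₂ _≤_ (∑∈-1 (C ∖ lonely)) (sym ∑j-split) (∑∈-mono (C ∖ lonely) 1≤j)
      3≤∑j : 3 ≤ ∑∈ C j
      3≤∑j = ≤-trans 3≤C∖Z C∖Z≤∑j
      -- The constant 14 is 2 at `v`, 1 for the edge to `v` at each of the two vertices of `R`, and
      -- 10 inside the 5-cycle `C`. Edges between `C` and `R` count twice.
      sum≡ : degree-sum ≡ 14 + (2 * ∑∈ C j + ∑∈ R (λ ρ → deg b ρ R))
      sum≡ = begin
        degree-sum
          ≡⟨ ∑∈-inside b X v (λ u → deg b u X) Xv ⟩
        deg b v X + (∑∈ R (λ u → deg b u X) + ∑∈ C (λ u → deg b u X))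
          ≡⟨ cong₂ _+_ deg≡2 (cong₂ _+_ (∑∈-cong R deg-R) (∑∈-cong C deg-C)) ⟩
        2 + (∑∈ R (λ ρ → 1 + (deg b ρ R + deg b ρ C)) + ∑∈ C (λ c → j c + 2))
          ≡⟨ cong (λ t → 2 + t) (cong₂ _+_ (trans (∑∈-+ R _ _) (cong₂ _+_ (trans (∑∈-1 R) deg≡2) (trans (∑∈-+ R _ _) (cong (λ t → D + t) (deg-comm b {R} {C})))))
               (trans (∑∈-+ C _ _) (cong (λ t → J + t) (trans (∑∈-const C 2) (cong (2 *_) sizeC))))) ⟩
        2 + ((2 + (D + J)) + (J + 10))
          ≡⟨ eq D J ⟩
        14 + (2 * J + D) ∎
        where
        open ≡-Reasoning
        J = ∑∈ C j
        D = ∑∈ R (λ ρ → deg b ρ R)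
        eq : ∀ D J → 2 + ((2 + (D + J)) + (J + 10)) ≡ 14 + (2 * J + D)
        eq = solve-∀
      20≤sum : 20 ≤ degree-sum
      20≤sum = subst (20 ≤_) (sym sum≡) (+-monoʳ-≤ 14 (≤-trans (*-monoʳ-≤ 2 3≤∑j) (m≤m+n _ _)))
      module _ (sum≡20 : degree-sum ≡ 20) where
        2J+D≡6 : 2 * ∑∈ C j + ∑∈ R (λ ρ → deg b ρ R) ≡ 6
        2J+D≡6 = +-cancelˡ-≡ 14 _ 6 (trans (sym sum≡) sum≡20)
        J≡3 : ∑∈ C j ≡ 3
        J≡3 = ≤-antisym (*-cancelˡ-≤ 2 (≤-trans (m≤m+n _ _) (≤-reflexive 2J+D≡6))) 3≤∑j
        D≡0 : ∑∈ R (λ ρ → deg b ρ R) ≡ 0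
        D≡0 = +-cancelˡ-≡ 6 _ 0 (trans (cong (λ J → 2 * J + ∑∈ R (λ ρ → deg b ρ R)) (sym J≡3)) 2J+D≡6)
        j≤1 : ∀ c → C c ≡ true → j c ≤ 1
        j≤1 c Cc with lonely c in eq
        ... | true  = subst (_≤ 1) (sym (≡ᵇ0⇒≡0 (j c) eq)) z≤n
        ... | false = ≤-reflexive (sym (∑∈-tight (C ∖ lonely) {λ _ → 1} 1≤j
            (subst₂ _≤_ (trans (sym J≡3) ∑j-split) (sym (∑∈-1 (C ∖ lonely))) 3≤C∖Z) c
            (∧-intro Cc (cong not eq))))
        deg-into-C : ∀ ρ → R ρ ≡ true → 1 ≤ deg b ρ C
        deg-into-C ρ Rρ = s≤s⁻¹ (subst (2 ≤_) (trans (deg-R ρ Rρ)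
          (cong (λ d → suc (d + deg b ρ C)) (∑∈-zero R D≡0 ρ Rρ))) (side-lower 2 cap₄ free size≡8 ρ (∧-elimˡ Rρ) b))
        -- The other vertex of `R` takes at least one of the 3 edges into `C`.
        deg-into-C≤2 : ∀ ρ → R ρ ≡ true → deg b ρ C ≤ 2
        deg-into-C≤2 ρ Rρ = +-cancelʳ-≤ 1 _ 2 (begin
          deg b ρ C + 1
            ≡⟨ cong (λ t → deg b ρ C + t) (deg-other 0 b ρ Rρ deg≡2 (∑∈-zero R D≡0 ρ Rρ)) ⟨
          deg b ρ C + size (R ∩ N r ρ)
            ≤⟨ +-monoʳ-≤ (deg b ρ C) (≤-trans (subst (_≤ ∑∈ (R ∩ N r ρ) (λ σ → deg b σ C)) (∑∈-1 (R ∩ N r ρ)) (∑∈-mono (R ∩ N r ρ)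
                 (λ σ h → deg-into-C σ (∧-elimˡ h)))) (m≤n+m _ _)) ⟩
          deg b ρ C + (∑∈ (R ∩ N b ρ) (λ σ → deg b σ C) + ∑∈ (R ∩ N r ρ) (λ σ → deg b σ C))
            ≡⟨ ∑∈-inside b R ρ (λ σ → deg b σ C) Rρ ⟨
          ∑∈ R (λ σ → deg b σ C)
            ≡⟨ trans (deg-comm b {R} {C}) J≡3 ⟩
          3 ∎)
          where open ≤-Reasoning
        all≤3 : ∀ u → X u ≡ true → deg b u X ≤ 3
        all≤3 u Xu with v Fin.≟ u
        ... | yes refl = subst (_≤ 3) (sym deg≡2) (≤ᵇ⇒≤ 2 3 tt)
        ... | no v≢u with N b v u in Nvu
        ...   | true = subst (_≤ 3) (sym (trans (deg-R u Ru)
                  (cong (λ d → suc (d + deg b u C)) (∑∈-zero R D≡0 u Ru)))) (s≤s (deg-into-C≤2 u Ru))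
            where Ru = ∧-intro Xu Nvu
        ...   | false = subst (_≤ 3) (sym (deg-C u Cu)) (+-monoˡ-≤ 2 (j≤1 u Cu))
            where Cu = ∧-intro Xu (N-complement b v≢u Nvu)

    -- Every b-degree is at least 2, because the other side has at most 5 vertices. If none equals 2
    -- the sum is at least 24; otherwise a vertex of degree 2 gives at least 14 + 2·3.
    sparse : (20 ≤ degree-sum) × (degree-sum ≡ 20 → ∀ u → X u ≡ true → deg b u X ≤ 3)
    sparse with Fin.any? (λ v → (X v Bool.≟ true) ×-dec (deg b v X ≟ 2))
    ... | yes (v , Xv , e) = 20≤sum v Xv e , all≤3 v Xv e
    ... | no none = ≤-trans (≤ᵇ⇒≤ 20 24 tt) 24≤ , λ e → contradiction (subst (24 ≤_) e 24≤) (<⇒≱ (≤ᵇ⇒≤ 21 24 tt))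
      where
      24≤ : 24 ≤ degree-sum
      24≤ = subst (_≤ degree-sum) (cong (3 *_) size≡8) (∑∈-≥ X 3 (λ v Xv →
        ≤∧≢⇒< (side-lower 2 cap₄ free size≡8 v Xv b) (λ e → none (v , Xv , sym e))))

  deg-split : ∀ c u X Y → deg c u X ≡ deg c u (X ∩ Y) + deg c u (X ∖ Y)
  deg-split c u X Y = trans (sym (deg-∑∈ c u X)) (trans (∑∈-split X Y (λ v → ⟦ N c u v ⟧))
    (cong₂ _+_ (deg-∑∈ c u (X ∩ Y)) (deg-∑∈ c u (X ∖ Y))))

  252+-≤ : ∀ m → 20 ≤ m → 272 ≤ 36 + m + 216
  252+-≤ m le = +-monoˡ-≤ 216 (+-monoʳ-≤ 36 le)

  252+-≡ : ∀ m → 272 ≡ 36 + m + 216 → m ≡ 20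
  252+-≡ m e = +-cancelˡ-≡ 36 m 20 (+-cancelʳ-≡ 216 (36 + m) 56 (sym e))

  module Eighteen {X} (free : Free 6 X) (size≡18 : size X ≡ 18) where

    goodmanTerm-flip : ∀ b v → goodmanTerm X v ≡ mono b v X + mono (not b) v X + 3 * (deg b v X * deg (not b) v X)
    goodmanTerm-flip true  v = refl
    goodmanTerm-flip false v = cong₂ (λ m d → m + 3 * d) (+-comm (mono true v X) _) (*-comm (deg true v X) _)

    mono-9 : ∀ v → X v ≡ true → ∀ b → deg b v X ≡ 9 → mono b v X ≡ 36
    mono-9 v Xv b 9≡ = trans (∑∈-≡ (X ∩ N b v) 4 (λ u p → Nine.4-regular (side-free free Xv b) 9≡ u p b)) (cong (4 *_) 9≡)

    term≡ : ∀ v → X v ≡ true → ∀ b → deg b v X ≡ 9 → goodmanTerm X v ≡ 36 + mono (not b) v X + 216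
    term≡ v Xv b 9≡ = trans (goodmanTerm-flip b v) (cong₂ (λ m d → m + mono (not b) v X + 3 * d)
      (mono-9 v Xv b 9≡) (cong₂ _*_ 9≡ (deg-other 9 b v Xv size≡18 9≡)))

    majority : ∀ v → X v ≡ true → deg true v X ≡ 9 ⊎ deg false v X ≡ 9
    majority v Xv = [ (λ 8≡ → inj₂ (deg-other 8 true v Xv size≡18 8≡)) , inj₁ ]′
      (p≤d≤1+p (side-lower 8 cap₅ free size≡18 v Xv true) (cap₅ _ (side-free free Xv true)))

    module _ (v : Fin n) (Xv : X v ≡ true) (b : Bool) (9≡ : deg b v X ≡ 9) where
      open Eight (side-free free Xv (not b)) (deg-other 9 b v Xv size≡18 9≡) (not b) using (sparse)

      -- The 9-vertex side contributes 9·4 = 36, the degrees 3·9·8 = 216 and the 8-vertex side at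
      -- least 20; the total is 17·16, exactly Goodman's average on 18 vertices.
      272≤term : 272 ≤ goodmanTerm X v
      272≤term = subst (272 ≤_) (sym (term≡ v Xv b 9≡)) (252+-≤ _ (proj₁ sparse))

      minority-sum : 272 ≡ goodmanTerm X v → mono (not b) v X ≡ 20
      minority-sum e = 252+-≡ _ (trans e (term≡ v Xv b 9≡))

      minority-sparse : 272 ≡ goodmanTerm X v → ∀ u → (X ∩ N (not b) v) u ≡ true → deg (not b) u (X ∩ N (not b) v) ≤ 3
      minority-sparse e = proj₂ sparse (minority-sum e)

    term≡272 : ∀ v → X v ≡ true → 272 ≡ goodmanTerm X v
    term≡272 = goodman-tight X 272 17 size≡18 refl 272≤
      where
      272≤ : ∀ v → X v ≡ true → 272 ≤ goodmanTerm X v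
      272≤ v Xv = [ 272≤term v Xv true , 272≤term v Xv false ]′ (majority v Xv)

    -- The b-codegree of the two vertices is 4 as seen from one of them and at most 3
    -- as seen from the other.
    clash : ∀ x y → X x ≡ true → X y ≡ true → deg true x X ≡ 9 → deg false y X ≡ 9 → ⊥
    clash x y Xx Xy 9≡x 9≡y = by-colour (N true x y) refl
      where
      x≢y : x ≢ y
      x≢y refl = <⇒≢ (≤ᵇ⇒≤ 9 9 tt) (trans (sym (deg-other 9 true x Xx size≡18 9≡x)) 9≡y)
      too-big : ∀ c → deg c y (X ∩ N c x) ≡ 4 → deg c x (X ∩ N c y) ≤ 3 → ⊥
      too-big c e le = <⇒≱ (≤ᵇ⇒≤ 4 4 tt) (subst (_≤ 3) (trans (size-swap X (N c y) (N c x)) e) le)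
      by-colour : ∀ d → N true x y ≡ d → ⊥
      by-colour true  Nxy = too-big true (Nine.4-regular (side-free free Xx true) 9≡x y (∧-intro Xy Nxy) true)
        (minority-sparse y Xy false 9≡y (term≡272 y Xy) x (∧-intro Xx (N-flip {true} {x} {y} Nxy)))
      by-colour false Nxy = too-big false (trans (size-swap X (N false x) (N false y))
        (Nine.4-regular (side-free free Xy false) 9≡y x (∧-intro Xx (N-flip {false} {x} {y} Nxy′)) false))
        (subst (_≤ 3) (size-swap X (N false x) (N false y))
          (minority-sparse x Xx true 9≡x (term≡272 x Xx) y (∧-intro Xy Nxy′)))
        where Nxy′ = N-complement true x≢y Nxy

    module Regular (b : Bool) (9-regular : ∀ v → X v ≡ true → deg b v X ≡ 9) (v : Fin n) (Xv : X v ≡ true) where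
      r = not b
      X′ W : VertexSet
      X′ = X ∩ N b v
      W  = X ∩ N r v
      module N′ = Nine (side-free free Xv b) (9-regular v Xv)
      sizeW : size W ≡ 8
      sizeW = deg-other 9 b v Xv size≡18 (9-regular v Xv)

      module _ (w : Fin n) (Ww : W w ≡ true) (2<deg : 2 < deg r w W) where
        Xw : X w ≡ true
        Xw = ∧-elimˡ Ww
        Nvw : N r v w ≡ true
        Nvw = ∧-elimʳ {X w} Ww
        Nbwv : N b w v ≡ false
        Nbwv = N-flip {b} {v} {w} (N-disjoint′ v w Nvw)
        deg-r-w : deg r w W ≡ 3
        deg-r-w = ≤-antisym (minority-sparse v Xv b (9-regular v Xv) (term≡272 v Xv) w Ww) 2<deg
        S : VertexSet
        S = X′ ∩ N b w
        -- Of the 7 other vertices of `W`, 3 are joined to `w` in colour r and 4 in colour b, so 5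
        -- of its 9 b-neighbours lie on the other side of `v`.
        sizeS : size S ≡ 5
        sizeS = +-cancelʳ-≡ 4 _ 5 (sym (begin
          9                                      ≡⟨ 9-regular w Xw ⟨
          deg b w X                              ≡⟨ deg-via b b w X v Xv ⟩
          ⟦ N b w v ⟧ + (size S + deg b w W)     ≡⟨ cong₂ (λ a d → ⟦ a ⟧ + (size S + d)) Nbwv (deg-other′ 3 b w Ww sizeW deg-r-w) ⟩
          size S + 4 ∎))
          where open ≡-Reasoning
        -- Seen from s, both `v` and `w` lie in the 9-vertex graph on `N b s`. Being joined in
        -- colour r, they have 2 common b-neighbours there: `w` has 4, and 2 of these lie on the
        -- r-side of `v`.
        deg-b-S : ∀ s → S s ≡ true → deg b s S ≡ 2
        deg-b-S s Ss = trans (sym (trans (deg-swap b w X (N b s) (N b v)) (size-swap X′ (N b s) (N b w))))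
          (+-cancelʳ-≡ 2 _ 2 (sym (begin
            4
              ≡⟨ Y.4-regular w Yw b ⟨
            deg b w Y
              ≡⟨ deg-via b b w Y v Yv ⟩
            ⟦ N b w v ⟧ + (deg b w (Y ∩ N b v) + deg b w (Y ∩ N r v))
              ≡⟨ cong₂ (λ a d → ⟦ a ⟧ + (deg b w (Y ∩ N b v) + d)) Nbwv
                   (deg-other′ 1 b w (∧-intro Yw Nvw) (Y.4-regular v Yv r) (Y.sides-1-regular v Yv r w (∧-intro Yw Nvw))) ⟩
            deg b w (Y ∩ N b v) + 2 ∎)))
          where
          open ≡-Reasoning
          X′s : X′ s ≡ true
          X′s = ∧-elimˡ Ss
          Xs : X s ≡ true
          Xs = ∧-elimˡ X′s
          Y : VertexSet
          Y = X ∩ N b s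
          module Y = Nine (side-free free Xs b) (9-regular s Xs)
          Yv : Y v ≡ true
          Yv = ∧-intro Xv (N-flip {b} {v} {s} (∧-elimʳ {X s} X′s))
          Yw : Y w ≡ true
          Yw = ∧-intro Xw (N-flip {b} {w} {s} (∧-elimʳ {X′ s} Ss))
        deg-S : ∀ s → S s ≡ true → ∀ c → deg c s S ≡ 2
        deg-S s Ss = both-colours b (deg-b-S s Ss) (deg-other 2 b s Ss sizeS (deg-b-S s Ss))

        module _ (y : Fin n) (X′y : X′ y ≡ true) (Nwy : N b w y ≡ false) where
          Sy : S y ≡ false
          Sy = trans (cong (X′ y ∧_) Nwy) (Bool.∧-zeroʳ (X′ y))
          -- The four c-neighbours of s in `X′` are perfectly matched in colour c. The two in `S`
          -- are not matched with each other, since the 5-cycle has no triangle, so the matching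
          -- runs between them and the two outside `S`, one of which is `y`.
          1-regular : ∀ c s → (S ∩ N c y) s ≡ true → deg c s (S ∩ N c y) ≡ 1
          1-regular c s h = trans (size-swap S (N c y) (N c s))
            (∑∈-tight Q₂ {g = λ _ → 1} ≤1 (≤-reflexive (trans (∑∈-1 Q₂) (trans sizeQ₂ (sym ∑Q₂)))) y Q₂y)
            where
            Ss : S s ≡ true
            Ss = ∧-elimˡ h
            X′s : X′ s ≡ true
            X′s = ∧-elimˡ Ss
            Q Q₁ Q₂ : VertexSet
            Q  = X′ ∩ N c s
            Q₁ = S ∩ N c s
            Q₂ = Q ∖ N b w
            Q₂y : Q₂ y ≡ true
            Q₂y = ∧-intro (∧-intro X′y (N-flip {c} {y} {s} (∧-elimʳ {S s} h))) (cong not Nwy)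
            sizeQ₂ : size Q₂ ≡ 2
            sizeQ₂ = +-cancelˡ-≡ 2 _ 2 (trans (cong (_+ size Q₂) (sym (trans (size-swap X′ (N c s) (N b w)) (deg-S s Ss c))))
              (trans (sym (size-split Q (N b w))) (N′.4-regular s X′s c)))
            split : ∀ u → Q u ≡ true → deg c u Q₁ + deg c u Q₂ ≡ 1
            split u Qu = trans (cong (_+ deg c u Q₂) (sym (deg-swap c u X′ (N c s) (N b w))))
              (trans (sym (deg-split c u Q (N b w))) (N′.sides-1-regular s X′s c u Qu))
            across : ∀ u → Q₁ u ≡ true → deg c u Q₂ ≡ 1
            across u Q₁u = trans (cong (_+ deg c u Q₂) (sym (triangle-free-5 sizeS deg-S s Ss c u Q₁u)))
              (split u (∧-intro (∧-elimˡ {X′ u} (∧-elimˡ Q₁u)) (∧-elimʳ {S u} Q₁u)))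
            ∑Q₂ : ∑∈ Q₂ (λ u → deg c u Q₁) ≡ 2
            ∑Q₂ = trans (deg-comm c {Q₂} {Q₁}) (trans (∑∈-≡ Q₁ 1 across) (cong (1 *_) (deg-S s Ss c)))
            ≤1 : ∀ u → Q₂ u ≡ true → deg c u Q₁ ≤ 1
            ≤1 u Q₂u = ≤-trans (m≤m+n _ _) (≤-reflexive (split u (∧-elimˡ Q₂u)))
          -- A perfect matching on the c-neighbours of `y` in `S` makes their number even for both
          -- colours, but the two numbers add up to 5.
          even : ∀ c → ∃[ m ] deg c y S ≡ 2 * m
          even c with handshake c (S ∩ N c y)
          ... | m , e = m , trans (sym (*-identityˡ _)) (trans (sym (∑∈-≡ (S ∩ N c y) 1 (1-regular c))) e)
          absurd : ⊥
          absurd = even≢odd (proj₁ (even b) + proj₁ (even r)) 2 (begin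
            2 * (proj₁ (even b) + proj₁ (even r))     ≡⟨ *-distribˡ-+ 2 (proj₁ (even b)) _ ⟩
            2 * proj₁ (even b) + 2 * proj₁ (even r)   ≡⟨ cong₂ _+_ (proj₂ (even b)) (proj₂ (even r)) ⟨
            deg b y S + deg r y S                     ≡⟨ size-outside b S y Sy ⟨
            size S                                    ≡⟨ sizeS ⟩
            5 ∎)
            where open ≡-Reasoning

      contradictory : ⊥
      contradictory =
        -- The r-degree sum 20 on the 8 vertices of `W` exceeds 2·8, so some r-degree is at least 3.
        let (w , Ww , 2<deg) = ∑∈-∃ W 2 (subst₂ _<_ (cong (2 *_) (sym sizeW))
              (sym (minority-sum v Xv b (9-regular v Xv) (term≡272 v Xv))) (≤ᵇ⇒≤ 17 20 tt))
            (y , X′y , Nwy) = size-∃∖ X′ (N b w) (subst₂ _<_ (sym (sizeS w Ww 2<deg)) (sym (9-regular v Xv)) (≤ᵇ⇒≤ 6 9 tt))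
        in absurd w Ww 2<deg y X′y Nwy

    impossible : ⊥
    impossible = [ (λ 9≡ → Regular.contradictory true (λ u Xu → [ (λ e → e) , (λ e → ⊥-elim (clash v u Xv Xu 9≡ e)) ]′ (majority u Xu)) v Xv)
                 , (λ 9≡ → Regular.contradictory false (λ u Xu → [ (λ e → ⊥-elim (clash u v Xu Xv e 9≡)) , (λ e → e) ]′ (majority u Xu)) v Xv)
                 ]′ (majority v Xv)
      where
      v = proj₁ (size-∃ X (subst (0 <_) (sym size≡18) z<s))
      Xv : X v ≡ true
      Xv = proj₂ (size-∃ X (subst (0 <_) (sym size≡18) z<s))

  cap₆ : Cap 6 17
  cap₆ X free = s≤s⁻¹ (≤∧≢⇒< (cap-double-odd 4 cap₅ X free) λ e → Eighteen.impossible free e)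

-- Bounding r'₂ from above

-- The cap at order 6 + 2i is the odd number 2h + 1 with h = `half-cap i`. Keeping h exposes the
-- oddness that `cap-double-odd` asks for at every other step.
half-cap : ℕ → ℕ
half-cap zero    = 8
half-cap (suc i) = suc (half-cap i + half-cap i) + suc (half-cap i + half-cap i)

-- The cap is (52·4^i - 1)/3, and 52·4^i/3 is 13/48 of 2^(6 + 2i).
half-cap-eq : ∀ i → 3 * suc (half-cap i + half-cap i) + 1 ≡ 52 * 2 ^ (i + i)
half-cap-eq zero    = refl
half-cap-eq (suc i) = trans (eq₁ (half-cap i)) (trans (cong (4 *_) (half-cap-eq i))
  (trans (eq₂ (2 ^ (i + i))) (cong (λ m → 52 * (2 * 2 ^ m)) (sym (+-suc i i)))))
  where
  eq₁ : ∀ c → 3 * suc ((suc (c + c) + suc (c + c)) + (suc (c + c) + suc (c + c))) + 1 ≡ 4 * (3 * suc (c + c) + 1)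
  eq₁ = solve-∀
  eq₂ : ∀ m → 4 * (52 * m) ≡ 52 * (2 * (2 * m))
  eq₂ = solve-∀

module Caps {n : ℕ} (colour : Fin n → Fin n → Bool) (colour-sym : ∀ u v → colour u v ≡ colour v u) where
  open Ramsey colour colour-sym

  cap-even : ∀ i → Cap (6 + (i + i)) (suc (half-cap i + half-cap i))
  cap-even zero    = cap₆
  cap-even (suc i) = subst (λ k → Cap k (suc (half-cap (suc i) + half-cap (suc i)))) (cong (λ t → 7 + t) (sym (+-suc i i)))
    (cap-double (cap-double-odd (half-cap i) (cap-even i)))

halve : ∀ m → ∃[ i ] (m ≡ i + i ⊎ m ≡ suc (i + i))
halve zero = 0 , inj₁ refl
halve (suc m) with halve m
... | i , inj₁ e = i , inj₂ (cong suc e)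
... | i , inj₂ e = suc i , inj₁ (trans (cong suc e) (cong suc (sym (+-suc i i))))

cap-bound : ∀ k → ∃[ c ] (48 * c < 13 * 2 ^ (6 + k)) × (∀ {n} (colour : Fin n → Fin n → Bool) colour-sym →
  Ramsey.Cap colour colour-sym (6 + k) c)
cap-bound k with halve k
... | i , inj₁ refl = o , even , λ colour colour-sym → Caps.cap-even colour colour-sym i
  where
  o = suc (half-cap i + half-cap i)
  even : 48 * o < 13 * 2 ^ (6 + (i + i))
  even = begin-strict
    48 * o                  <⟨ m<m+n (48 * o) z<s ⟩
    48 * o + 16             ≡⟨ eq₁ o ⟩
    16 * (3 * o + 1)        ≡⟨ cong (16 *_) (half-cap-eq i) ⟩
    16 * (52 * 2 ^ (i + i)) ≡⟨ eq₂ (2 ^ (i + i)) ⟩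
    13 * 2 ^ (6 + (i + i))  ∎
    where
    open ≤-Reasoning
    eq₁ : ∀ o → 48 * o + 16 ≡ 16 * (3 * o + 1)
    eq₁ = solve-∀
    eq₂ : ∀ m → 16 * (52 * m) ≡ 13 * (2 * (2 * (2 * (2 * (2 * (2 * m))))))
    eq₂ = solve-∀
... | i , inj₂ refl = o + o , odd , λ colour colour-sym →
      Ramsey.cap-double-odd colour colour-sym (half-cap i) (Caps.cap-even colour colour-sym i)
  where
  o = suc (half-cap i + half-cap i)
  odd : 48 * (o + o) < 13 * 2 ^ (7 + (i + i))
  odd = begin-strict
    48 * (o + o)            <⟨ m<m+n (48 * (o + o)) z<s ⟩
    48 * (o + o) + 32       ≡⟨ eq₁ o ⟩
    32 * (3 * o + 1)        ≡⟨ cong (32 *_) (half-cap-eq i) ⟩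
    32 * (52 * 2 ^ (i + i)) ≡⟨ eq₂ (2 ^ (i + i)) ⟩
    13 * 2 ^ (7 + (i + i))  ∎
    where
    open ≤-Reasoning
    eq₁ : ∀ o → 48 * (o + o) + 32 ≡ 32 * (3 * o + 1)
    eq₁ = solve-∀
    eq₂ : ∀ m → 32 * (52 * m) ≡ 13 * (2 * (2 * (2 * (2 * (2 * (2 * (2 * m)))))))
    eq₂ = solve-∀

floor-lower : ∀ p → ℚ.floor p ℤ.* ℚ.denominator p ℤ.≤ ℚ.numerator p
floor-lower p@record{} = ℤ.[n/d]*d≤n (ℚ.numerator p) (ℚ.denominator p)

-- The ceiling is minus the floor of -q, so the defining inequality of that floor, multiplied out by
-- the denominator, gives the claim.
ceiling-upper : ∀ m q → + m ℚ./ 1 ℚ.< q → + suc m ℤ.≤ ceiling q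
ceiling-upper m q@record{} m<q = ℤ.i<j⇒suc[i]≤j (ℤ.*-cancelʳ-<-nonNeg {+ m} {ℤ.- z} d (ℤ.<-≤-trans md<n n≤-zd))
  where
  d = ℚ.denominator q
  z = ℚ.floor (ℚ.- q)
  md<n : + m ℤ.* d ℤ.< ℚ.numerator q
  md<n = subst (+ m ℤ.* d ℤ.<_) (ℤ.*-identityʳ (ℚ.numerator q))
    (ℚᵘ.drop-*<* (ℚᵘ.<-respˡ-≃ (ℚ.toℚᵘ-fromℚᵘ (mkℚᵘ (+ m) 0)) (ℚ.toℚᵘ-mono-< {+ m ℚ./ 1} {q} m<q)))
  n≤-zd : ℚ.numerator q ℤ.≤ (ℤ.- z) ℤ.* d
  n≤-zd = subst₂ ℤ._≤_ (ℤ.neg-involutive (ℚ.numerator q)) (ℤ.neg-distribˡ-* z d)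
    (ℤ.neg-mono-≤ (subst₂ (λ a b → z ℤ.* a ℤ.≤ b) (ℚ.↧-neg q) (ℚ.↥-neg q)
      (floor-lower (ℚ.- q))))

-- Embeddings versus induced threshold subgraphs

full : ∀ {n} → VertexSet {n}
full _ = true

module _ {n : ℕ} (G : Graph n) where
  open Coloured (adj G) (Graph.adj-sym G)
  open Ramsey (adj G) (Graph.adj-sym G)

  record Realisation (k : ℕ) (X : VertexSet) : Set where
    field
      graph         : Graph k
      constructible : Constructible graph
      vertex        : Fin k → Fin n
      vertex∈       : ∀ i → X (vertex i) ≡ true
      injective     : ∀ {i j} → vertex i ≡ vertex j → i ≡ j
      adj-vertex    : ∀ i j → adj graph i j ≡ adj G (vertex i) (vertex j)

  realise : ∀ {k X} → Emb k X → Realisation k X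
  realise (one v Xv) = record
    { graph = single ; constructible = start ; vertex = λ _ → v ; vertex∈ = λ _ → Xv
    ; injective = λ { {zero} {zero} _ → refl } ; adj-vertex = λ _ _ → sym (Graph.adj-irrefl G v) }
  realise {suc k} {X} (more v b Xv emb) = record
    { graph = addVertex b graph ; constructible = grow b constructible
    ; vertex = vertex′ ; vertex∈ = vertex∈′ ; injective = λ {i} {j} → injective′ i j ; adj-vertex = adj′ }
    where
    open Realisation (realise emb)
    vertex′ : Fin (suc k) → Fin n
    vertex′ zero    = v
    vertex′ (suc i) = vertex i
    vertex∈′ : ∀ i → X (vertex′ i) ≡ true
    vertex∈′ zero    = Xv
    vertex∈′ (suc i) = ∧-elimˡ (vertex∈ i)
    N-vertex : ∀ i → N b v (vertex i) ≡ true
    N-vertex i = ∧-elimʳ {X (vertex i)} (vertex∈ i)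
    injective′ : ∀ i j → vertex′ i ≡ vertex′ j → i ≡ j
    injective′ zero    zero    e = refl
    injective′ zero    (suc j) e = contradiction e (N-≢ v (vertex j) (N-vertex j))
    injective′ (suc i) zero    e = contradiction (sym e) (N-≢ v (vertex i) (N-vertex i))
    injective′ (suc i) (suc j) e = cong suc (injective e)
    adj′ : ∀ i j → adj (addVertex b graph) i j ≡ adj G (vertex′ i) (vertex′ j)
    adj′ zero    zero    = sym (Graph.adj-irrefl G v)
    adj′ zero    (suc j) = sym (N-colour v (vertex j) (N-vertex j))
    adj′ (suc i) zero    = trans (sym (N-colour v (vertex i) (N-vertex i))) (Graph.adj-sym G v (vertex i))
    adj′ (suc i) (suc j) = adj-vertex i j

  unrealise : ∀ {k} {T : Graph k} {X} → Constructible T → (f : Fin k → Fin n) → (∀ i → X (f i) ≡ true) →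
    (∀ {i j} → f i ≡ f j → i ≡ j) → (∀ i j → adj T i j ≡ adj G (f i) (f j)) → Emb k X
  unrealise start f f∈ inj adj-f = one (f zero) (f∈ zero)
  unrealise {X = X} (grow b c) f f∈ inj adj-f = more (f zero) b (f∈ zero) (unrealise c (f ∘ suc)
    (λ i → ∧-intro (f∈ (suc i)) (subst (λ d → N d (f zero) (f (suc i)) ≡ true) (sym (adj-f zero (suc i)))
      (N-intro (λ e → contradiction (inj e) λ ()))))
    (λ e → Fin.suc-injective (inj e)) (λ i j → adj-f (suc i) (suc j)))

ThresholdIn : ∀ {n} → ℕ → Graph n → Set
ThresholdIn s G = Σ[ T ∈ Graph s ] Threshold T × G ContainsInduced T

emb⇒threshold : ∀ {n s} (G : Graph n) → Ramsey.Emb (adj G) (Graph.adj-sym G) s full → ThresholdIn s G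
emb⇒threshold G emb = graph , (graph , constructible , mk↔ₛ′ (λ i → i) (λ i → i) (λ _ → refl) (λ _ → refl) , λ _ _ → refl) ,
  mk↣ injective , adj-vertex
  where open Realisation (realise G emb)

threshold⇒emb : ∀ {n s} (G : Graph n) → ThresholdIn s G → Ramsey.Emb (adj G) (Graph.adj-sym G) s full
threshold⇒emb G (T , (H , c , iso , H≅T) , f , T≡G) = unrealise G c (λ i → Injection.to f (Inverse.to iso i)) (λ _ → refl)
  (λ e → Injection.injective (Inverse⇒Injection iso) (Injection.injective f e)) (λ i j → trans (H≅T i j) (T≡G _ _))

-- Deciding unavoidability and finding the minimum

ThresholdIn? : ∀ {n} s (G : Graph n) → Dec (ThresholdIn s G)
ThresholdIn? s G = map′ (emb⇒threshold G) (threshold⇒emb G) (Ramsey.Emb? (adj G) (Graph.adj-sym G) s full)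

-- Only the entries with u < v are read. The square table keeps the index a plain `combine u v` and
-- lets arbitrary bit vectors serve as colourings.
pairColour : ∀ n → Vec Bool (n * n) → Fin n → Fin n → Bool
pairColour n x u v with Fin.<-cmp u v
... | tri< _ _ _ = lookup x (combine u v)
... | tri≈ _ _ _ = false
... | tri> _ _ _ = lookup x (combine v u)

pairColour-sym : ∀ n (x : Vec Bool (n * n)) u v → pairColour n x u v ≡ pairColour n x v u
pairColour-sym n x u v with Fin.<-cmp u v | Fin.<-cmp v u
... | tri< _ _ _    | tri> _ _ _    = refl
... | tri≈ _ _ _    | tri≈ _ _ _    = refl
... | tri> _ _ _    | tri< _ _ _    = refl
... | tri< u<v _ _  | tri< v<u _ _  = contradiction v<u (Fin.<-asym u<v)
... | tri< _ u≢v _  | tri≈ _ v≡u _  = contradiction (sym v≡u) u≢v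
... | tri≈ _ u≡v _  | tri< _ v≢u _  = contradiction (sym u≡v) v≢u
... | tri≈ _ u≡v _  | tri> _ v≢u _  = contradiction (sym u≡v) v≢u
... | tri> _ u≢v _  | tri≈ _ v≡u _  = contradiction (sym v≡u) u≢v
... | tri> _ _ v<u  | tri> _ _ u<v  = contradiction v<u (Fin.<-asym u<v)

pairColour-irrefl : ∀ n (x : Vec Bool (n * n)) v → pairColour n x v v ≡ false
pairColour-irrefl n x v with Fin.<-cmp v v
... | tri< _ v≢v _ = contradiction refl v≢v
... | tri≈ _ _ _   = refl
... | tri> _ v≢v _ = contradiction refl v≢v

pairColour-< : ∀ n (x : Vec Bool (n * n)) {u v} → u Fin.< v → pairColour n x u v ≡ lookup x (combine u v)
pairColour-< n x {u} {v} u<v with Fin.<-cmp u v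
... | tri< _ _ _    = refl
... | tri≈ u≮v _ _  = contradiction u<v u≮v
... | tri> u≮v _ _  = contradiction u<v u≮v

graphOf : ∀ n → Vec Bool (n * n) → Graph n
graphOf n x = record { adj = pairColour n x ; adj-sym = pairColour-sym n x ; adj-irrefl = pairColour-irrefl n x }

graphOf-surjective : ∀ {n} (G : Graph n) → ∃[ x ] ∀ u v → adj G u v ≡ adj (graphOf n x) u v
graphOf-surjective {n} G = x , eq
  where
  entry : Fin (n * n) → Bool
  entry i = adj G (proj₁ (remQuot {n} n i)) (proj₂ (remQuot {n} n i))
  x = Vec.tabulate entry
  at : ∀ u v → lookup x (combine u v) ≡ adj G u v
  at u v = trans (lookup∘tabulate entry (combine u v))
    (cong (λ p → adj G (proj₁ p) (proj₂ p)) (Fin.remQuot-combine u v))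
  eq : ∀ u v → adj G u v ≡ pairColour n x u v
  eq u v with Fin.<-cmp u v
  ... | tri< _ _ _    = sym (at u v)
  ... | tri≈ _ refl _ = Graph.adj-irrefl G u
  ... | tri> _ _ _    = trans (Graph.adj-sym G u v) (sym (at v u))

∀Vec? : ∀ N {P : Vec Bool N → Set} → (∀ x → Dec (P x)) → Dec (∀ x → P x)
∀Vec? zero    P? = map′ (λ { p [] → p }) (λ p → p []) (P? [])
∀Vec? (suc N) P? = map′ (λ { (p , q) (true ∷ x) → p x ; (p , q) (false ∷ x) → q x })
  (λ p → (λ x → p (true ∷ x)) , (λ x → p (false ∷ x)))
  (∀Vec? N (λ x → P? (true ∷ x)) ×-dec ∀Vec? N (λ x → P? (false ∷ x)))

-- The least element of `Unavoidable s` is found by search, which needs a decision at each n; bit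
-- vectors reduce it to finitely many graphs, up to pointwise equality of adjacency.
unavoidable? : ∀ s n → Dec (Unavoidable s n)
unavoidable? s n = map′ to (λ unavoidable x → unavoidable (graphOf n x)) (∀Vec? (n * n) (λ x → ThresholdIn? s (graphOf n x)))
  where
  to : (∀ x → ThresholdIn s (graphOf n x)) → Unavoidable s n
  to h G with graphOf-surjective G
  ... | x , eq with h x
  ...   | T , threshold , f , T≡ = T , threshold , f , λ u v → trans (T≡ u v) (sym (eq _ _))

minimum : ∀ {P : ℕ → Set} → (∀ n → Dec (P n)) → ∀ n → P n → ∃[ r ] IsMinimum P r
minimum {P} P? n Pn = [ (λ h → h) , (λ none → contradiction Pn (none n ≤-refl)) ]′ (search (suc n))
  where
  search : ∀ k → (∃[ r ] IsMinimum P r) ⊎ (∀ m → m < k → ¬ P m)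
  search zero = inj₂ λ _ ()
  search (suc k) with search k | P? k
  ... | inj₁ h    | _      = inj₁ h
  ... | inj₂ none | yes Pk = inj₁ (k , Pk , λ m Pm → ≮⇒≥ (λ m<k → none m m<k Pm))
  ... | inj₂ none | no ¬Pk = inj₂ λ m m<1+k Pm → [ (λ m<k → none m m<k Pm) , (λ { refl → ¬Pk Pm }) ]′
        (m≤n⇒m<n∨m≡n (s≤s⁻¹ m<1+k))

size-full : ∀ n → size {n} full ≡ n
size-full zero    = refl
size-full (suc n) = cong suc (size-full n)

unavoidable-cap : ∀ {s c} → (∀ {n} (colour : Fin n → Fin n → Bool) colour-sym → Ramsey.Cap colour colour-sym s c) →
  Unavoidable s (suc c)
unavoidable-cap {s} {c} cap G = emb⇒threshold G (decidable-stable (Ramsey.Emb? (adj G) (Graph.adj-sym G) s full)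
  λ free → <⇒≱ (n<1+n c) (subst (_≤ c) (size-full (suc c)) (cap (adj G) (Graph.adj-sym G) full free)))

r′₂-upper : ∀ k → ∃[ r ] IsR'₂ (6 + k) r × (+ r) ℤ.≤ ceiling ((+ 13 ℚ./ 48) ℚ.* (+ (2 ^ (6 + k)) ℚ./ 1))
r′₂-upper k =
  let (c , 48c< , cap) = cap-bound k
      (r , min) = minimum (unavoidable? (6 + k)) (suc c) (unavoidable-cap cap)
  in r , min , ℤ.≤-trans (ℤ.+≤+ (proj₂ min (suc c) (unavoidable-cap cap))) (ceiling-upper c ((+ 13 ℚ./ 48) ℚ.* (+ (2 ^ (6 + k)) ℚ./ 1)) (lt c (2 ^ (6 + k)) 48c<))
  where
  lt : ∀ c t → 48 * c < 13 * t → + c ℚ./ 1 ℚ.< (+ 13 ℚ./ 48) ℚ.* (+ t ℚ./ 1)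
  lt c t h = ℚ.toℚᵘ-cancel-<
    (ℚᵘ.<-respˡ-≃ (ℚᵘ.≃-sym (ℚ.toℚᵘ-fromℚᵘ (mkℚᵘ (+ c) 0)))
      (ℚᵘ.<-respʳ-≃ (ℚᵘ.≃-sym (ℚᵘ.≃-trans (ℚ.toℚᵘ-homo-* (+ 13 ℚ./ 48) (+ t ℚ./ 1))
          (ℚᵘ.*-congˡ {ℚ.toℚᵘ (+ 13 ℚ./ 48)} (ℚ.toℚᵘ-fromℚᵘ (mkℚᵘ (+ t) 0)))))
        (ℚᵘ.*<* (subst₂ ℤ._<_ (ℤ.pos-* c 48) (trans (ℤ.pos-* 13 t) (sym (ℤ.*-identityʳ _)))
          (ℤ.+<+ (subst (_< 13 * t) (*-comm 48 c) h))))))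

-- The local lemma

♯ : ∀ {A : Set} → (A → Bool) → List A → ℕ
♯ f []       = 0
♯ f (x ∷ xs) = ⟦ f x ⟧ + ♯ f xs

♯-++ : ∀ {A : Set} (f : A → Bool) xs ys → ♯ f (xs ++ ys) ≡ ♯ f xs + ♯ f ys
♯-++ f []       ys = refl
♯-++ f (x ∷ xs) ys = trans (cong (λ t → ⟦ f x ⟧ + t) (♯-++ f xs ys)) (sym (+-assoc ⟦ f x ⟧ (♯ f xs) (♯ f ys)))

♯-partition : ∀ {A : Set} (f g : A → Bool) xs →
  ♯ f (filterᵇ g xs) + ♯ f (filterᵇ (λ x → not (g x)) xs) ≡ ♯ f xs
♯-partition f g [] = refl
♯-partition f g (x ∷ xs) with g x
... | true  = trans (+-assoc ⟦ f x ⟧ _ _) (cong (λ t → ⟦ f x ⟧ + t) (♯-partition f g xs))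
... | false = trans (swap (♯ f (filterᵇ g xs)) ⟦ f x ⟧ _) (cong (λ t → ⟦ f x ⟧ + t) (♯-partition f g xs))
  where
  swap : ∀ a b c → a + (b + c) ≡ b + (a + c)
  swap = solve-∀

length-filterᵇ : ∀ {A : Set} (g : A → Bool) xs → length (filterᵇ g xs) ≡ ♯ g xs
length-filterᵇ g [] = refl
length-filterᵇ g (x ∷ xs) with g x
... | true  = cong suc (length-filterᵇ g xs)
... | false = length-filterᵇ g xs

length-♯ : ∀ {A : Set} (xs : List A) → ♯ (λ _ → true) xs ≡ length xs
length-♯ []       = refl
length-♯ (x ∷ xs) = cong suc (length-♯ xs)

count : ∀ {N} → (Vec Bool N → Bool) → ℕ
count {zero}  f = ⟦ f [] ⟧
count {suc N} f = count (λ x → f (true ∷ x)) + count (λ x → f (false ∷ x))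

count-mono : ∀ {N} {f g : Vec Bool N → Bool} → (∀ x → f x ≡ true → g x ≡ true) → count f ≤ count g
count-mono {zero} {f} {g} h with f [] | h []
... | true  | k rewrite k refl = ≤-refl
... | false | _ = z≤n
count-mono {suc N} h = +-mono-≤ (count-mono (λ x → h (true ∷ x))) (count-mono (λ x → h (false ∷ x)))

count-cong : ∀ {N} {f g : Vec Bool N → Bool} → (∀ x → f x ≡ g x) → count f ≡ count g
count-cong {zero}  h = cong ⟦_⟧ (h [])
count-cong {suc N} h = cong₂ _+_ (count-cong (λ x → h (true ∷ x))) (count-cong (λ x → h (false ∷ x)))

count-split : ∀ {N} (g f : Vec Bool N → Bool) → count f ≡ count (λ x → g x ∧ f x) + count (λ x → not (g x) ∧ f x)
count-split {zero} g f with g []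
... | true  = sym (+-identityʳ _)
... | false = refl
count-split {suc N} g f = trans (cong₂ _+_ (count-split (λ x → g (true ∷ x)) (λ x → f (true ∷ x)))
    (count-split (λ x → g (false ∷ x)) (λ x → f (false ∷ x))))
  (swap (count (λ x → g (true ∷ x) ∧ f (true ∷ x))) (count (λ x → not (g (true ∷ x)) ∧ f (true ∷ x))) _ _)
  where
  swap : ∀ a b c d → (a + b) + (c + d) ≡ (a + c) + (b + d)
  swap = solve-∀

count-∃ : ∀ {N} (f : Vec Bool N → Bool) → 0 < count f → ∃[ x ] f x ≡ true
count-∃ {zero} f h with f [] in eq
... | true = [] , eq
count-∃ {suc N} f h with count (λ x → f (true ∷ x)) in eq
... | suc _ = let (x , e) = count-∃ (λ x → f (true ∷ x)) (subst (0 <_) (sym eq) z<s) in true ∷ x , e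
... | zero  = let (x , e) = count-∃ (λ x → f (false ∷ x)) h in false ∷ x , e

count-true : ∀ N → 0 < count {N} (λ _ → true)
count-true zero    = z<s
count-true (suc N) = <-≤-trans (count-true N) (m≤m+n _ _)

flip : ∀ {N} → Fin N → Vec Bool N → Vec Bool N
flip i x = updateAt x i not

count-flip : ∀ {N} i (f : Vec Bool N → Bool) → count (λ x → f (flip i x)) ≡ count f
count-flip zero    f = +-comm (count (λ x → f (false ∷ x))) _
count-flip (suc i) f = cong₂ _+_ (count-flip i (λ x → f (true ∷ x))) (count-flip i (λ x → f (false ∷ x)))

module LocalLemma {N : ℕ} where

  -- A pattern is a conjunction of literals "variable i has value b".
  Pattern : Set
  Pattern = List (Fin N × Bool)

  holds : Fin N × Bool → Vec Bool N → Bool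
  holds (i , b) x = does (lookup x i Bool.≟ b)

  matches : Pattern → Vec Bool N → Bool
  matches []      x = true
  matches (l ∷ p) x = holds l x ∧ matches p x

  avoids : List Pattern → Vec Bool N → Bool
  avoids []       x = true
  avoids (p ∷ ps) x = not (matches p x) ∧ avoids ps x

  mentions : Fin N → Pattern → Bool
  mentions i []            = false
  mentions i ((j , _) ∷ p) = does (i Fin.≟ j) ∨ mentions i p

  overlaps : Pattern → Pattern → Bool
  overlaps []            q = false
  overlaps ((i , _) ∷ p) q = mentions i q ∨ overlaps p q

  Distinct : Pattern → Set
  Distinct = AllPairs (λ l l′ → proj₁ l ≢ proj₁ l′)

  matches-flip : ∀ i p x → mentions i p ≡ false → matches p (flip i x) ≡ matches p x
  matches-flip i []            x _ = refl
  matches-flip i ((j , b) ∷ p) x h with i Fin.≟ j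
  ... | no i≢j = cong₂ _∧_ (cong (λ a → does (a Bool.≟ b)) (lookup∘updateAt′ j i (λ e → i≢j (sym e)) x)) (matches-flip i p x h)

  avoids-flip : ∀ i ps x → All (λ p → mentions i p ≡ false) ps → avoids ps (flip i x) ≡ avoids ps x
  avoids-flip i []       x _       = refl
  avoids-flip i (p ∷ ps) x (h ∷ hs) = cong₂ _∧_ (cong not (matches-flip i p x h)) (avoids-flip i ps x hs)

  -- Flipping bit i exchanges the two values of the literal and preserves `R`, so each value takes
  -- half of the count.
  count-holds : ∀ i b (R : Vec Bool N → Bool) → (∀ x → R (flip i x) ≡ R x) →
    2 * count (λ x → holds (i , b) x ∧ R x) ≡ count R
  count-holds i b R indep = sym (begin
    count R
      ≡⟨ count-split (holds (i , b)) R ⟩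
    C + count (λ x → not (holds (i , b) x) ∧ R x)
      ≡⟨ cong (λ t → C + t) (count-flip i (λ x → not (holds (i , b) x) ∧ R x)) ⟨
    C + count (λ x → not (holds (i , b) (flip i x)) ∧ R (flip i x))
      ≡⟨ cong (λ t → C + t) (count-cong (λ x → cong₂ _∧_ (flipped x) (indep x))) ⟩
    C + C
      ≡⟨ cong (λ t → C + t) (+-identityʳ C) ⟨
    2 * C ∎)
    where
    open ≡-Reasoning
    C = count (λ x → holds (i , b) x ∧ R x)
    not-≟ : ∀ a b → not (does (not a Bool.≟ b)) ≡ does (a Bool.≟ b)
    not-≟ true  true  = refl
    not-≟ true  false = refl
    not-≟ false true  = refl
    not-≟ false false = refl
    flipped : ∀ x → not (holds (i , b) (flip i x)) ≡ holds (i , b) x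
    flipped x rewrite lookup∘updateAt i {not} x = not-≟ (lookup x i) b

  distinct⇒¬mentions : ∀ i (p : Pattern) → All (λ l → i ≢ proj₁ l) p → mentions i p ≡ false
  distinct⇒¬mentions i []            []         = refl
  distinct⇒¬mentions i ((j , _) ∷ p) (i≢j ∷ h) with i Fin.≟ j
  ... | yes e = contradiction e i≢j
  ... | no _  = distinct⇒¬mentions i p h

  -- Independence in counting form: a pattern has conditional probability 2 to the minus its length,
  -- given an event that ignores its variables.
  count-matches : ∀ p (R : Vec Bool N → Bool) → Distinct p →
    (∀ i → mentions i p ≡ true → ∀ x → R (flip i x) ≡ R x) →
    2 ^ length p * count (λ x → matches p x ∧ R x) ≡ count R
  count-matches []            R _          _     = *-identityˡ (count R)
  count-matches ((i , b) ∷ p) R (i∉p ∷ dp) indep = begin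
    2 * 2 ^ length p * count (λ x → (holds (i , b) x ∧ matches p x) ∧ R x)
      ≡⟨ trans (cong (_* K) (*-comm 2 (2 ^ length p))) (*-assoc (2 ^ length p) 2 K) ⟩
    2 ^ length p * (2 * count (λ x → (holds (i , b) x ∧ matches p x) ∧ R x))
      ≡⟨ cong (λ k → 2 ^ length p * (2 * k)) (count-cong (λ x → Bool.∧-assoc (holds (i , b) x) (matches p x) (R x))) ⟩
    2 ^ length p * (2 * count (λ x → holds (i , b) x ∧ (matches p x ∧ R x)))
      ≡⟨ cong (2 ^ length p *_) (count-holds i b (λ x → matches p x ∧ R x) (λ x → cong₂ _∧_
           (matches-flip i p x (distinct⇒¬mentions i p i∉p)) (indep i i-mentioned x))) ⟩
    2 ^ length p * count (λ x → matches p x ∧ R x)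
      ≡⟨ count-matches p R dp (λ j h → indep j (trans (cong (does (j Fin.≟ i) ∨_) h) (Bool.∨-zeroʳ _))) ⟩
    count R ∎
    where
    open ≡-Reasoning
    K = count (λ x → (holds (i , b) x ∧ matches p x) ∧ R x)
    i-mentioned : mentions i ((i , b) ∷ p) ≡ true
    i-mentioned with i Fin.≟ i
    ... | yes _   = refl
    ... | no i≢i = contradiction refl i≢i

  ¬overlaps⇒¬mentions : ∀ i p q → overlaps p q ≡ false → mentions i p ≡ true → mentions i q ≡ false
  ¬overlaps⇒¬mentions i ((j , _) ∷ p) q h m with i Fin.≟ j
  ... | yes refl = proj₁ (∨-false h)
    where
    ∨-false : ∀ {a b} → a ∨ b ≡ false → a ≡ false × b ≡ false
    ∨-false {false} {false} _ = refl , refl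
  ... | no _ with mentions j q
  ...   | false = ¬overlaps⇒¬mentions i p q h m

  avoids-++ : ∀ ps qs x → avoids (ps ++ qs) x ≡ avoids ps x ∧ avoids qs x
  avoids-++ []       qs x = refl
  avoids-++ (p ∷ ps) qs x = trans (cong (not (matches p x) ∧_) (avoids-++ ps qs x))
    (sym (Bool.∧-assoc (not (matches p x)) (avoids ps x) (avoids qs x)))

  avoids-partition : ∀ g ps x → avoids (filterᵇ g ps) x ∧ avoids (filterᵇ (λ p → not (g p)) ps) x ≡ avoids ps x
  avoids-partition g []       x = refl
  avoids-partition g (p ∷ ps) x with g p
  ... | true  = trans (Bool.∧-assoc (not (matches p x)) _ _) (cong (not (matches p x) ∧_) (avoids-partition g ps x))
  ... | false = begin
    A ∧ (not (matches p x) ∧ B) ≡⟨ Bool.∧-assoc A (not (matches p x)) B ⟨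
    (A ∧ not (matches p x)) ∧ B ≡⟨ cong (_∧ B) (Bool.∧-comm A (not (matches p x))) ⟩
    (not (matches p x) ∧ A) ∧ B ≡⟨ Bool.∧-assoc (not (matches p x)) A B ⟩
    not (matches p x) ∧ (A ∧ B) ≡⟨ cong (not (matches p x) ∧_) (avoids-partition g ps x) ⟩
    not (matches p x) ∧ avoids ps x ∎
    where
    open ≡-Reasoning
    A = avoids (filterᵇ g ps) x
    B = avoids (filterᵇ (λ p → not (g p)) ps) x

  filterᵇ-All : ∀ {P : Pattern → Set} g ps → All P ps → All P (filterᵇ g ps)
  filterᵇ-All g []       []       = []
  filterᵇ-All g (p ∷ ps) (h ∷ hs) with g p
  ... | true  = h ∷ filterᵇ-All g ps hs
  ... | false = filterᵇ-All g ps hs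

  filterᵇ-all : ∀ g (ps : List Pattern) → All (λ p → g p ≡ true) (filterᵇ g ps)
  filterᵇ-all g []       = []
  filterᵇ-all g (p ∷ ps) with g p in eq
  ... | true  = eq ∷ filterᵇ-all g ps
  ... | false = filterᵇ-all g ps

  -- (1 - 1/D)ʲ ≥ 1 - j/D with D = e + 1 and t = D - j.
  bernoulli : ∀ e j t → j + t ≡ suc e → suc e ^ j * t ≤ e ^ j * suc e
  bernoulli e zero    t h = ≤-reflexive (cong (_+ 0) h)
  bernoulli e (suc j) t h = begin
    suc e * suc e ^ j * t       ≡⟨ eq₁ (suc e) (suc e ^ j) t ⟩
    (suc e * t) * suc e ^ j     ≤⟨ *-monoˡ-≤ (suc e ^ j) (+-monoˡ-≤ (e * t) (m+n≤o⇒n≤o j (≤-reflexive (suc-injective h)))) ⟩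
    (e + e * t) * suc e ^ j     ≡⟨ eq₂ e t (suc e ^ j) ⟩
    e * (suc e ^ j * suc t)     ≤⟨ *-monoʳ-≤ e (bernoulli e j (suc t) (trans (+-suc j t) h)) ⟩
    e * (e ^ j * suc e)         ≡⟨ *-assoc e (e ^ j) (suc e) ⟨
    e * e ^ j * suc e           ∎
    where
    open ≤-Reasoning
    eq₁ : ∀ a b c → a * b * c ≡ (a * c) * b
    eq₁ = solve-∀
    eq₂ : ∀ e t a → (e + e * t) * a ≡ e * (a * suc t)
    eq₂ = solve-∀

  module _ (Ps : List Pattern) (m c : ℕ) (sparse : 4 * suc c ≤ 2 ^ m) where

    -- The local lemma is run with the uniform weight 1/D, D = 2d, where d bounds the number of
    -- overlapping patterns; e/D is 1 - 1/D. Starting from c = d - 1 avoids subtraction.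
    d e D : ℕ
    d = suc c
    e = suc (c + c)
    D = suc e

    Good : Pattern → Set
    Good p = length p ≡ m × Distinct p × ♯ (overlaps p) Ps ≤ d

    -- Inclusion as multisets, tested by all counts: it survives the reordering of a list into
    -- overlapping and other patterns, and bounds the overlaps of every sublist.
    _⊑Ps : List Pattern → Set
    ps ⊑Ps = ∀ f → ♯ f ps ≤ ♯ f Ps

    -- By Bernoulli (1 - 1/(2d))ʲ is at least 1 - j/(2d), hence at least 1/2.
    D^j≤2e^j : ∀ j → j ≤ d → D ^ j ≤ 2 * e ^ j
    D^j≤2e^j j j≤d = *-cancelʳ-≤ (D ^ j) (2 * e ^ j) d (begin
      D ^ j * d         ≤⟨ *-monoʳ-≤ (D ^ j) (m+n≤o⇒m≤o∸n d (≤-trans (+-monoʳ-≤ d j≤d) (≤-reflexive D≡))) ⟩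
      D ^ j * (D ∸ j)   ≤⟨ bernoulli e j (D ∸ j) (m+[n∸m]≡n (≤-trans j≤d (≤-trans (m≤m+n d d) (≤-reflexive D≡)))) ⟩
      e ^ j * D         ≡⟨ cong (e ^ j *_) D≡ ⟨
      e ^ j * (d + d)   ≡⟨ eq (e ^ j) d ⟩
      2 * e ^ j * d     ∎)
      where
      open ≤-Reasoning
      D≡ : d + d ≡ D
      D≡ = cong suc (+-suc c c)
      eq : ∀ a b → a * (b + b) ≡ 2 * a * b
      eq = solve-∀

    -- P(avoid p and ps) ≥ (1 - 1/D) P(avoid ps).
    extend : ∀ k ps → length ps ≤ k → All Good ps → ps ⊑Ps → ∀ p → Good p →
      e * count (avoids ps) ≤ D * count (avoids (p ∷ ps))
    extend k ps len good sub p (length≡m , distinct , few) = ℕ.+-cancelˡ-≤ (count (avoids ps)) _ _ (begin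
      D * count (avoids ps)
        ≡⟨ cong (D *_) (count-split (matches p) (avoids ps)) ⟩
      D * (B + count (avoids (p ∷ ps)))
        ≡⟨ *-distribˡ-+ D B _ ⟩
      D * B + D * count (avoids (p ∷ ps))
        ≤⟨ +-monoˡ-≤ _ DB≤ ⟩
      count (avoids ps) + D * count (avoids (p ∷ ps)) ∎)
      where
      open ≤-Reasoning
      B = count (λ x → matches p x ∧ avoids ps x)
      -- `os` shares variables with `p`, while avoiding `qs` is independent of `p`.
      os qs : List Pattern
      os = filterᵇ (overlaps p) ps
      qs = filterᵇ (λ q → not (overlaps p q)) ps
      ♯-os-qs : ∀ f → ♯ f os + ♯ f qs ≤ ♯ f Ps
      ♯-os-qs f = subst (_≤ ♯ f Ps) (sym (♯-partition f (overlaps p) ps)) (sub f)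
      lengths : length os + length qs ≤ k
      lengths = subst (_≤ k) (trans (sym (length-♯ ps)) (trans (sym (♯-partition (λ _ → true) (overlaps p) ps))
        (cong₂ _+_ (length-♯ os) (length-♯ qs)))) len
      -- Putting the overlapping patterns back one at a time costs a factor e/D each. Each use of
      -- `extend` concerns a list shorter than `ps`, which the bound `k` makes structural.
      chain : ∀ k os → length os + length qs ≤ k → All Good os → (∀ f → ♯ f os + ♯ f qs ≤ ♯ f Ps) →
        e ^ length os * count (avoids qs) ≤ D ^ length os * count (avoids (os ++ qs))
      chain k       []       _   _          _   = ≤-refl
      chain (suc k) (o ∷ os) len (go ∷ gos) sub = begin
        e * e ^ length os * count (avoids qs)
          ≡⟨ *-assoc e (e ^ length os) _ ⟩
        e * (e ^ length os * count (avoids qs))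
          ≤⟨ *-monoʳ-≤ e (chain (suc k) os (≤-trans (n≤1+n _) len) gos sub′) ⟩
        e * (D ^ length os * count (avoids (os ++ qs)))
          ≡⟨ swap e (D ^ length os) _ ⟩
        D ^ length os * (e * count (avoids (os ++ qs)))
          ≤⟨ *-monoʳ-≤ (D ^ length os) (extend k (os ++ qs) (≤-trans (≤-reflexive (length-++′ os)) (s≤s⁻¹ len))
               (All.++⁺ gos (filterᵇ-All _ ps good)) (λ f → ≤-trans (≤-reflexive (♯-++ f os qs)) (sub′ f)) o go) ⟩
        D ^ length os * (D * count (avoids (o ∷ os ++ qs)))
          ≡⟨ swap′ D (D ^ length os) _ ⟩
        D * D ^ length os * count (avoids (o ∷ os ++ qs)) ∎
        where
        sub′ : ∀ f → ♯ f os + ♯ f qs ≤ ♯ f Ps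
        sub′ f = ≤-trans (+-monoˡ-≤ (♯ f qs) (m≤n+m (♯ f os) ⟦ f o ⟧)) (sub f)
        length-++′ : ∀ os → length (os ++ qs) ≡ length os + length qs
        length-++′ []       = refl
        length-++′ (o ∷ os) = cong suc (length-++′ os)
        swap : ∀ a b c → a * (b * c) ≡ b * (a * c)
        swap = solve-∀
        swap′ : ∀ a b c → b * (a * c) ≡ a * b * c
        swap′ = solve-∀
      j = length os
      G-qs≤2G-ps : count (avoids qs) ≤ 2 * count (avoids ps)
      G-qs≤2G-ps = *-cancelˡ-≤ (D ^ j) {{m^n≢0 D j}} (begin
        D ^ j * count (avoids qs)
          ≤⟨ *-monoˡ-≤ _ (D^j≤2e^j j (≤-trans (≤-reflexive (length-filterᵇ (overlaps p) ps)) (≤-trans (sub (overlaps p)) few))) ⟩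
        2 * e ^ j * count (avoids qs)
          ≡⟨ *-assoc 2 (e ^ j) _ ⟩
        2 * (e ^ j * count (avoids qs))
          ≤⟨ *-monoʳ-≤ 2 (chain k os lengths (filterᵇ-All _ ps good) ♯-os-qs) ⟩
        2 * (D ^ j * count (avoids (os ++ qs)))
          ≡⟨ cong (λ t → 2 * (D ^ j * t)) (count-cong (λ x → trans (avoids-++ os qs x) (avoids-partition (overlaps p) ps x))) ⟩
        2 * (D ^ j * count (avoids ps))
          ≡⟨ swap 2 (D ^ j) _ ⟩
        D ^ j * (2 * count (avoids ps)) ∎)
        where
        swap : ∀ a b c → a * (b * c) ≡ b * (a * c)
        swap = solve-∀
      not-true : ∀ {b} → not b ≡ true → b ≡ false
      not-true {false} _ = refl
      2^mB≤G-qs : 2 ^ m * B ≤ count (avoids qs)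
      2^mB≤G-qs = begin
        2 ^ m * B
          ≤⟨ *-monoʳ-≤ (2 ^ m) (count-mono (λ x h → ∧-intro (∧-elimˡ h)
               (∧-elimʳ {avoids os x} (trans (avoids-partition (overlaps p) ps x) (∧-elimʳ {matches p x} h))))) ⟩
        2 ^ m * count (λ x → matches p x ∧ avoids qs x)
          ≡⟨ cong (λ k → 2 ^ k * count (λ x → matches p x ∧ avoids qs x)) length≡m ⟨
        2 ^ length p * count (λ x → matches p x ∧ avoids qs x)
          ≡⟨ count-matches p (avoids qs) distinct (λ i h x → avoids-flip i qs x
               (All.map (λ {q} no → ¬overlaps⇒¬mentions i p q (not-true no) h) (filterᵇ-all (λ q → not (overlaps p q)) ps))) ⟩
        count (avoids qs) ∎
      DB≤ : D * B ≤ count (avoids ps)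
      DB≤ = *-cancelˡ-≤ 2 (begin
        2 * (D * B)             ≡⟨ eq c B ⟩
        4 * suc c * B           ≤⟨ *-monoˡ-≤ B sparse ⟩
        2 ^ m * B               ≤⟨ 2^mB≤G-qs ⟩
        count (avoids qs)       ≤⟨ G-qs≤2G-ps ⟩
        2 * count (avoids ps)   ∎)
        where
        eq : ∀ c B → 2 * (suc (suc (c + c)) * B) ≡ 4 * suc c * B
        eq = solve-∀

    avoids-pos : ∀ ps → All Good ps → ps ⊑Ps → 0 < count (avoids ps)
    avoids-pos []       _        _   = count-true N
    avoids-pos (p ∷ ps) (g ∷ gs) sub = n≢0⇒n>0 λ none → <⇒≱ (avoids-pos ps gs sub′)
      (≤-trans (m≤m+n _ _) (subst (e * count (avoids ps) ≤_) (trans (cong (D *_) none) (*-zeroʳ D))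
        (extend (length ps) ps ≤-refl gs sub′ p g)))
      where
      sub′ : ps ⊑Ps
      sub′ f = ≤-trans (m≤n+m (♯ f ps) ⟦ f p ⟧) (sub f)

    local-lemma : All Good Ps → ∃[ x ] avoids Ps x ≡ true
    local-lemma good = count-∃ (avoids Ps) (avoids-pos Ps good (λ f → ≤-refl))

-- Threshold patterns

subsets : ∀ {A : Set} → ℕ → List A → List (List A)
subsets zero    xs       = [] ∷ []
subsets (suc s) []       = []
subsets (suc s) (x ∷ xs) = map (x ∷_) (subsets s xs) ++ subsets (suc s) xs

♯-map : ∀ {A B : Set} (f : B → Bool) (g : A → B) xs → ♯ f (map g xs) ≡ ♯ (λ x → f (g x)) xs
♯-map f g []       = refl
♯-map f g (x ∷ xs) = cong (λ t → ⟦ f (g x) ⟧ + t) (♯-map f g xs)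

♯-none : ∀ {A : Set} (f : A → Bool) xs → All (λ x → f x ≡ false) xs → ♯ f xs ≡ 0
♯-none f []       []       = refl
♯-none f (x ∷ xs) (h ∷ hs) rewrite h = ♯-none f xs hs

♯≤length : ∀ {A : Set} (f : A → Bool) xs → ♯ f xs ≤ length xs
♯≤length f []       = z≤n
♯≤length f (x ∷ xs) = +-mono-≤ (⟦⟧≤1 (f x)) (♯≤length f xs)
  where
  ⟦⟧≤1 : ∀ b → ⟦ b ⟧ ≤ 1
  ⟦⟧≤1 true  = ≤-refl
  ⟦⟧≤1 false = z≤n

subsets-All : ∀ {A : Set} {P : A → Set} s xs → All P xs → All (All P) (subsets s xs)
subsets-All zero    xs       _        = [] ∷ []
subsets-All (suc s) []       _        = []
subsets-All (suc s) (x ∷ xs) (h ∷ hs) =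
  All.++⁺ (All.map⁺ (All.map (h ∷_) (subsets-All s xs hs))) (subsets-All (suc s) xs hs)

subsets-AllPairs : ∀ {A : Set} {R : A → A → Set} s xs → AllPairs R xs → All (AllPairs R) (subsets s xs)
subsets-AllPairs zero    xs       _        = [] ∷ []
subsets-AllPairs (suc s) []       _        = []
subsets-AllPairs (suc s) (x ∷ xs) (h ∷ hs) = All.++⁺
  (All.map⁺ (All.zipWith (λ { (p , q) → p ∷ q }) (subsets-All s xs h , subsets-AllPairs s xs hs)))
  (subsets-AllPairs (suc s) xs hs)

subsets-length : ∀ {A : Set} s (xs : List A) → All (λ S → length S ≡ s) (subsets s xs)
subsets-length zero    xs       = refl ∷ []
subsets-length (suc s) []       = []
subsets-length (suc s) (x ∷ xs) =
  All.++⁺ (All.map⁺ (All.map (cong suc) (subsets-length s xs))) (subsets-length (suc s) xs)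

filterᵇ∈subsets : ∀ {A : Set} (f : A → Bool) xs → filterᵇ f xs ∈ subsets (♯ f xs) xs
filterᵇ∈subsets f [] = here refl
filterᵇ∈subsets f (x ∷ xs) with f x
... | true = ∈-++⁺ˡ (∈-map⁺ (x ∷_) (filterᵇ∈subsets f xs))
... | false with ♯ f xs | filterᵇ∈subsets f xs
...   | zero  | h = h
...   | suc s | h = ∈-++⁺ʳ (map (x ∷_) (subsets s xs)) h

_choose_ : ℕ → ℕ → ℕ
t     choose zero  = 1
zero  choose suc j = 0
suc t choose suc j = t choose j + t choose suc j

-- The first two terms of the binomial expansion.
suc-^ : ∀ n k → suc k * n ^ k + n ^ suc k ≤ suc n ^ suc k
suc-^ n zero    = ≤-reflexive (eq n)
  where
  eq : ∀ n → 1 * 1 + n * 1 ≡ suc n * 1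
  eq = solve-∀
suc-^ n (suc k) = begin
  suc (suc k) * n ^ suc k + n ^ suc (suc k)
    ≤⟨ m≤m+n _ (suc k * n ^ k) ⟩
  suc (suc k) * (n * n ^ k) + n * (n * n ^ k) + suc k * n ^ k
    ≡⟨ eq k n (n ^ k) ⟩
  suc n * (suc k * n ^ k + n ^ suc k)
    ≤⟨ *-monoʳ-≤ (suc n) (suc-^ n k) ⟩
  suc n ^ suc (suc k) ∎
  where
  open ≤-Reasoning
  eq : ∀ k n m → suc (suc k) * (n * m) + n * (n * m) + suc k * m ≡ suc n * (suc k * m + n * m)
  eq = solve-∀

≤ᵇ-suc : ∀ j m → (suc j ≤ᵇ suc m) ≡ (j ≤ᵇ m)
≤ᵇ-suc zero    m = refl
≤ᵇ-suc (suc j) m = refl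

≤ᵇ-false : ∀ {j m} → m < j → (j ≤ᵇ m) ≡ false
≤ᵇ-false {suc j} {zero}  _         = refl
≤ᵇ-false {suc j} {suc m} (s≤s lt) = trans (≤ᵇ-suc j m) (≤ᵇ-false lt)

♯-cong : ∀ {A : Set} {f g : A → Bool} xs → (∀ x → f x ≡ g x) → ♯ f xs ≡ ♯ g xs
♯-cong []       h = refl
♯-cong (x ∷ xs) h = cong₂ (λ b t → ⟦ b ⟧ + t) (h x) (♯-cong xs h)

spread : ∀ c n k a b → a * k ! ≤ c * n ^ k → b * suc k ! ≤ c * n ^ suc k → (a + b) * suc k ! ≤ c * suc n ^ suc k
spread c n k a b ha hb = begin
  (a + b) * (suc k * k !)              ≡⟨ eq₁ a b (suc k) (k !) ⟩
  suc k * (a * k !) + b * (suc k * k !) ≤⟨ +-mono-≤ (*-monoʳ-≤ (suc k) ha) hb ⟩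
  suc k * (c * n ^ k) + c * n ^ suc k  ≡⟨ eq₂ (suc k) c (n ^ k) (n ^ suc k) ⟩
  c * (suc k * n ^ k + n ^ suc k)      ≤⟨ *-monoʳ-≤ c (suc-^ n k) ⟩
  c * suc n ^ suc k                    ∎
  where
  open ≤-Reasoning
  eq₁ : ∀ a b k m → (a + b) * (k * m) ≡ k * (a * m) + b * (k * m)
  eq₁ = solve-∀
  eq₂ : ∀ k c m l → k * (c * m) + c * l ≡ c * (k * m + l)
  eq₂ = solve-∀

♯-subsets-∷ : ∀ {A : Set} (f : List A → Bool) s x xs →
  ♯ f (subsets (suc s) (x ∷ xs)) ≡ ♯ (λ S → f (x ∷ S)) (subsets s xs) + ♯ f (subsets (suc s) xs)
♯-subsets-∷ f s x xs = trans (♯-++ f (map (x ∷_) (subsets s xs)) _)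
  (cong (_+ ♯ f (subsets (suc s) xs)) (♯-map f (x ∷_) (subsets s xs)))

-- Every such subset arises by choosing j elements of `T` and then k further elements, whose k!
-- orders are all counted in the k-th power. The induction follows Pascal's rule at elements of `T`
-- and `suc-^` at the others.
subsets-meeting : ∀ {A : Set} (T : A → Bool) xs j k →
  ♯ (λ S → j ≤ᵇ ♯ T S) (subsets (j + k) xs) * k ! ≤ (♯ T xs choose j) * length xs ^ k
subsets-meeting T []       zero    zero    = ≤-refl
subsets-meeting T []       zero    (suc k) = z≤n
subsets-meeting T []       (suc j) k       = z≤n
subsets-meeting T (x ∷ xs) zero    zero    = ≤-refl
subsets-meeting T (x ∷ xs) zero    (suc k) = ≤-trans
  (≤-reflexive (cong (_* suc k !) (♯-subsets-∷ (λ S → 0 ≤ᵇ ♯ T S) k x xs)))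
  (spread 1 (length xs) k (hits k) (hits (suc k)) (subsets-meeting T xs zero k) (subsets-meeting T xs zero (suc k)))
  where
  hits : ℕ → ℕ
  hits s = ♯ (λ S → 0 ≤ᵇ ♯ T S) (subsets s xs)
subsets-meeting T (x ∷ xs) (suc j) k rewrite ♯-subsets-∷ (λ S → suc j ≤ᵇ ♯ T S) (j + k) x xs with T x
... | true = begin
  (♯ (λ S → suc j ≤ᵇ suc (♯ T S)) (subsets (j + k) xs) + b) * k !
    ≡⟨ cong (λ a → (a + b) * k !) (♯-cong (subsets (j + k) xs) (λ S → ≤ᵇ-suc j (♯ T S))) ⟩
  (a + b) * k !
    ≡⟨ *-distribʳ-+ (k !) a b ⟩
  a * k ! + b * k !
    ≤⟨ +-mono-≤ (subsets-meeting T xs j k) (subsets-meeting T xs (suc j) k) ⟩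
  (t choose j) * n ^ k + (t choose suc j) * n ^ k
    ≡⟨ *-distribʳ-+ (n ^ k) (t choose j) (t choose suc j) ⟨
  (t choose j + t choose suc j) * n ^ k
    ≤⟨ *-monoʳ-≤ (t choose j + t choose suc j) (^-monoˡ-≤ k (n≤1+n n)) ⟩
  (t choose j + t choose suc j) * suc n ^ k ∎
  where
  open ≤-Reasoning
  a = ♯ (λ S → j ≤ᵇ ♯ T S) (subsets (j + k) xs)
  b = ♯ (λ S → suc j ≤ᵇ ♯ T S) (subsets (suc j + k) xs)
  t = ♯ T xs
  n = length xs
-- Here all j + 1 elements must lie in `T`, so no admissible subset contains `x`.
subsets-meeting T (x ∷ xs) (suc j) zero | false = begin
  (♯ (λ S → suc j ≤ᵇ ♯ T S) (subsets (j + 0) xs) + b) * 1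
    ≡⟨ cong (λ a → (a + b) * 1) (♯-none _ (subsets (j + 0) xs) (All.map (λ {S} e →
         ≤ᵇ-false (s≤s (≤-trans (♯≤length T S) (≤-reflexive (trans e (+-identityʳ j)))))) (subsets-length (j + 0) xs))) ⟩
  b * 1
    ≤⟨ subsets-meeting T xs (suc j) 0 ⟩
  (♯ T xs choose suc j) * 1 ∎
  where
  open ≤-Reasoning
  b = ♯ (λ S → suc j ≤ᵇ ♯ T S) (subsets (suc j + 0) xs)
subsets-meeting T (x ∷ xs) (suc j) (suc k) | false =
  spread (♯ T xs choose suc j) (length xs) k (hits (j + suc k)) (hits (suc j + suc k))
    (subst (λ s → ♯ (λ S → suc j ≤ᵇ ♯ T S) (subsets s xs) * k ! ≤ (♯ T xs choose suc j) * length xs ^ k)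
      (sym (+-suc j k)) (subsets-meeting T xs (suc j) k))
    (subsets-meeting T xs (suc j) (suc k))
  where
  hits : ℕ → ℕ
  hits s = ♯ (λ S → suc j ≤ᵇ ♯ T S) (subsets s xs)

-- Ordered set partitions

interleave : ∀ {A : Set} → A → ℕ → List A → List (List A)
interleave c zero    rs       = rs ∷ []
interleave c (suc j) []       = map (c ∷_) (interleave c j [])
interleave c (suc j) (r ∷ rs) = map (c ∷_) (interleave c j (r ∷ rs)) ++ map (r ∷_) (interleave c (suc j) rs)

-- Ordered set partitions of k positions, written as the list of block numbers
-- starting from c. In blocks f c j k there are j + k positions, and at least j of
-- them lie in the block c. The fuel f must be at least k.
mutual
  codes : ℕ → ℕ → ℕ → List (List ℕ)
  codes f       c zero    = [] ∷ []
  codes zero    c (suc k) = []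
  codes (suc f) c (suc k) = blocks f c 1 k

  blocks : ℕ → ℕ → ℕ → ℕ → List (List ℕ)
  blocks f c j zero    = concatMap (interleave c j) (codes f (suc c) zero)
  blocks f c j (suc k) = concatMap (interleave c j) (codes f (suc c) (suc k)) ++ blocks f c (suc j) k

-- binomial j k = (j + k)! / (j! k!).
binomial : ℕ → ℕ → ℕ
binomial zero    k       = 1
binomial (suc j) zero    = binomial j zero
binomial (suc j) (suc k) = binomial j (suc k) + binomial (suc j) k

-- For f ≥ k, `♯codes f k` is the ordered Bell number, computed by summing over the size j of the
-- first block with j of the positions chosen for it.
mutual
  ♯codes : ℕ → ℕ → ℕ
  ♯codes f       zero    = 1
  ♯codes zero    (suc k) = 0
  ♯codes (suc f) (suc k) = ♯blocks f 1 k

  ♯blocks : ℕ → ℕ → ℕ → ℕ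
  ♯blocks f j zero    = binomial j zero * ♯codes f zero
  ♯blocks f j (suc k) = binomial j (suc k) * ♯codes f (suc k) + ♯blocks f (suc j) k

binomial-! : ∀ j k → binomial j k * (j ! * k !) ≡ (j + k) !
binomial-! zero    k       = trans (*-identityˡ _) (*-identityˡ (k !))
binomial-! (suc j) zero    = begin
  binomial j 0 * (suc j * j ! * 1)   ≡⟨ eq (binomial j 0) (suc j) (j !) ⟩
  suc j * (binomial j 0 * (j ! * 1)) ≡⟨ cong (suc j *_) (binomial-! j 0) ⟩
  suc j * (j + 0) !                  ≡⟨ cong (λ m → suc m * (j + 0) !) (+-identityʳ j) ⟨
  suc (j + 0) * (j + 0) !            ∎
  where
  open ≡-Reasoning
  eq : ∀ b s m → b * (s * m * 1) ≡ s * (b * (m * 1))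
  eq = solve-∀
binomial-! (suc j) (suc k) = begin
  (binomial j (suc k) + binomial (suc j) k) * (suc j * j ! * (suc k * k !))
    ≡⟨ eq₁ (binomial j (suc k)) (binomial (suc j) k) j (j !) k (k !) ⟩
  suc j * (binomial j (suc k) * (j ! * (suc k * k !))) + suc k * (binomial (suc j) k * (suc j * j ! * k !))
    ≡⟨ cong₂ (λ a b → suc j * a + suc k * b) (binomial-! j (suc k)) (binomial-! (suc j) k) ⟩
  suc j * (j + suc k) ! + suc k * (suc j + k) !
    ≡⟨ cong (λ m → suc j * (j + suc k) ! + suc k * m !) (sym (+-suc j k)) ⟩
  suc j * (j + suc k) ! + suc k * (j + suc k) !
    ≡⟨ eq₂ j k ((j + suc k) !) ⟩
  suc (j + suc k) * (j + suc k) ! ∎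
  where
  open ≡-Reasoning
  eq₁ : ∀ a b j m k l → (a + b) * (suc j * m * (suc k * l)) ≡
    suc j * (a * (m * (suc k * l))) + suc k * (b * (suc j * m * l))
  eq₁ = solve-∀
  eq₂ : ∀ j k m → suc j * m + suc k * m ≡ suc (j + suc k) * m
  eq₂ = solve-∀

length-interleave : ∀ {A : Set} (c : A) j rs → length (interleave c j rs) ≡ binomial j (length rs)
length-interleave c zero    rs       = refl
length-interleave c (suc j) []       = trans (length-map (c ∷_) (interleave c j [])) (length-interleave c j [])
length-interleave c (suc j) (r ∷ rs) = trans (length-++ (map (c ∷_) (interleave c j (r ∷ rs))))
  (cong₂ _+_ (trans (length-map (c ∷_) (interleave c j (r ∷ rs))) (length-interleave c j (r ∷ rs)))
    (trans (length-map (r ∷_) (interleave c (suc j) rs)) (length-interleave c (suc j) rs)))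

interleave-lengths : ∀ {A : Set} (c : A) j rs → All (λ r → length r ≡ j + length rs) (interleave c j rs)
interleave-lengths c zero    rs       = refl ∷ []
interleave-lengths c (suc j) []       = All.map⁺ (All.map (cong suc) (interleave-lengths c j []))
interleave-lengths c (suc j) (r ∷ rs) = All.++⁺ (All.map⁺ (All.map (cong suc) (interleave-lengths c j (r ∷ rs))))
  (All.map⁺ (All.map (λ e → cong suc (trans e (sym (+-suc j (length rs))))) (interleave-lengths c (suc j) rs)))

concatMap-All : ∀ {A B : Set} {P : A → Set} {Q : B → Set} (g : A → List B) → (∀ x → P x → All Q (g x)) →
  ∀ xs → All P xs → All Q (concatMap g xs)
concatMap-All g h xs ps = All.concat⁺ (All.map⁺ (All.map (λ {x} → h x) ps))

mutual
  codes-lengths : ∀ f c k → All (λ r → length r ≡ k) (codes f c k)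
  codes-lengths f       c zero    = refl ∷ []
  codes-lengths zero    c (suc k) = []
  codes-lengths (suc f) c (suc k) = blocks-lengths f c 1 k

  blocks-lengths : ∀ f c j k → All (λ r → length r ≡ j + k) (blocks f c j k)
  blocks-lengths f c j zero    = concatMap-All (interleave c j)
    (λ rs e → All.map (λ e′ → trans e′ (cong (λ m → j + m) e)) (interleave-lengths c j rs)) _ (codes-lengths f (suc c) zero)
  blocks-lengths f c j (suc k) = All.++⁺ (concatMap-All (interleave c j)
    (λ rs e → All.map (λ e′ → trans e′ (cong (λ m → j + m) e)) (interleave-lengths c j rs)) _ (codes-lengths f (suc c) (suc k)))
    (All.map (λ e → trans e (sym (+-suc j k))) (blocks-lengths f c (suc j) k))

length-concatMap : ∀ {A B : Set} (g : A → List B) b xs → All (λ x → length (g x) ≡ b) xs →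
  length (concatMap g xs) ≡ b * length xs
length-concatMap g b []       []       = sym (*-zeroʳ b)
length-concatMap g b (x ∷ xs) (h ∷ hs) = trans (length-++ (g x)) (trans (cong₂ _+_ h (length-concatMap g b xs hs))
  (sym (*-suc b (length xs))))

mutual
  length-codes : ∀ f c k → length (codes f c k) ≡ ♯codes f k
  length-codes f       c zero    = refl
  length-codes zero    c (suc k) = refl
  length-codes (suc f) c (suc k) = length-blocks f c 1 k

  length-blocks : ∀ f c j k → length (blocks f c j k) ≡ ♯blocks f j k
  length-blocks f c j zero    = length-block f c j zero
  length-blocks f c j (suc k) = trans (length-++ (concatMap (interleave c j) (codes f (suc c) (suc k))))
    (cong₂ _+_ (length-block f c j (suc k)) (length-blocks f c (suc j) k))

  length-block : ∀ f c j k → length (concatMap (interleave c j) (codes f (suc c) k)) ≡ binomial j k * ♯codes f k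
  length-block f c j k = trans (length-concatMap (interleave c j) (binomial j k) (codes f (suc c) k)
      (All.map (λ {rs} e → trans (length-interleave c j rs) (cong (binomial j) e)) (codes-lengths f (suc c) k)))
    (cong (binomial j k *_) (length-codes f (suc c) k))

∈-filterᵇ⁺ : ∀ {A : Set} (f : A → Bool) {x xs} → x ∈ xs → f x ≡ true → x ∈ filterᵇ f xs
∈-filterᵇ⁺ f {x} (here refl) h rewrite h = here refl
∈-filterᵇ⁺ f {xs = y ∷ _} (there p) h with f y
... | true  = there (∈-filterᵇ⁺ f p h)
... | false = ∈-filterᵇ⁺ f p h

∈-filterᵇ⁻ : ∀ {A : Set} (f : A → Bool) {x} xs → x ∈ filterᵇ f xs → x ∈ xs × f x ≡ true
∈-filterᵇ⁻ f (y ∷ xs) p with f y in eq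
∈-filterᵇ⁻ f (y ∷ xs) (here refl) | true = here refl , eq
∈-filterᵇ⁻ f (y ∷ xs) (there p) | true  = let (q , h) = ∈-filterᵇ⁻ f xs p in there q , h
∈-filterᵇ⁻ f (y ∷ xs) p         | false = let (q , h) = ∈-filterᵇ⁻ f xs p in there q , h

GapFree : ℕ → List ℕ → Set
GapFree c r = (∀ v → v ∈ r → c ≤ v) × (∀ v w → v ∈ r → c ≤ w → w ≤ v → w ∈ r)

is : ℕ → ℕ → Bool
is = _≡ᵇ_

interleave-∷ : ∀ (c : ℕ) j rs {r} → r ∈ interleave c j rs → (c ∷ r) ∈ interleave c (suc j) rs
interleave-∷ c j []       p = ∈-map⁺ (c ∷_) p
interleave-∷ c j (_ ∷ _)  p = ∈-++⁺ˡ (∈-map⁺ (c ∷_) p)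

interleave-∷′ : ∀ (c : ℕ) j v rs {r} → r ∈ interleave c j rs → (v ∷ r) ∈ interleave c j (v ∷ rs)
interleave-∷′ c zero    v rs (here refl) = here refl
interleave-∷′ c (suc j) v rs p = ∈-++⁺ʳ (map (c ∷_) (interleave c j (v ∷ rs))) (∈-map⁺ (v ∷_) p)

interleave-filter : ∀ c r → r ∈ interleave c (♯ (is c) r) (filterᵇ (λ v → not (is c v)) r)
interleave-filter c []      = here refl
interleave-filter c (v ∷ r) with c ≡ᵇ v in eq
... | true rewrite sym (≡ᵇ⇒≡ c v (subst T (sym eq) tt)) =
  interleave-∷ c (♯ (is c) r) (filterᵇ (λ v → not (is c v)) r) (interleave-filter c r)
... | false = interleave-∷′ c (♯ (is c) r) v (filterᵇ (λ v → not (is c v)) r) (interleave-filter c r)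

block⊆blocks : ∀ f c j k {r rs} → rs ∈ codes f (suc c) k → r ∈ interleave c j rs → r ∈ blocks f c j k
block⊆blocks f c j zero    p q = ∈-concatMap⁺ (interleave c j) (Any.map (λ { refl → q }) p)
block⊆blocks f c j (suc k) p q = ∈-++⁺ˡ (∈-concatMap⁺ (interleave c j) (Any.map (λ { refl → q }) p))

blocks-complete : ∀ i f c j k {r rs} → rs ∈ codes f (suc c) k → r ∈ interleave c (i + j) rs → r ∈ blocks f c j (i + k)
blocks-complete zero    f c j k p q = block⊆blocks f c j k p q
blocks-complete (suc i) f c j k {r} {rs} p q = ∈-++⁺ʳ (concatMap (interleave c j) (codes f (suc c) (suc (i + k))))
  (blocks-complete i f c (suc j) k p (subst (λ m → r ∈ interleave c m rs) (sym (+-suc i j)) q))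

-- The positions of value `c` form the first block, which is nonempty because a gap-free list starts
-- at `c`. Deleting them leaves a gap-free list from c + 1.
codes-complete : ∀ f c r → length r ≤ f → GapFree c r → r ∈ codes f c (length r)
codes-complete f       c []        _   _ = here refl
codes-complete (suc f) c r@(v ∷ r′) len (lower , closed) = by-count (♯ (is c) r) refl
  where
  other : ℕ → Bool
  other w = not (is c w)
  rest : List ℕ
  rest = filterᵇ other r
  c∈r : c ∈ r
  c∈r = closed v c (here refl) ≤-refl (lower v (here refl))
  ♯-pos : ∀ {r} → c ∈ r → 0 < ♯ (is c) r
  ♯-pos (here refl) rewrite dec-true (c ≟ c) refl = z<s
  ♯-pos (there p)   = <-≤-trans (♯-pos p) (m≤n+m _ _)
  rest-gapfree : GapFree (suc c) rest
  rest-gapfree = lower′ , closed′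
    where
    ≢c : ∀ w → w ∈ rest → c ≢ w
    ≢c w p refl with () ← trans (sym (proj₂ (∈-filterᵇ⁻ other r p))) (cong not (dec-true (c ≟ c) refl))
    lower′ : ∀ w → w ∈ rest → suc c ≤ w
    lower′ w p = ≤∧≢⇒< (lower w (proj₁ (∈-filterᵇ⁻ other r p))) (≢c w p)
    closed′ : ∀ w u → w ∈ rest → suc c ≤ u → u ≤ w → u ∈ rest
    closed′ w u p c<u u≤w = ∈-filterᵇ⁺ other (closed w u (proj₁ (∈-filterᵇ⁻ other r p)) (<⇒≤ c<u) u≤w)
      (cong not (dec-false (c ≟ u) (<⇒≢ c<u)))
  lengths : ♯ (is c) r + length rest ≡ length r
  lengths = trans (cong₂ _+_ (sym (trans (length-♯ (filterᵇ (is c) r)) (length-filterᵇ (is c) r))) (sym (length-♯ rest)))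
    (trans (♯-partition (λ _ → true) (is c) r) (length-♯ r))
  by-count : ∀ j → ♯ (is c) r ≡ j → r ∈ codes (suc f) c (length r)
  by-count zero    e = contradiction (♯-pos c∈r) (<⇒≱ (s≤s (≤-reflexive e)))
  by-count (suc i) e = subst (λ k → r ∈ blocks f c 1 k) length-r′
    (blocks-complete i f c 1 (length rest) (codes-complete f (suc c) rest (≤-trans (≤-trans (m≤n+m (length rest) i)
        (≤-reflexive length-r′)) (s≤s⁻¹ len)) rest-gapfree)
      (subst (λ m → r ∈ interleave c m rest) (trans e (+-comm 1 i)) (interleave-filter c r)))
    where
    length-r′ : i + length rest ≡ length r′
    length-r′ = suc-injective (trans (cong (_+ length rest) (sym e)) lengths)

-- Patterns of edge colours that force a threshold graph

odd : ℕ → Bool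
odd zero    = false
odd (suc m) = not (odd m)

triangle : ℕ → ℕ
triangle zero    = 0
triangle (suc s) = s + triangle s

member : ∀ {n} → Fin n → List (Fin n) → Bool
member u []       = false
member u (x ∷ xs) = does (x Fin.≟ u) ∨ member u xs

∈⇒member : ∀ {n} {u : Fin n} {xs} → u ∈ xs → member u xs ≡ true
∈⇒member {u = u} (here refl) rewrite dec-true (u Fin.≟ u) refl = refl
∈⇒member {u = u} {x ∷ xs} (there p) = trans (cong (does (x Fin.≟ u) ∨_) (∈⇒member p)) (Bool.∨-zeroʳ _)

♯-tabulate : ∀ {A : Set} {n} (f : A → Bool) (g : Fin n → A) → ♯ f (tabulate g) ≡ sum (λ i → ⟦ f (g i) ⟧)
♯-tabulate {n = zero}  f g = refl
♯-tabulate {n = suc n} f g = cong (λ t → ⟦ f (g zero) ⟧ + t) (♯-tabulate f (λ i → g (suc i)))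

♯-member : ∀ {n} (S : List (Fin n)) → ♯ (λ u → member u S) (allFin n) ≤ length S
♯-member {n} S = ≤-trans (≤-reflexive (♯-tabulate (λ u → member u S) (λ i → i))) (bound S)
  where
  open ≤-Reasoning
  ∨-≤ : ∀ a b → ⟦ a ∨ b ⟧ ≤ ⟦ a ⟧ + ⟦ b ⟧
  ∨-≤ true  b = s≤s z≤n
  ∨-≤ false b = ≤-refl
  bound : ∀ S → sum (λ (u : Fin n) → ⟦ member u S ⟧) ≤ length S
  bound []      = ≤-reflexive (sum-replicate-zero n)
  bound (x ∷ S) = begin
    sum (λ u → ⟦ member u (x ∷ S) ⟧)
      ≤⟨ sum-mono (λ u → ∨-≤ (does (x Fin.≟ u)) (member u S)) ⟩
    sum (λ u → ⟦ does (x Fin.≟ u) ⟧ + ⟦ member u S ⟧)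
      ≡⟨ ∑-distrib-+ (λ u → ⟦ does (x Fin.≟ u) ⟧) (λ u → ⟦ member u S ⟧) ⟩
    sum (λ u → ⟦ does (x Fin.≟ u) ⟧) + sum (λ u → ⟦ member u S ⟧)
      ≤⟨ +-mono-≤ (≤-reflexive (size-singleton x)) (bound S) ⟩
    suc (length S) ∎

1≤♯ : ∀ {A : Set} (f : A → Bool) {v xs} → v ∈ xs → f v ≡ true → 1 ≤ ♯ f xs
1≤♯ f (here refl) h rewrite h = s≤s z≤n
1≤♯ f (there p)   h = ≤-trans (1≤♯ f p h) (m≤n+m _ _)

2≤♯ : ∀ {A : Set} (f : A → Bool) {u v xs} → u ≢ v → u ∈ xs → v ∈ xs → f u ≡ true → f v ≡ true → 2 ≤ ♯ f xs
2≤♯ f u≢v (here refl) (here refl) _  _  = contradiction refl u≢v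
2≤♯ f u≢v (here refl) (there q)   fu fv rewrite fu = s≤s (1≤♯ f q fv)
2≤♯ f u≢v (there p)   (here refl) fu fv rewrite fv = s≤s (1≤♯ f p fu)
2≤♯ f u≢v (there p)   (there q)   fu fv = ≤-trans (2≤♯ f u≢v p q fu fv) (m≤n+m _ _)

choose-2 : ∀ t → t choose 2 ≤ t * t
choose-2 zero    = z≤n
choose-2 (suc t) = begin
  t choose 1 + t choose 2 ≤⟨ +-mono-≤ (choose-1 t) (choose-2 t) ⟩
  t + t * t               ≤⟨ m≤m+n _ (suc t) ⟩
  t + t * t + suc t       ≡⟨ eq t ⟩
  suc t * suc t           ∎
  where
  open ≤-Reasoning
  choose-1 : ∀ t → t choose 1 ≤ t
  choose-1 zero    = z≤n
  choose-1 (suc t) = s≤s (choose-1 t)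
  eq : ∀ t → t + t * t + suc t ≡ suc t * suc t
  eq = solve-∀

♯-concatMap : ∀ {A B : Set} (g : B → Bool) (h : A → List B) (f : A → Bool) t xs →
  All (λ x → ♯ g (h x) ≤ t * ⟦ f x ⟧) xs → ♯ g (concatMap h xs) ≤ t * ♯ f xs
♯-concatMap g h f t []       []       = z≤n
♯-concatMap g h f t (x ∷ xs) (p ∷ ps) = begin
  ♯ g (h x ++ concatMap h xs)          ≡⟨ ♯-++ g (h x) (concatMap h xs) ⟩
  ♯ g (h x) + ♯ g (concatMap h xs)     ≤⟨ +-mono-≤ p (♯-concatMap g h f t xs ps) ⟩
  t * ⟦ f x ⟧ + t * ♯ f xs             ≡⟨ *-distribˡ-+ t ⟦ f x ⟧ (♯ f xs) ⟨
  t * (⟦ f x ⟧ + ♯ f xs)               ∎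
  where open ≤-Reasoning

module Patterns (n : ℕ) where

  open LocalLemma {n * n}

  Ranked : Set
  Ranked = Fin n × ℕ

  -- The lower rank belongs to the vertex added later, which dictates the colour of the pair.
  -- Consecutive runs alternate in colour, so the parity of that rank is the colour.
  literal : Ranked → Ranked → Fin (n * n) × Bool
  literal (u , a) (v , b) = combine u v , odd (a ⊓ b)

  literals : List Ranked → Pattern
  literals []       = []
  literals (w ∷ ws) = map (literal w) ws ++ literals ws

  length-literals : ∀ ws → length (literals ws) ≡ triangle (length ws)
  length-literals []       = refl
  length-literals (w ∷ ws) = trans (length-++ (map (literal w) ws)) (cong₂ _+_ (length-map (literal w) ws) (length-literals ws))

  _≢₁_ : Ranked → Ranked → Set
  w ≢₁ w′ = proj₁ w ≢ proj₁ w′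

  literals-avoid : ∀ u ws → All (λ w → u ≢ proj₁ w) ws → All (λ l → ∀ v → combine u v ≢ proj₁ l) (literals ws)
  literals-avoid u []       []       = []
  literals-avoid u (w ∷ ws) (h ∷ hs) = All.++⁺
    (All.map⁺ (All.universal (λ w′ v e → h (proj₁ (Fin.combine-injective u v (proj₁ w) (proj₁ w′) e))) ws))
    (literals-avoid u ws hs)

  distinct-literals : ∀ ws → AllPairs _≢₁_ ws → Distinct (literals ws)
  distinct-literals []       []       = []
  distinct-literals (w ∷ ws) (h ∷ hs) = AllPairs.++⁺
    (AllPairs.map⁺ (AllPairs.map (λ {x} {y} ne e → ne (proj₂ (Fin.combine-injective (proj₁ w) (proj₁ x) (proj₁ w) (proj₁ y) e))) hs))
    (distinct-literals ws hs)
    (All.map⁺ (All.universal (λ w′ → All.map (λ no → no (proj₁ w′)) (literals-avoid (proj₁ w) ws h)) ws))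

  mentions-∈ : ∀ i (p : Pattern) → mentions i p ≡ true → ∃[ b ] (i , b) ∈ p
  mentions-∈ i ((j , b) ∷ p) h with i Fin.≟ j
  ... | yes refl = b , here refl
  ... | no _     = let (b , q) = mentions-∈ i p h in b , there q

  overlaps-∈ : ∀ (p q : Pattern) → overlaps p q ≡ true → ∃[ i ] ∃[ b ] ∃[ b′ ] ((i , b) ∈ p × (i , b′) ∈ q)
  overlaps-∈ ((i , b) ∷ p) q h with mentions i q in eq
  ... | true  = let (b′ , r) = mentions-∈ i q eq in i , b , b′ , here refl , r
  ... | false = let (j , c , c′ , r , r′) = overlaps-∈ p q h in j , c , c′ , there r , r′

  literal-∈ : ∀ ws {i b} → AllPairs _≢₁_ ws → (i , b) ∈ literals ws →
    ∃[ u ] ∃[ v ] (u ≢ v × i ≡ combine u v × u ∈ map proj₁ ws × v ∈ map proj₁ ws)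
  literal-∈ (w ∷ ws) (h ∷ hs) p with ∈-++⁻ (map (literal w) ws) p
  ... | inj₁ q = let (w′ , w′∈ , e) = ∈-map⁻ (literal w) q in
        proj₁ w , proj₁ w′ , All.lookup h w′∈ , cong proj₁ e , here refl , there (∈-map⁺ proj₁ w′∈)
  ... | inj₂ q = let (u , v , u≢v , e , u∈ , v∈) = literal-∈ ws hs q in u , v , u≢v , e , there u∈ , there v∈

  overlaps⇒meet : ∀ ws ws′ → AllPairs _≢₁_ ws → AllPairs _≢₁_ ws′ → overlaps (literals ws) (literals ws′) ≡ true →
    2 ≤ ♯ (λ u → member u (map proj₁ ws)) (map proj₁ ws′)
  overlaps⇒meet ws ws′ d d′ h with overlaps-∈ (literals ws) (literals ws′) h
  ... | i , _ , _ , p , p′ with literal-∈ ws d p | literal-∈ ws′ d′ p′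
  ...   | u , v , u≢v , refl , u∈ , v∈ | u′ , v′ , _ , e , u′∈ , v′∈ with Fin.combine-injective u v u′ v′ e
  ...     | refl , refl = 2≤♯ _ u≢v u′∈ v′∈ (∈⇒member u∈) (∈⇒member v∈)

  map-proj₁-zip : ∀ (S : List (Fin n)) (r : List ℕ) → length r ≡ length S → map proj₁ (zip S r) ≡ S
  map-proj₁-zip []      []      _ = refl
  map-proj₁-zip (u ∷ S) (a ∷ r) e = cong (u ∷_) (map-proj₁-zip S r (suc-injective e))

  ≢₁-zip : ∀ S r → length r ≡ length S → AllPairs _≢_ S → AllPairs _≢₁_ (zip S r)
  ≢₁-zip S r e d = AllPairs.map⁻ (subst (AllPairs _≢_) (sym (map-proj₁-zip S r e)) d)

  module _ (s : ℕ) where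

    -- Starting the numbering at 0 or at 1 encodes the colour of the first block.
    rankings : List (List ℕ)
    rankings = codes s 0 s ++ codes s 1 s

    patternsOn : List (Fin n) → List Pattern
    patternsOn S = map (λ r → literals (zip S r)) rankings

    patterns : List Pattern
    patterns = concatMap patternsOn (subsets s (allFin n))

    Shape : Pattern → Set
    Shape p = Σ[ S ∈ List (Fin n) ] Σ[ r ∈ List ℕ ]
      p ≡ literals (zip S r) × length S ≡ s × length r ≡ s × AllPairs _≢_ S

    rankings-length : All (λ r → length r ≡ s) rankings
    rankings-length = All.++⁺ (codes-lengths s 0 s) (codes-lengths s 1 s)

    subsets-valid : All (λ S → length S ≡ s × AllPairs _≢_ S) (subsets s (allFin n))
    subsets-valid = All.zip (subsets-length s (allFin n) , subsets-AllPairs s (allFin n) (AllPairs.tabulate⁺ (λ ne e → ne e)))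

    patterns-shape : All Shape patterns
    patterns-shape = concatMap-All patternsOn
      (λ S (e , d) → All.map⁺ (All.map (λ {r} e′ → S , r , refl , e , e′ , d) rankings-length)) _ subsets-valid

    t : ℕ
    t = ♯codes s s + ♯codes s s

    -- Overlapping patterns share a pair of vertices, so their vertex sets meet in at least two
    -- points. `subsets-meeting` with j = 2 counts these sets, and each carries `t` rankings.
    few-overlaps : ∀ k → s ≡ 2 + k → ∀ p → Shape p → ♯ (overlaps p) patterns * k ! ≤ t * (s * s * n ^ k)
    few-overlaps k s≡ p (S , r , refl , lS , lr , dS) = begin
      ♯ (overlaps p) patterns * k !
        ≤⟨ *-monoˡ-≤ (k !) (♯-concatMap (overlaps p) patternsOn meets t (subsets s (allFin n)) (All.map (λ {S′} → on S′) subsets-valid)) ⟩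
      t * ♯ meets (subsets s (allFin n)) * k !
        ≡⟨ trans (*-assoc t _ (k !)) (cong (λ m → t * (♯ meets (subsets m (allFin n)) * k !)) s≡) ⟩
      t * (♯ meets (subsets (2 + k) (allFin n)) * k !)
        ≤⟨ *-monoʳ-≤ t (subsets-meeting (λ u → member u S) (allFin n) 2 k) ⟩
      t * ((♯ (λ u → member u S) (allFin n) choose 2) * length (allFin n) ^ k)
        ≤⟨ *-monoʳ-≤ t (*-mono-≤ (≤-trans (choose-2 (♯ (λ u → member u S) (allFin n))) (*-mono-≤ T≤s T≤s)) (≤-reflexive (cong (_^ k) length-allFin))) ⟩
      t * (s * s * n ^ k) ∎
      where
      open ≤-Reasoning
      T≤s : ♯ (λ u → member u S) (allFin n) ≤ s
      T≤s = ≤-trans (♯-member S) (≤-reflexive lS)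
      length-allFin : length (allFin n) ≡ n
      length-allFin = length-tabulate {n = n} (λ i → i)
      meets : List (Fin n) → Bool
      meets S′ = 2 ≤ᵇ ♯ (λ u → member u S) S′
      on : ∀ S′ → length S′ ≡ s × AllPairs _≢_ S′ → ♯ (overlaps p) (patternsOn S′) ≤ t * ⟦ meets S′ ⟧
      on S′ (lS′ , dS′) with meets S′ in eq
      ... | true  = begin
        ♯ (overlaps p) (patternsOn S′) ≤⟨ ♯≤length (overlaps p) (patternsOn S′) ⟩
        length (patternsOn S′)         ≡⟨ length-map (λ r → literals (zip S′ r)) rankings ⟩
        length rankings                ≡⟨ trans (length-++ (codes s 0 s)) (cong₂ _+_ (length-codes s 0 s) (length-codes s 1 s)) ⟩
        t                              ≡⟨ *-identityʳ t ⟨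
        t * 1                          ∎
      ... | false = ≤-trans (≤-reflexive (♯-none (overlaps p) (patternsOn S′) (All.map⁺ (All.map (λ {r′} e →
          Bool.¬-not (λ o → contradiction (trans (sym eq) (hit r′ (trans e (sym lS′)) o)) λ ())) rankings-length)))) z≤n
        where
        hit : ∀ r′ → length r′ ≡ length S′ → overlaps p (literals (zip S′ r′)) ≡ true → meets S′ ≡ true
        hit r′ e o = true-≤ᵇ (subst₂ (λ A B → 2 ≤ ♯ (λ u → member u A) B)
            (map-proj₁-zip S r (trans lr (sym lS))) (map-proj₁-zip S′ r′ e)
            (overlaps⇒meet (zip S r) (zip S′ r′) (≢₁-zip S r (trans lr (sym lS)) dS) (≢₁-zip S′ r′ e dS′) o))
          where
          true-≤ᵇ : ∀ {m} → 2 ≤ m → (2 ≤ᵇ m) ≡ true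
          true-≤ᵇ (s≤s (s≤s _)) = refl

    avoiding-colouring : ∀ k m → s ≡ 2 + k → triangle s ≡ 2 + m → t * (s * s * n ^ k) ≤ 2 ^ m * k ! →
      ∃[ x ] avoids patterns x ≡ true
    -- Since `triangle s` is 2 + m, the hypothesis of the local lemma holds with equality for d =
    -- 2^m; `pred` is there because it takes d - 1.
    avoiding-colouring k m s≡ m≡ bound = local-lemma patterns (triangle s) (pred (2 ^ m)) sparse (All.map good patterns-shape)
      where
      suc-c : suc (pred (2 ^ m)) ≡ 2 ^ m
      suc-c = suc-pred (2 ^ m) {{m^n≢0 2 m}}
      sparse : 4 * suc (pred (2 ^ m)) ≤ 2 ^ triangle s
      sparse = ≤-reflexive (trans (cong (4 *_) suc-c) (trans (*-assoc 2 2 (2 ^ m)) (cong (2 ^_) (sym m≡))))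
      good : ∀ {p} → Shape p → length p ≡ triangle s × Distinct p × ♯ (overlaps p) patterns ≤ suc (pred (2 ^ m))
      good {p} sh@(S , r , refl , lS , lr , dS) =
        trans (length-literals (zip S r)) (cong triangle (trans (sym (length-map proj₁ (zip S r)))
          (trans (cong length (map-proj₁-zip S r (trans lr (sym lS)))) lS))) ,
        distinct-literals (zip S r) (≢₁-zip S r (trans lr (sym lS)) dS) ,
        subst (♯ (overlaps p) patterns ≤_) (sym suc-c)
          (*-cancelʳ-≤ _ (2 ^ m) (k !) {{k !≢0}} (≤-trans (few-overlaps k s≡ p sh) bound))

-- From embedded threshold graphs to patterns

module Layers {n : ℕ} (colour : Fin n → Fin n → Bool) (colour-sym : ∀ u v → colour u v ≡ colour v u) where

  open Coloured colour colour-sym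
  open Ramsey colour colour-sym

  -- A threshold structure on M: the maximal runs of equal colours in the
  -- construction order are numbered consecutively from c, the last vertex first.
  record Layered (k : ℕ) (X : VertexSet) (c : ℕ) : Set where
    field
      M       : VertexSet
      rank    : Fin n → ℕ
      M⊆X     : ∀ u → M u ≡ true → X u ≡ true
      size-M  : size M ≡ k
      lower   : ∀ u → M u ≡ true → c ≤ rank u
      closed  : ∀ u w → M u ≡ true → c ≤ w → w ≤ rank u → ∃[ v ] (M v ≡ true × rank v ≡ w)
      colours : ∀ u v → M u ≡ true → M v ≡ true → u ≢ v → colour u v ≡ odd (rank u ⊓ rank v)

  -- The new vertex gets rank `c`. It joins the last run of the rest when that run already starts at
  -- `c`, and opens a new run of the opposite colour when it starts at `suc c`.
  add-vertex : ∀ {k X} c c′ v b → X v ≡ true → odd c ≡ b → (c′ ≡ c ⊎ c′ ≡ suc c) →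
    Layered k (X ∩ N b v) c′ → Layered (suc k) X c
  add-vertex {k} {X} c c′ v b Xv odd-c c′≡ L = record
    { M = M′ ; rank = rank′ ; M⊆X = M′⊆X
    ; size-M = trans (trans (size-split M′ ｛v｝) (+-comm (size (M′ ∩ ｛v｝)) _))
        (trans (cong₂ _+_ (trans (size-cong outside) size-M) (trans (size-cong inside) (size-singleton v))) (+-comm k 1))
    ; lower = λ u _ → lower′ u ; closed = closed′ ; colours = colours′ }
    where
    open Layered L
    ｛v｝ M′ : VertexSet
    ｛v｝ u = does (v Fin.≟ u)
    M′ u = ｛v｝ u ∨ M u
    rank′ : Fin n → ℕ
    rank′ u = if ｛v｝ u then c else (if M u then rank u else c)
    c≤c′ : c ≤ c′
    c≤c′ = [ (λ e → ≤-reflexive (sym e)) , (λ e → ≤-trans (n≤1+n c) (≤-reflexive (sym e))) ]′ c′≡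
    v∉M : M v ≡ false
    v∉M = Bool.¬-not λ Mv → contradiction (trans (sym (∧-elimʳ {X v} (M⊆X v Mv))) (N-irrefl b v)) λ ()
    M′⊆X : ∀ u → M′ u ≡ true → X u ≡ true
    M′⊆X u h with v Fin.≟ u
    ... | yes refl = Xv
    ... | no _     = ∧-elimˡ (M⊆X u h)
    inside : ∀ u → M′ u ∧ ｛v｝ u ≡ ｛v｝ u
    inside u with v Fin.≟ u
    ... | yes _ = refl
    ... | no _  = Bool.∧-zeroʳ (M u)
    outside : ∀ u → M′ u ∧ not (｛v｝ u) ≡ M u
    outside u with v Fin.≟ u
    ... | yes refl = sym v∉M
    ... | no _     = Bool.∧-identityʳ (M u)
    lower′ : ∀ u → c ≤ rank′ u
    lower′ u with v Fin.≟ u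
    ... | yes _ = ≤-refl
    ... | no _ with M u in eq
    ...   | true  = ≤-trans c≤c′ (lower u eq)
    ...   | false = ≤-refl
    rank-v : rank′ v ≡ c
    rank-v rewrite dec-true (v Fin.≟ v) refl = refl
    M′v : M′ v ≡ true
    M′v rewrite dec-true (v Fin.≟ v) refl = refl
    rank-M : ∀ u → M u ≡ true → M′ u ≡ true × rank′ u ≡ rank u
    rank-M u Mu with v Fin.≟ u
    ... | yes refl = contradiction (trans (sym Mu) v∉M) λ ()
    ... | no _ rewrite Mu = refl , refl
    closed′ : ∀ u w → M′ u ≡ true → c ≤ w → w ≤ rank′ u → ∃[ y ] (M′ y ≡ true × rank′ y ≡ w)
    closed′ u w M′u c≤w w≤ with m≤n⇒m<n∨m≡n c≤w
    ... | inj₂ refl = v , M′v , rank-v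
    ... | inj₁ c<w with v Fin.≟ u
    ...   | yes _ = contradiction w≤ (<⇒≱ c<w)
    ...   | no _ with M u in Mu
    ...     | true =
      let (y , My , e) = closed u w Mu (≤-trans ([ (λ e → ≤-trans (≤-reflexive e) (n≤1+n c)) , ≤-reflexive ]′ c′≡) c<w) w≤
          (M′y , e′)   = rank-M y My
      in y , M′y , trans e′ e
    colour-v : ∀ u → M u ≡ true → colour v u ≡ odd (c ⊓ rank u)
    colour-v u Mu = trans (N-colour v u (∧-elimʳ {X u} (M⊆X u Mu)))
      (trans (sym odd-c) (cong odd (sym (m≤n⇒m⊓n≡m (≤-trans c≤c′ (lower u Mu))))))
    colours′ : ∀ u w → M′ u ≡ true → M′ w ≡ true → u ≢ w → colour u w ≡ odd (rank′ u ⊓ rank′ w)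
    colours′ u w M′u M′w u≢w with v Fin.≟ u | v Fin.≟ w
    ... | yes refl | yes refl = contradiction refl u≢w
    ... | yes refl | no _ rewrite M′w = colour-v w M′w
    ... | no _ | yes refl rewrite M′u = trans (colour-sym u v) (trans (colour-v u M′u) (cong odd (⊓-comm c (rank u))))
    ... | no _ | no _ rewrite M′u | M′w = colours u w M′u M′w u≢w

  -- `b` is the colour of the last run. The starting number stays free within its parity, since a
  -- change of colour shifts the numbering of everything before.
  layers : ∀ {k X} → Emb k X → ∃[ b ] ∀ c → odd c ≡ b → Layered k X c
  -- A single vertex has no edge to fix the colour of its run; `false` is a choice.
  layers {X = X} (one v Xv) = false , λ c _ → record
    { M = λ u → does (v Fin.≟ u) ; rank = λ _ → c ; M⊆X = λ u h → subst (λ w → X w ≡ true) (≟-true u h) Xv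
    ; size-M = size-singleton v ; lower = λ _ _ → ≤-refl
    ; closed = λ u w _ c≤w w≤c → v , dec-true (v Fin.≟ v) refl , ≤-antisym c≤w w≤c
    ; colours = λ u w hu hw u≢w → contradiction (trans (sym (≟-true u hu)) (≟-true w hw)) u≢w }
    where
    ≟-true : ∀ u → does (v Fin.≟ u) ≡ true → v ≡ u
    ≟-true u h with v Fin.≟ u
    ... | yes e = e
  layers (more v b Xv emb) with layers emb
  ... | b′ , L = b , λ c odd-c → by-colour c odd-c (b′ Bool.≟ b)
    where
    by-colour : ∀ c → odd c ≡ b → Dec (b′ ≡ b) → _
    by-colour c odd-c (yes e)  = add-vertex c c v b Xv odd-c (inj₁ refl) (L c (trans odd-c (sym e)))
    by-colour c odd-c (no b′≢b) = add-vertex c (suc c) v b Xv odd-c (inj₂ refl)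
      (L (suc c) (trans (cong not odd-c) (sym (Bool.¬-not b′≢b))))

filterᵇ-AllPairs : ∀ {A : Set} {R : A → A → Set} f xs → AllPairs R xs → AllPairs R (filterᵇ f xs)
filterᵇ-AllPairs f []       []       = []
filterᵇ-AllPairs {A} {R} f (x ∷ xs) (h ∷ hs) with f x
... | true  = All.tabulate (λ p → All.lookup h (proj₁ (∈-filterᵇ⁻ f xs p))) ∷ filterᵇ-AllPairs f xs hs
... | false = filterᵇ-AllPairs f xs hs

avoids-∈ : ∀ {N} {ps p} {x : Vec Bool N} → p ∈ ps → LocalLemma.avoids ps x ≡ true → LocalLemma.matches p x ≡ false
avoids-∈ {p = p} {x} (here refl) h with LocalLemma.matches p x
... | false = refl
avoids-∈ {ps = q ∷ ps} {p} {x} (there i) h = avoids-∈ {ps = ps} {p} i (∧-elimʳ {not (LocalLemma.matches q x)} h)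

module _ (n s : ℕ) (x : Vec Bool (n * n)) where

  open Patterns n
  open LocalLemma {n * n}
  open Ramsey (pairColour n x) (pairColour-sym n x)
  open Layers (pairColour n x) (pairColour-sym n x)

  -- Listing `M` in increasing order turns each of its pairs into an entry that the graph actually
  -- reads; the ranks along this list are gap-free, hence one of the codes.
  layered⇒pattern : ∀ c → (∀ {r} → r ∈ codes s c s → r ∈ rankings s) → Layered s full c →
    ∃[ p ] (p ∈ patterns s × matches p x ≡ true)
  layered⇒pattern c sub L = literals (zip S r) ,
      ∈-concatMap⁺ (patternsOn s) (Any.map (λ { refl → ∈-map⁺ (λ r → literals (zip S r)) (sub r∈codes) }) S∈subsets) ,
      all-match S (filterᵇ-AllPairs M (allFin n) (AllPairs.tabulate⁺-< (λ lt → lt)))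
        (All.tabulate (λ p → proj₂ (∈-filterᵇ⁻ M (allFin n) p)))
    where
    open Layered L
    S : List (Fin n)
    S = filterᵇ M (allFin n)
    r : List ℕ
    r = map rank S
    ♯M : ♯ M (allFin n) ≡ s
    ♯M = trans (♯-tabulate M (λ i → i)) size-M
    length-S : length S ≡ s
    length-S = trans (length-filterᵇ M (allFin n)) ♯M
    length-r : length r ≡ s
    length-r = trans (length-map rank S) length-S
    S∈subsets : S ∈ subsets s (allFin n)
    S∈subsets = subst (λ m → S ∈ subsets m (allFin n)) ♯M (filterᵇ∈subsets M (allFin n))
    gap-free : GapFree c r
    gap-free = (λ v p → let (u , u∈ , e) = ∈-map⁻ rank p in
                  subst (c ≤_) (sym e) (lower u (proj₂ (∈-filterᵇ⁻ M (allFin n) u∈)))) ,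
               (λ v w p c≤w w≤v → let (u , u∈ , e) = ∈-map⁻ rank p
                                      (y , My , e′) = closed u w (proj₂ (∈-filterᵇ⁻ M (allFin n) u∈)) c≤w (subst (w ≤_) e w≤v)
                                  in subst (_∈ r) e′ (∈-map⁺ rank (∈-filterᵇ⁺ M (∈-allFin y) My)))
    r∈codes : r ∈ codes s c s
    r∈codes = subst (λ k → r ∈ codes s c k) length-r (codes-complete s c r (≤-reflexive length-r) gap-free)
    row-match : ∀ u S → All (u Fin.<_) S → M u ≡ true → All (λ v → M v ≡ true) S → ∀ rest → matches rest x ≡ true →
      matches (map (literal (u , rank u)) (zip S (map rank S)) ++ rest) x ≡ true
    row-match u []      []          Mu []        rest h = h
    row-match u (v ∷ S) (u<v ∷ u<S) Mu (Mv ∷ MS) rest h = ∧-intro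
      (dec-true (lookup x (combine u v) Bool.≟ odd (rank u ⊓ rank v))
        (trans (sym (pairColour-< n x u<v)) (colours u v Mu Mv (Fin.<⇒≢ u<v))))
      (row-match u S u<S Mu MS rest h)
    all-match : ∀ S → AllPairs Fin._<_ S → All (λ v → M v ≡ true) S → matches (literals (zip S (map rank S))) x ≡ true
    all-match []      []           []        = refl
    all-match (u ∷ S) (u<S ∷ incr) (Mu ∷ MS) = row-match u S u<S Mu MS (literals (zip S (map rank S))) (all-match S incr MS)

  avoids⇒free : avoids (patterns s) x ≡ true → Free s full
  avoids⇒free h emb = uncurry-layers (layers emb)
    where
    clash : ∃[ p ] (p ∈ patterns s × matches p x ≡ true) → ⊥
    clash (p , p∈ , m) = contradiction (trans (sym m) (avoids-∈ {p = p} {x} p∈ h)) λ ()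
    uncurry-layers : (∃[ b ] ∀ c → odd c ≡ b → Layered s full c) → ⊥
    uncurry-layers (false , L) = clash (layered⇒pattern 0 ∈-++⁺ˡ (L 0 refl))
    uncurry-layers (true  , L) = clash (layered⇒pattern 1 (∈-++⁺ʳ (codes s 0 s)) (L 1 refl))

avoidable : ∀ n k m → triangle (2 + k) ≡ 2 + m →
  (♯codes (2 + k) (2 + k) + ♯codes (2 + k) (2 + k)) * ((2 + k) * (2 + k) * n ^ k) ≤ 2 ^ m * k ! → ¬ Unavoidable (2 + k) n
avoidable n k m m≡ bound unavoidable =
  let (x , h) = Patterns.avoiding-colouring n (2 + k) k m refl m≡ bound
  in avoids⇒free n (2 + k) x h (threshold⇒emb (graphOf n x) (unavoidable (graphOf n x)))

-- Counting ordered partitions by the exponential series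

ι : ℕ → ℚ
ι n = + n ℚ./ 1

toℚᵘ-/ : ∀ a c → ℚ.toℚᵘ (+ a ℚ./ suc c) ℚᵘ.≃ mkℚᵘ (+ a) c
toℚᵘ-/ a c = ℚ.toℚᵘ-fromℚᵘ (mkℚᵘ (+ a) c)

ι-+ : ∀ m n → ι (m ℕ.+ n) ≡ ι m ℚ.+ ι n
ι-+ m n = sym (/-add m n 0)

ι-* : ∀ m n → ι (m ℕ.* n) ≡ ι m ℚ.* ι n
ι-* m n = ℚ.toℚᵘ-injective (ℚᵘ.≃-trans (toℚᵘ-/ (m ℕ.* n) 0) (ℚᵘ.≃-sym
  (ℚᵘ.≃-trans (ℚ.toℚᵘ-homo-* (ι m) (ι n)) (ℚᵘ.≃-trans (ℚᵘ.*-cong (toℚᵘ-/ m 0) (toℚᵘ-/ n 0))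
    (ℚᵘ.*≡* (cong (ℤ._* + 1) (sym (ℤ.pos-* m n))))))))

ι-mono-≤ : ∀ {m n} → m ℕ.≤ n → ι m ℚ.≤ ι n
ι-mono-≤ {m} {n} h = /-mono-≤ m n 0 0 (ℕ.*-monoˡ-≤ 1 h)

ι-cancel-≤ : ∀ {m n} → ι m ℚ.≤ ι n → m ℕ.≤ n
ι-cancel-≤ {m} {n} h = ℤ.drop‿+≤+ (subst₂ ℤ._≤_ (ℤ.*-identityʳ (+ m)) (ℤ.*-identityʳ (+ n))
  (ℚᵘ.drop-*≤* (ℚᵘ.≤-respˡ-≃ (toℚᵘ-/ m 0) (ℚᵘ.≤-respʳ-≃ (toℚᵘ-/ n 0) (ℚ.toℚᵘ-mono-≤ {ι m} {ι n} h)))))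

1/suc-* : ∀ n → 1/suc n ℚ.* ι (suc n) ≡ 1ℚ
1/suc-* n = ℚ.toℚᵘ-injective (ℚᵘ.≃-trans (ℚ.toℚᵘ-homo-* (1/suc n) (ι (suc n)))
  (ℚᵘ.≃-trans (ℚᵘ.*-cong (toℚᵘ-/ 1 n) (toℚᵘ-/ (suc n) 0))
    (ℚᵘ.*≡* (trans (ℤ.*-identityʳ (+ 1 ℤ.* + suc n)) (cong (λ m → + 1 ℤ.* + m) (sym (ℕ.*-identityʳ (suc n))))))))

0≤ι : ∀ n → 0ℚ ℚ.≤ ι n
0≤ι n = ι-mono-≤ {0} {n} ℕ.z≤n

0<ι : ∀ n → 0ℚ ℚ.< ι (suc n)
0<ι n = ℚ.<-≤-trans (ℚ.positive⁻¹ 1ℚ) (ι-mono-≤ {1} {suc n} (ℕ.s≤s ℕ.z≤n))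

0≤1/suc : ∀ n → 0ℚ ℚ.≤ 1/suc n
0≤1/suc n = /-mono-≤ 0 1 0 n ℕ.z≤n

*-monoʳ : ∀ {p q} r → 0ℚ ℚ.≤ r → p ℚ.≤ q → r ℚ.* p ℚ.≤ r ℚ.* q
*-monoʳ r 0≤r = ℚ.*-monoˡ-≤-nonNeg r {{ℚ.nonNegative 0≤r}}

*-monoˡ : ∀ {p q} r → 0ℚ ℚ.≤ r → p ℚ.≤ q → p ℚ.* r ℚ.≤ q ℚ.* r
*-monoˡ r 0≤r = ℚ.*-monoʳ-≤-nonNeg r {{ℚ.nonNegative 0≤r}}

0≤* : ∀ {p q} → 0ℚ ℚ.≤ p → 0ℚ ℚ.≤ q → 0ℚ ℚ.≤ p ℚ.* q
0≤* {p} {q} 0≤p 0≤q = subst (ℚ._≤ p ℚ.* q) (ℚ.*-zeroʳ p) (*-monoʳ p 0≤p 0≤q)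

0≤+ : ∀ {p q} → 0ℚ ℚ.≤ p → 0ℚ ℚ.≤ q → 0ℚ ℚ.≤ p ℚ.+ q
0≤+ = ℚ.+-mono-≤

p≤p+q : ∀ {p q} → 0ℚ ℚ.≤ q → p ℚ.≤ p ℚ.+ q
p≤p+q {p} {q} 0≤q = subst (ℚ._≤ p ℚ.+ q) (ℚ.+-identityʳ p) (ℚ.+-monoʳ-≤ p 0≤q)

infixr 8 _↑_

_↑_ : ℚ → ℕ → ℚ
x ↑ zero  = 1ℚ
x ↑ suc n = x ↑ n ℚ.* x

0≤↑ : ∀ {x} n → 0ℚ ℚ.≤ x → 0ℚ ℚ.≤ x ↑ n
0≤↑ zero    _   = ℚ.nonNegative⁻¹ 1ℚ
0≤↑ (suc n) 0≤x = 0≤* (0≤↑ n 0≤x) 0≤x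

↑-+ : ∀ x m n → x ↑ (m ℕ.+ n) ≡ x ↑ m ℚ.* x ↑ n
↑-+ x zero    n = sym (ℚ.*-identityˡ (x ↑ n))
↑-+ x (suc m) n = trans (cong (ℚ._* x) (↑-+ x m n)) (eq (x ↑ m) (x ↑ n) x)
  where
  open +-*-Solver
  eq : ∀ a b x → a ℚ.* b ℚ.* x ≡ a ℚ.* x ℚ.* b
  eq = solve 3 (λ a b x → a :* b :* x := a :* x :* b) refl

-- expTerm x i = xⁱ/i! and expSum x j k = ∑_{i=j}^{j+k} xⁱ/i!.
expTerm : ℚ → ℕ → ℚ
expTerm x zero    = 1ℚ
expTerm x (suc i) = expTerm x i ℚ.* x ℚ.* 1/suc i

expSum : ℚ → ℕ → ℕ → ℚ
expSum x j zero    = expTerm x j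
expSum x j (suc k) = expTerm x j ℚ.+ expSum x (suc j) k

expTerm-! : ∀ x i → expTerm x i ℚ.* ι (i !) ≡ x ↑ i
expTerm-! x zero    = refl
expTerm-! x (suc i) = begin
  expTerm x i ℚ.* x ℚ.* 1/suc i ℚ.* ι (suc i ℕ.* i !)
    ≡⟨ cong (λ t → expTerm x i ℚ.* x ℚ.* 1/suc i ℚ.* t) (ι-* (suc i) (i !)) ⟩
  expTerm x i ℚ.* x ℚ.* 1/suc i ℚ.* (ι (suc i) ℚ.* ι (i !))
    ≡⟨ eq (expTerm x i) x (1/suc i) (ι (suc i)) (ι (i !)) ⟩
  expTerm x i ℚ.* ι (i !) ℚ.* x ℚ.* (1/suc i ℚ.* ι (suc i))
    ≡⟨ cong₂ (λ a b → a ℚ.* x ℚ.* b) (expTerm-! x i) (1/suc-* i) ⟩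
  x ↑ i ℚ.* x ℚ.* 1ℚ
    ≡⟨ ℚ.*-identityʳ (x ↑ suc i) ⟩
  x ↑ suc i ∎
  where
  open ≡-Reasoning
  open +-*-Solver
  eq : ∀ t x h p f → t ℚ.* x ℚ.* h ℚ.* (p ℚ.* f) ≡ t ℚ.* f ℚ.* x ℚ.* (h ℚ.* p)
  eq = solve 5 (λ t x h p f → t :* x :* h :* (p :* f) := t :* f :* x :* (h :* p)) refl

0≤expTerm : ∀ {x} i → 0ℚ ℚ.≤ x → 0ℚ ℚ.≤ expTerm x i
0≤expTerm zero    _   = ℚ.nonNegative⁻¹ 1ℚ
0≤expTerm (suc i) 0≤x = 0≤* (0≤* (0≤expTerm i 0≤x) 0≤x) (0≤1/suc i)

-- The mean value inequality for t^(i+1)/(i+1)!, whose derivative t^i/i! is largest at x + y; proved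
-- by induction on i.
expTerm-mean : ∀ x y i → 0ℚ ℚ.≤ x → 0ℚ ℚ.≤ y →
  expTerm (x ℚ.+ y) (suc i) ℚ.≤ expTerm x (suc i) ℚ.+ y ℚ.* expTerm (x ℚ.+ y) i
expTerm-mean x y zero    0≤x 0≤y = ℚ.≤-reflexive (eq x y 1ℚ)
  where
  open +-*-Solver
  eq : ∀ x y e → e ℚ.* (x ℚ.+ y) ℚ.* 1ℚ ≡ e ℚ.* x ℚ.* 1ℚ ℚ.+ y ℚ.* e
  eq = solve 3 (λ x y e → e :* (x :+ y) :* con 1ℚ := e :* x :* con 1ℚ :+ y :* e) refl
expTerm-mean x y (suc i) 0≤x 0≤y = begin
  z₁ ℚ.* (x ℚ.+ y) ℚ.* h
    ≡⟨ eq₁ z₁ x y h ⟩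
  z₁ ℚ.* x ℚ.* h ℚ.+ z₁ ℚ.* y ℚ.* h
    ≤⟨ ℚ.+-monoˡ-≤ (z₁ ℚ.* y ℚ.* h) (*-monoˡ h 0≤h (*-monoˡ x 0≤x (expTerm-mean x y i 0≤x 0≤y))) ⟩
  (x₁ ℚ.+ y ℚ.* z₀) ℚ.* x ℚ.* h ℚ.+ z₁ ℚ.* y ℚ.* h
    ≡⟨ eq₂ x₁ y z₀ x h z₁ ⟩
  x₁ ℚ.* x ℚ.* h ℚ.+ y ℚ.* h ℚ.* (z₀ ℚ.* x ℚ.+ z₁)
    ≤⟨ ℚ.+-monoʳ-≤ (x₁ ℚ.* x ℚ.* h) (*-monoʳ (y ℚ.* h) (0≤* 0≤y 0≤h) (ℚ.+-monoˡ-≤ z₁ (*-monoʳ z₀ (0≤expTerm i (0≤+ 0≤x 0≤y)) (p≤p+q 0≤y)))) ⟩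
  x₁ ℚ.* x ℚ.* h ℚ.+ y ℚ.* h ℚ.* (z₀ ℚ.* (x ℚ.+ y) ℚ.+ z₁)
    ≡⟨ cong (λ t → x₁ ℚ.* x ℚ.* h ℚ.+ y ℚ.* h ℚ.* (t ℚ.+ z₁)) z₀z ⟩
  x₁ ℚ.* x ℚ.* h ℚ.+ y ℚ.* h ℚ.* (ι (suc i) ℚ.* z₁ ℚ.+ z₁)
    ≡⟨ eq₃ (x₁ ℚ.* x ℚ.* h) y h (ι (suc i)) z₁ ⟩
  x₁ ℚ.* x ℚ.* h ℚ.+ y ℚ.* z₁ ℚ.* (h ℚ.* (1ℚ ℚ.+ ι (suc i)))
    ≡⟨ cong (λ t → x₁ ℚ.* x ℚ.* h ℚ.+ y ℚ.* z₁ ℚ.* (h ℚ.* t)) (ι-+ 1 (suc i)) ⟨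
  x₁ ℚ.* x ℚ.* h ℚ.+ y ℚ.* z₁ ℚ.* (h ℚ.* ι (suc (suc i)))
    ≡⟨ cong (λ t → x₁ ℚ.* x ℚ.* h ℚ.+ y ℚ.* z₁ ℚ.* t) (1/suc-* (suc i)) ⟩
  x₁ ℚ.* x ℚ.* h ℚ.+ y ℚ.* z₁ ℚ.* 1ℚ
    ≡⟨ cong (λ t → x₁ ℚ.* x ℚ.* h ℚ.+ t) (ℚ.*-identityʳ (y ℚ.* z₁)) ⟩
  x₁ ℚ.* x ℚ.* h ℚ.+ y ℚ.* z₁ ∎
  where
  open ℚ.≤-Reasoning
  open +-*-Solver
  z₀ z₁ x₁ h : ℚ
  z₀ = expTerm (x ℚ.+ y) i
  z₁ = expTerm (x ℚ.+ y) (suc i)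
  x₁ = expTerm x (suc i)
  h  = 1/suc (suc i)
  0≤h : 0ℚ ℚ.≤ h
  0≤h = 0≤1/suc (suc i)
  eq₁ : ∀ z x y h → z ℚ.* (x ℚ.+ y) ℚ.* h ≡ z ℚ.* x ℚ.* h ℚ.+ z ℚ.* y ℚ.* h
  eq₁ = solve 4 (λ z x y h → z :* (x :+ y) :* h := z :* x :* h :+ z :* y :* h) refl
  eq₂ : ∀ a y z x h w → (a ℚ.+ y ℚ.* z) ℚ.* x ℚ.* h ℚ.+ w ℚ.* y ℚ.* h ≡ a ℚ.* x ℚ.* h ℚ.+ y ℚ.* h ℚ.* (z ℚ.* x ℚ.+ w)
  eq₂ = solve 6 (λ a y z x h w → (a :+ y :* z) :* x :* h :+ w :* y :* h := a :* x :* h :+ y :* h :* (z :* x :+ w)) refl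
  eq₃ : ∀ a y h p z → a ℚ.+ y ℚ.* h ℚ.* (p ℚ.* z ℚ.+ z) ≡ a ℚ.+ y ℚ.* z ℚ.* (h ℚ.* (1ℚ ℚ.+ p))
  eq₃ = solve 5 (λ a y h p z → a :+ y :* h :* (p :* z :+ z) := a :+ y :* z :* (h :* (con 1ℚ :+ p))) refl
  eq₄ : ∀ z w g p → z ℚ.* w ℚ.* (g ℚ.* p) ≡ p ℚ.* (z ℚ.* w ℚ.* g)
  eq₄ = solve 4 (λ z w g p → z :* w :* (g :* p) := p :* (z :* w :* g)) refl
  z₀z : z₀ ℚ.* (x ℚ.+ y) ≡ ι (suc i) ℚ.* z₁
  z₀z = trans (sym (ℚ.*-identityʳ (z₀ ℚ.* (x ℚ.+ y)))) (trans (cong (z₀ ℚ.* (x ℚ.+ y) ℚ.*_) (sym (1/suc-* i)))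
    (eq₄ z₀ (x ℚ.+ y) (1/suc i) (ι (suc i))))

expSum-mean : ∀ x y j k → 0ℚ ℚ.≤ x → 0ℚ ℚ.≤ y →
  expSum (x ℚ.+ y) (suc j) k ℚ.≤ expSum x (suc j) k ℚ.+ y ℚ.* expSum (x ℚ.+ y) j k
expSum-mean x y j zero    0≤x 0≤y = expTerm-mean x y j 0≤x 0≤y
expSum-mean x y j (suc k) 0≤x 0≤y = subst (expSum (x ℚ.+ y) (suc j) (suc k) ℚ.≤_) (eq (expTerm x (suc j)) y (expTerm (x ℚ.+ y) j) (expSum x (suc (suc j)) k) (expSum (x ℚ.+ y) (suc j) k))
  (ℚ.+-mono-≤ (expTerm-mean x y j 0≤x 0≤y) (expSum-mean x y (suc j) k 0≤x 0≤y))
  where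
  open +-*-Solver
  eq : ∀ a y b c d → (a ℚ.+ y ℚ.* b) ℚ.+ (c ℚ.+ y ℚ.* d) ≡ (a ℚ.+ c) ℚ.+ y ℚ.* (b ℚ.+ d)
  eq = solve 5 (λ a y b c d → (a :+ y :* b) :+ (c :+ y :* d) := (a :+ c) :+ y :* (b :+ d)) refl

expSum-mono : ∀ {x} j k → 0ℚ ℚ.≤ x → expSum x j k ℚ.≤ expSum x j (suc k)
expSum-mono j zero    0≤x = p≤p+q (0≤expTerm (suc j) 0≤x)
expSum-mono {x} j (suc k) 0≤x = ℚ.+-monoʳ-≤ (expTerm x j) (expSum-mono (suc j) k 0≤x)

-- The truncated form of e^{x+y} (1 - y) ≤ e^x.
expSum-step : ∀ x y k → 0ℚ ℚ.≤ x → 0ℚ ℚ.≤ y →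
  expSum (x ℚ.+ y) 0 k ℚ.≤ expSum x 0 k ℚ.+ y ℚ.* expSum (x ℚ.+ y) 0 k
expSum-step x y zero    0≤x 0≤y = p≤p+q (0≤* 0≤y (ℚ.nonNegative⁻¹ 1ℚ))
expSum-step x y (suc k) 0≤x 0≤y = begin
  1ℚ ℚ.+ expSum z 1 k
    ≤⟨ ℚ.+-monoʳ-≤ 1ℚ (expSum-mean x y 0 k 0≤x 0≤y) ⟩
  1ℚ ℚ.+ (expSum x 1 k ℚ.+ y ℚ.* expSum z 0 k)
    ≡⟨ ℚ.+-assoc 1ℚ (expSum x 1 k) _ ⟨
  1ℚ ℚ.+ expSum x 1 k ℚ.+ y ℚ.* expSum z 0 k
    ≤⟨ ℚ.+-monoʳ-≤ (1ℚ ℚ.+ expSum x 1 k) (*-monoʳ y 0≤y (expSum-mono 0 k (0≤+ 0≤x 0≤y))) ⟩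
  1ℚ ℚ.+ expSum x 1 k ℚ.+ y ℚ.* expSum z 0 (suc k) ∎
  where
  open ℚ.≤-Reasoning
  z = x ℚ.+ y

expSum-0 : ∀ k → expSum 0ℚ 0 k ≡ 1ℚ
expSum-0 zero    = refl
expSum-0 (suc k) = cong (1ℚ ℚ.+_) (tail 0 k)
  where
  term : ∀ i → expTerm 0ℚ (suc i) ≡ 0ℚ
  term i = trans (cong (ℚ._* 1/suc i) (ℚ.*-zeroʳ (expTerm 0ℚ i))) (ℚ.*-zeroˡ (1/suc i))
  tail : ∀ j k → expSum 0ℚ (suc j) k ≡ 0ℚ
  tail j zero    = term j
  tail j (suc k) = cong₂ ℚ._+_ (term j) (tail (suc j) k)

harmonic : ℕ → ℕ → ℚ
harmonic n i = + 1 ℚ./ (suc n ℕ.+ suc i)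

0≤∑harmonic : ∀ n i → 0ℚ ℚ.≤ ∑ i (harmonic n)
0≤∑harmonic n zero    = ℚ.≤-refl
0≤∑harmonic n (suc i) = 0≤+ (0≤∑harmonic n i) (0≤1/suc (n ℕ.+ suc i))

-- e^{1/m} ≤ m/(m - 1), and the product telescopes.
expSum-harmonic : ∀ n k i → ι (suc n) ℚ.* expSum (∑ i (harmonic n)) 0 k ℚ.≤ ι (suc n ℕ.+ i)
expSum-harmonic n k zero = ℚ.≤-reflexive (trans (cong (ι (suc n) ℚ.*_) (expSum-0 k))
  (trans (ℚ.*-identityʳ (ι (suc n))) (cong ι (sym (ℕ.+-identityʳ (suc n))))))
expSum-harmonic n k (suc i) = ℚ.*-cancelˡ-≤-pos q {{ℚ.positive (0<ι (n ℕ.+ i))}} (begin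
  q ℚ.* (ι (suc n) ℚ.* Z)
    ≡⟨ swap q (ι (suc n)) Z ⟩
  ι (suc n) ℚ.* (q ℚ.* Z)
    ≤⟨ *-monoʳ (ι (suc n)) (0≤ι (suc n)) qZ≤pX ⟩
  ι (suc n) ℚ.* (p ℚ.* X)
    ≡⟨ swap (ι (suc n)) p X ⟩
  p ℚ.* (ι (suc n) ℚ.* X)
    ≤⟨ *-monoʳ p (0≤ι (suc n ℕ.+ suc i)) (expSum-harmonic n k i) ⟩
  p ℚ.* q
    ≡⟨ ℚ.*-comm p q ⟩
  q ℚ.* p ∎)
  where
  open ℚ.≤-Reasoning
  open +-*-Solver
  x y p q X Z : ℚ
  x = ∑ i (harmonic n)
  y = harmonic n i
  p = ι (suc n ℕ.+ suc i)
  q = ι (suc n ℕ.+ i)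
  X = expSum x 0 k
  Z = expSum (x ℚ.+ y) 0 k
  swap : ∀ a b c → a ℚ.* (b ℚ.* c) ≡ b ℚ.* (a ℚ.* c)
  swap = solve 3 (λ a b c → a :* (b :* c) := b :* (a :* c)) refl
  p≡1+q : p ≡ 1ℚ ℚ.+ q
  p≡1+q = trans (cong ι (ℕ.+-suc (suc n) i)) (ι-+ 1 (suc n ℕ.+ i))
  distrib : ∀ p X y Z → p ℚ.* (X ℚ.+ y ℚ.* Z) ≡ p ℚ.* X ℚ.+ (y ℚ.* p) ℚ.* Z
  distrib = solve 4 (λ p X y Z → p :* (X :+ y :* Z) := p :* X :+ (y :* p) :* Z) refl
  lhs : ∀ q Z → Z ℚ.+ q ℚ.* Z ≡ (1ℚ ℚ.+ q) ℚ.* Z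
  lhs = solve 2 (λ q Z → Z :+ q :* Z := (con 1ℚ :+ q) :* Z) refl
  rhs : ∀ a Z → a ℚ.+ 1ℚ ℚ.* Z ≡ Z ℚ.+ a
  rhs = solve 2 (λ a Z → a :+ con 1ℚ :* Z := Z :+ a) refl
  qZ≤pX : q ℚ.* Z ℚ.≤ p ℚ.* X
  qZ≤pX = +-cancelˡ-≤ Z (q ℚ.* Z) (p ℚ.* X) (begin
    Z ℚ.+ q ℚ.* Z                    ≡⟨ lhs q Z ⟩
    (1ℚ ℚ.+ q) ℚ.* Z                 ≡⟨ cong (ℚ._* Z) p≡1+q ⟨
    p ℚ.* Z                          ≤⟨ *-monoʳ p (0≤ι (suc n ℕ.+ suc i)) (expSum-step x y k (0≤∑harmonic n i) (0≤1/suc (n ℕ.+ suc i))) ⟩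
    p ℚ.* (X ℚ.+ y ℚ.* Z)            ≡⟨ distrib p X y Z ⟩
    p ℚ.* X ℚ.+ (y ℚ.* p) ℚ.* Z      ≡⟨ cong (λ t → p ℚ.* X ℚ.+ t ℚ.* Z) (1/suc-* (n ℕ.+ suc i)) ⟩
    p ℚ.* X ℚ.+ 1ℚ ℚ.* Z             ≡⟨ rhs (p ℚ.* X) Z ⟩
    Z ℚ.+ p ℚ.* X                    ∎)

0≤ln2Approx : ∀ n → 0ℚ ℚ.≤ ln2Approx n
0≤ln2Approx n = 0≤∑harmonic n (suc n)

-- After all N = n + 1 summands the telescoping product is 2N/N = 2, so the exponential series
-- without its first term is at most 1.
expSum-ln2 : ∀ n k → expSum (ln2Approx n) 1 k ℚ.≤ 1ℚ
expSum-ln2 n k = +-cancelˡ-≤ 1ℚ (expSum (ln2Approx n) 1 k) 1ℚ (ℚ.*-cancelˡ-≤-pos (ι (suc n)) {{ℚ.positive (0<ι n)}}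
  (subst (ι (suc n) ℚ.* expSum (ln2Approx n) 0 (suc k) ℚ.≤_) double (expSum-harmonic n (suc k) (suc n))))
  where
  open +-*-Solver
  eq : ∀ a → a ℚ.+ a ≡ a ℚ.* (1ℚ ℚ.+ 1ℚ)
  eq = solve 1 (λ a → a :+ a := a :* (con 1ℚ :+ con 1ℚ)) refl
  double : ι (suc n ℕ.+ suc n) ≡ ι (suc n) ℚ.* (1ℚ ℚ.+ 1ℚ)
  double = trans (ι-+ (suc n) (suc n)) (eq (ι (suc n)))

module _ (L : ℚ) (0≤L : 0ℚ ℚ.≤ L) (expSum≤1 : ∀ k → expSum L 1 k ℚ.≤ 1ℚ) where

  mutual
    -- Divided by k!, the recurrence over the first block becomes a convolution with 1/j!. By
    -- induction the factor gained is the sum of L^j/j! over j ≥ 1, at most 1 by hypothesis.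
    ♯codes-bound : ∀ f k → ι (♯codes f k) ℚ.* L ↑ k ℚ.≤ ι (k !)
    ♯codes-bound f       zero    = ℚ.≤-refl
    ♯codes-bound zero    (suc k) = ℚ.≤-trans (ℚ.≤-reflexive (ℚ.*-zeroˡ (L ↑ suc k))) (0≤ι (suc k !))
    ♯codes-bound (suc f) (suc k) = ℚ.≤-trans (♯blocks-bound f 1 k)
      (ℚ.≤-trans (*-monoʳ (ι (suc k !)) (0≤ι (suc k !)) (expSum≤1 k)) (ℚ.≤-reflexive (ℚ.*-identityʳ (ι (suc k !)))))

    ♯blocks-bound : ∀ f j k → ι (♯blocks f j k) ℚ.* L ↑ (j ℕ.+ k) ℚ.≤ ι ((j ℕ.+ k) !) ℚ.* expSum L j k
    ♯blocks-bound f j zero    = ♯block-bound f j zero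
    ♯blocks-bound f j (suc k) = begin
      ι (binomial j (suc k) ℕ.* ♯codes f (suc k) ℕ.+ ♯blocks f (suc j) k) ℚ.* P
        ≡⟨ trans (cong (ℚ._* P) (ι-+ (binomial j (suc k) ℕ.* ♯codes f (suc k)) (♯blocks f (suc j) k)))
             (ℚ.*-distribʳ-+ P (ι (binomial j (suc k) ℕ.* ♯codes f (suc k))) (ι (♯blocks f (suc j) k))) ⟩
      ι (binomial j (suc k) ℕ.* ♯codes f (suc k)) ℚ.* P ℚ.+ ι (♯blocks f (suc j) k) ℚ.* P
        ≤⟨ ℚ.+-mono-≤ (♯block-bound f j (suc k)) (subst (λ m → ι (♯blocks f (suc j) k) ℚ.* L ↑ m ℚ.≤ ι (m !) ℚ.* expSum L (suc j) k)
             (sym (ℕ.+-suc j k)) (♯blocks-bound f (suc j) k)) ⟩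
      F ℚ.* expTerm L j ℚ.+ F ℚ.* expSum L (suc j) k
        ≡⟨ ℚ.*-distribˡ-+ F (expTerm L j) (expSum L (suc j) k) ⟨
      F ℚ.* expSum L j (suc k) ∎
      where
      open ℚ.≤-Reasoning
      P F : ℚ
      P = L ↑ (j ℕ.+ suc k)
      F = ι ((j ℕ.+ suc k) !)

    ♯block-bound : ∀ f j k → ι (binomial j k ℕ.* ♯codes f k) ℚ.* L ↑ (j ℕ.+ k) ℚ.≤ ι ((j ℕ.+ k) !) ℚ.* expTerm L j
    ♯block-bound f j k = begin
      ι (binomial j k ℕ.* ♯codes f k) ℚ.* L ↑ (j ℕ.+ k)
        ≡⟨ cong₂ ℚ._*_ (ι-* (binomial j k) (♯codes f k)) (↑-+ L j k) ⟩
      ι (binomial j k) ℚ.* ι (♯codes f k) ℚ.* (L ↑ j ℚ.* L ↑ k)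
        ≡⟨ eq₁ (ι (binomial j k)) (ι (♯codes f k)) (L ↑ j) (L ↑ k) ⟩
      ι (binomial j k) ℚ.* L ↑ j ℚ.* (ι (♯codes f k) ℚ.* L ↑ k)
        ≤⟨ *-monoʳ (ι (binomial j k) ℚ.* L ↑ j) (0≤* (0≤ι (binomial j k)) (0≤↑ j 0≤L)) (♯codes-bound f k) ⟩
      ι (binomial j k) ℚ.* L ↑ j ℚ.* ι (k !)
        ≡⟨ cong (λ t → ι (binomial j k) ℚ.* t ℚ.* ι (k !)) (expTerm-! L j) ⟨
      ι (binomial j k) ℚ.* (expTerm L j ℚ.* ι (j !)) ℚ.* ι (k !)
        ≡⟨ eq₂ (ι (binomial j k)) (expTerm L j) (ι (j !)) (ι (k !)) ⟩
      ι (binomial j k) ℚ.* (ι (j !) ℚ.* ι (k !)) ℚ.* expTerm L j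
        ≡⟨ cong (ℚ._* expTerm L j) (trans (ι-* (binomial j k) (j ! ℕ.* k !)) (cong (ι (binomial j k) ℚ.*_) (ι-* (j !) (k !)))) ⟨
      ι (binomial j k ℕ.* (j ! ℕ.* k !)) ℚ.* expTerm L j
        ≡⟨ cong (λ m → ι m ℚ.* expTerm L j) (binomial-! j k) ⟩
      ι ((j ℕ.+ k) !) ℚ.* expTerm L j ∎
      where
      open ℚ.≤-Reasoning
      open +-*-Solver
      eq₁ : ∀ a b c d → a ℚ.* b ℚ.* (c ℚ.* d) ≡ a ℚ.* c ℚ.* (b ℚ.* d)
      eq₁ = solve 4 (λ a b c d → a :* b :* (c :* d) := a :* c :* (b :* d)) refl
      eq₂ : ∀ a t j k → a ℚ.* (t ℚ.* j) ℚ.* k ≡ a ℚ.* (j ℚ.* k) ℚ.* t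
      eq₂ = solve 4 (λ a t j k → a :* (t :* j) :* k := a :* (j :* k) :* t) refl

-- Bounding r'₂ from below

fourth : ℕ → ℕ
fourth s = s * s * (s * s)

fourth-mono : ∀ {s t} → s ≤ t → fourth s ≤ fourth t
fourth-mono h = *-mono-≤ (*-mono-≤ h h) (*-mono-≤ h h)

bernoulli-^ : ∀ j t → j ^ t * (j + t) ≤ j * suc j ^ t
bernoulli-^ j zero    = ≤-reflexive (eq j)
  where
  eq : ∀ j → 1 * (j + 0) ≡ j * 1
  eq = solve-∀
bernoulli-^ j (suc t) = begin
  j * j ^ t * (j + suc t)         ≤⟨ m≤m+n _ (j ^ t * t) ⟩
  j * j ^ t * (j + suc t) + j ^ t * t
                                  ≡⟨ eq₁ j (j ^ t) t ⟩
  suc j * (j ^ t * (j + t))       ≤⟨ *-monoʳ-≤ (suc j) (bernoulli-^ j t) ⟩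
  suc j * (j * suc j ^ t)         ≡⟨ eq₂ (suc j) j (suc j ^ t) ⟩
  j * (suc j * suc j ^ t)         ∎
  where
  open ≤-Reasoning
  eq₁ : ∀ j p t → j * p * (j + suc t) + p * t ≡ suc j * (p * (j + t))
  eq₁ = solve-∀
  eq₂ : ∀ a b c → a * (b * c) ≡ b * (a * c)
  eq₂ = solve-∀

^-distribˡ-* : ∀ m n k → (m * n) ^ k ≡ m ^ k * n ^ k
^-distribˡ-* m n zero    = refl
^-distribˡ-* m n (suc k) = trans (cong (m * n *_) (^-distribˡ-* m n k)) (eq m n (m ^ k) (n ^ k))
  where
  eq : ∀ a b c d → a * b * (c * d) ≡ a * c * (b * d)
  eq = solve-∀

-- With k = 5t + o, the fifth power of Bernoulli's inequality beats the quartic factor.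
growth : ∀ j .{{_ : NonZero j}} w x t o → w * fourth x * j ^ 5 < t →
  w * fourth (x * t) * j ^ (t * 5 + o) < suc j ^ (t * 5 + o)
growth j w x t o big = *-cancelˡ-< (j ^ 5) _ _ (begin-strict
  j ^ 5 * (w * fourth (x * t) * j ^ (t * 5 + o))
    ≡⟨ eq₁ (j ^ 5) w x t (j ^ (t * 5 + o)) ⟩
  fourth t * (w * fourth x * j ^ 5) * j ^ (t * 5 + o)
    <⟨ *-monoˡ-< (j ^ (t * 5 + o)) {{m^n≢0 j (t * 5 + o)}} (*-monoʳ-< (fourth t) {{fourth≢0}} big) ⟩
  fourth t * t * j ^ (t * 5 + o)
    ≤⟨ *-monoˡ-≤ (j ^ (t * 5 + o)) (≤-trans (≤-reflexive (eq₂ t)) (^-monoˡ-≤ 5 (m≤n+m t j))) ⟩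
  (j + t) ^ 5 * j ^ (t * 5 + o)
    ≡⟨ cong ((j + t) ^ 5 *_) (^-distribˡ-+-* j (t * 5) o) ⟩
  (j + t) ^ 5 * (j ^ (t * 5) * j ^ o)
    ≡⟨ cong (λ p → (j + t) ^ 5 * (p * j ^ o)) (^-*-assoc j t 5) ⟨
  (j + t) ^ 5 * ((j ^ t) ^ 5 * j ^ o)
    ≡⟨ eq₃ ((j + t) ^ 5) ((j ^ t) ^ 5) (j ^ o) ⟩
  (j ^ t) ^ 5 * (j + t) ^ 5 * j ^ o
    ≡⟨ cong (_* j ^ o) (^-distribˡ-* (j ^ t) (j + t) 5) ⟨
  (j ^ t * (j + t)) ^ 5 * j ^ o
    ≤⟨ *-mono-≤ (^-monoˡ-≤ 5 (bernoulli-^ j t)) (^-monoˡ-≤ o (n≤1+n j)) ⟩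
  (j * suc j ^ t) ^ 5 * suc j ^ o
    ≡⟨ cong (_* suc j ^ o) (^-distribˡ-* j (suc j ^ t) 5) ⟩
  j ^ 5 * (suc j ^ t) ^ 5 * suc j ^ o
    ≡⟨ *-assoc (j ^ 5) ((suc j ^ t) ^ 5) (suc j ^ o) ⟩
  j ^ 5 * ((suc j ^ t) ^ 5 * suc j ^ o)
    ≡⟨ cong (λ p → j ^ 5 * (p * suc j ^ o)) (^-*-assoc (suc j) t 5) ⟩
  j ^ 5 * (suc j ^ (t * 5) * suc j ^ o)
    ≡⟨ cong (j ^ 5 *_) (^-distribˡ-+-* (suc j) (t * 5) o) ⟨
  j ^ 5 * suc j ^ (t * 5 + o) ∎)
  where
  open ≤-Reasoning
  t≢0 : NonZero t
  t≢0 = >-nonZero (≤-<-trans z≤n big)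
  fourth≢0 : NonZero (fourth t)
  fourth≢0 = m*n≢0 (t * t) (t * t) {{m*n≢0 t t {{t≢0}} {{t≢0}}}} {{m*n≢0 t t {{t≢0}} {{t≢0}}}}
  eq₁ : ∀ p w x t q → p * (w * (x * t * (x * t) * (x * t * (x * t))) * q) ≡ t * t * (t * t) * (w * (x * x * (x * x)) * p) * q
  eq₁ = solve-∀
  eq₂ : ∀ t → t * t * (t * t) * t ≡ t * (t * (t * (t * (t * 1))))
  eq₂ = solve-∀
  eq₃ : ∀ a b c → a * (b * c) ≡ b * a * c
  eq₃ = solve-∀

eventually : ∀ w j .{{_ : NonZero j}} → ∃[ K ] ∀ k → K ≤ k → w * fourth (2 + k) * j ^ k < suc j ^ k
eventually w j = bound , λ k K≤k → subst (λ m → w * fourth (2 + m) * j ^ m < suc j ^ m) (sym (division k)) (large k K≤k)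
  where
  -- With t = k / 5, the inequality 2 + k ≤ 5t + 6 ≤ 11t gives the 11; t ≥ 1 follows from c < t, the
  -- hypothesis of `growth`.
  c bound : ℕ
  c = w * fourth 11 * j ^ 5
  bound = suc c * 5
  division : ∀ k → k ≡ k / 5 * 5 + k % 5
  division k = trans (m≡m%n+[m/n]*n k 5) (+-comm (k % 5) (k / 5 * 5))
  large : ∀ k → bound ≤ k → w * fourth (2 + (k / 5 * 5 + k % 5)) * j ^ (k / 5 * 5 + k % 5) < suc j ^ (k / 5 * 5 + k % 5)
  large k K≤k = ≤-<-trans (*-monoˡ-≤ (j ^ (k / 5 * 5 + k % 5)) (*-monoʳ-≤ w (fourth-mono s≤11t))) (growth j w 11 (k / 5) (k % 5) c<t)
    where
    open ≤-Reasoning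
    c<t : c < k / 5
    c<t = *-cancelʳ-< 5 c (k / 5) (+-cancelˡ-< 5 _ _ (begin-strict
      5 + c * 5               ≤⟨ K≤k ⟩
      k                       ≡⟨ division k ⟩
      k / 5 * 5 + k % 5       <⟨ +-monoʳ-< (k / 5 * 5) (m%n<n k 5) ⟩
      k / 5 * 5 + 5           ≡⟨ +-comm (k / 5 * 5) 5 ⟩
      5 + k / 5 * 5           ∎))
    s≤11t : 2 + (k / 5 * 5 + k % 5) ≤ 11 * (k / 5)
    s≤11t = begin
      2 + (k / 5 * 5 + k % 5)       ≤⟨ +-monoʳ-≤ 2 (+-monoʳ-≤ (k / 5 * 5) (<⇒≤pred (m%n<n k 5))) ⟩
      2 + (k / 5 * 5 + 4)           ≡⟨ eq₁ (k / 5) ⟩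
      k / 5 * 5 + 6 * 1             ≤⟨ +-monoʳ-≤ (k / 5 * 5) (*-monoʳ-≤ 6 (≤-trans (s≤s z≤n) c<t)) ⟩
      k / 5 * 5 + 6 * (k / 5)       ≡⟨ eq₂ (k / 5) ⟩
      11 * (k / 5)                  ∎
      where
      eq₁ : ∀ t → 2 + (t * 5 + 4) ≡ t * 5 + 6 * 1
      eq₁ = solve-∀
      eq₂ : ∀ t → t * 5 + 6 * t ≡ 11 * t
      eq₂ = solve-∀

triangle-double : ∀ s → triangle s + triangle s + s ≡ s * s
triangle-double zero    = refl
triangle-double (suc s) = trans (eq₁ s (triangle s)) (trans (cong (λ p → p + s + s + 1) (triangle-double s)) (eq₂ s))
  where
  eq₁ : ∀ s t → (s + t) + (s + t) + suc s ≡ (t + t + s) + s + s + 1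
  eq₁ = solve-∀
  eq₂ : ∀ s → s * s + s + s + 1 ≡ suc s * suc s
  eq₂ = solve-∀

-- For s = k + 2 this is (s + 1)(s - 2) = s(s - 1) - 2. It makes 4·(2^m)² an exact k-th power of
-- 2^(s+1), the source of √2·2^(s/2).
triangle-exponent : ∀ k m → triangle (2 + k) ≡ 2 + m → (k + 3) * k ≡ 2 + (m + m)
triangle-exponent k m e = +-cancelʳ-≡ (4 + k) _ _ (begin
  (k + 3) * k + (4 + k)                           ≡⟨ eq₁ k ⟩
  (2 + k) * (2 + k)                               ≡⟨ triangle-double (2 + k) ⟨
  triangle (2 + k) + triangle (2 + k) + (2 + k)   ≡⟨ cong (λ t → t + t + (2 + k)) e ⟩
  (2 + m) + (2 + m) + (2 + k)                     ≡⟨ eq₂ m k ⟩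
  2 + (m + m) + (4 + k)                           ∎)
  where
  open ≡-Reasoning
  eq₁ : ∀ k → (k + 3) * k + (4 + k) ≡ (2 + k) * (2 + k)
  eq₁ = solve-∀
  eq₂ : ∀ m k → (2 + m) + (2 + m) + (2 + k) ≡ 2 + (m + m) + (4 + k)
  eq₂ = solve-∀

-- `F` stands for the number of ordered partitions and a/b for ln 2. The outcome is r >
-- 2^((s+1)/2)·(a/b)·j/(j + 1), squared and cleared of denominators.
module Estimate (F k m r a b j : ℕ) .{{_ : NonZero a}} .{{_ : NonZero b}}
  (triangle≡ : triangle (2 + k) ≡ 2 + m)
  (many : 2 ^ m * k ! ≤ (F + F) * ((2 + k) * (2 + k) * r ^ k))
  (few : F * a ^ (2 + k) ≤ (2 + k) ! * b ^ (2 + k))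
  (b≤2a : b ≤ 2 * a)
  (large : 16 * fourth (2 + k) * j ^ k < suc j ^ k) where

  s = 2 + k
  α = a ^ k
  β = b ^ k
  γ = j ^ k
  q = suc j ^ k
  ρ = r ^ k
  P = 2 ^ m

  instance
    α≢0 : NonZero α
    α≢0 = m^n≢0 a k
    β≢0 : NonZero β
    β≢0 = m^n≢0 b k
    P≢0 : NonZero P
    P≢0 = m^n≢0 2 m

  -- `F` is eliminated between `many` and `few`. Two factors s come from the choice of a shared
  -- pair, two more from s!/k! ≤ s².
  first : P * (a * a * α) ≤ 2 * fourth s * (b * b * β) * ρ
  first = *-cancelʳ-≤ _ _ (k !) {{k !≢0}} (begin
    P * (a * a * α) * k !
      ≡⟨ eq₁ P a α (k !) ⟩
    (P * k !) * (a * (a * α))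
      ≤⟨ *-monoˡ-≤ (a * (a * α)) many ⟩
    (F + F) * (s * s * ρ) * (a * (a * α))
      ≡⟨ eq₂ F s ρ (a * (a * α)) ⟩
    2 * (F * (a * (a * α))) * (s * s) * ρ
      ≤⟨ *-monoˡ-≤ ρ (*-monoˡ-≤ (s * s) (*-monoʳ-≤ 2 few)) ⟩
    2 * (s ! * (b * (b * β))) * (s * s) * ρ
      ≤⟨ *-monoˡ-≤ ρ (*-monoˡ-≤ (s * s) (*-monoʳ-≤ 2 (*-monoˡ-≤ (b * (b * β)) (*-monoʳ-≤ s (*-monoˡ-≤ (k !) (n≤1+n (suc k))))))) ⟩
    2 * (s * (s * k !) * (b * (b * β))) * (s * s) * ρ
      ≡⟨ eq₃ s (k !) b β ρ ⟩
    2 * fourth s * (b * b * β) * ρ * k ! ∎)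
    where
    open ≤-Reasoning
    eq₁ : ∀ P a α f → P * (a * a * α) * f ≡ (P * f) * (a * (a * α))
    eq₁ = solve-∀
    eq₂ : ∀ F s ρ a → (F + F) * (s * s * ρ) * a ≡ 2 * (F * a) * (s * s) * ρ
    eq₂ = solve-∀
    eq₃ : ∀ s f b β ρ → 2 * (s * (s * f) * (b * (b * β))) * (s * s) * ρ ≡ 2 * (s * s * (s * s)) * (b * b * β) * ρ * f
    eq₃ = solve-∀

  exponent : (2 ^ (k + 3)) ^ k ≡ 4 * (P * P)
  exponent = trans (^-*-assoc 2 (k + 3) k) (trans (cong (2 ^_) (triangle-exponent k m triangle≡))
    (trans (cong (λ p → 2 * (2 * p)) (^-distribˡ-+-* 2 m m)) (sym (*-assoc 2 2 (P * P)))))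

  square-^ : ∀ x → (x * x) ^ k ≡ x ^ k * x ^ k
  square-^ x = ^-distribˡ-* x x k

  -- The k-th power of the assumed inequality against the square of first.
  absurd : suc j * b * r * (suc j * b * r) ≤ 2 ^ (k + 3) * (j * a * (j * a)) → ¬ (16 * fourth s * γ < q)
  absurd h lt = <⇒≱ (*-mono-< lt lt) (*-cancelʳ-≤ (q * q) _ (fourth a) {{fourth≢0}} (*-cancelˡ-≤ (4 * (P * P) * (α * α)) {{left≢0}} (begin
    4 * (P * P) * (α * α) * (q * q * fourth a)
      ≡⟨ eq₁ P α q a ⟩
    4 * (q * q) * (P * (a * a * α) * (P * (a * a * α)))
      ≤⟨ *-monoʳ-≤ (4 * (q * q)) (*-mono-≤ first first) ⟩
    4 * (q * q) * (2 * fourth s * (b * b * β) * ρ * (2 * fourth s * (b * b * β) * ρ))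
      ≡⟨ eq₂ q (fourth s) b β ρ ⟩
    16 * (fourth s * fourth s) * fourth b * (q * β * ρ * (q * β * ρ))
      ≤⟨ *-monoʳ-≤ (16 * (fourth s * fourth s) * fourth b) powers ⟩
    16 * (fourth s * fourth s) * fourth b * (4 * (P * P) * (γ * α * (γ * α)))
      -- Only k of the s factors enter the k-th power; the fourth power of b left over is at most 16
      -- times that of a.
      ≤⟨ *-monoˡ-≤ _ (*-monoʳ-≤ (16 * (fourth s * fourth s)) (fourth-mono b≤2a)) ⟩
    16 * (fourth s * fourth s) * fourth (2 * a) * (4 * (P * P) * (γ * α * (γ * α)))
      ≡⟨ eq₃ (fourth s) a P γ α ⟩
    4 * (P * P) * (α * α) * (16 * fourth s * γ * (16 * fourth s * γ) * fourth a) ∎)))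
    where
    open ≤-Reasoning
    fourth≢0 : NonZero (fourth a)
    fourth≢0 = m*n≢0 (a * a) (a * a) {{m*n≢0 a a}} {{m*n≢0 a a}}
    left≢0 : NonZero (4 * (P * P) * (α * α))
    left≢0 = m*n≢0 (4 * (P * P)) (α * α) {{m*n≢0 4 (P * P) {{_}} {{m*n≢0 P P}}}} {{m*n≢0 α α}}
    powers : q * β * ρ * (q * β * ρ) ≤ 4 * (P * P) * (γ * α * (γ * α))
    powers = subst₂ _≤_
      (trans (square-^ (suc j * b * r)) (cong (λ p → p * p) (trans (^-distribˡ-* (suc j * b) r k) (cong (_* ρ) (^-distribˡ-* (suc j) b k)))))
      (trans (^-distribˡ-* (2 ^ (k + 3)) (j * a * (j * a)) k) (cong₂ _*_ exponent
        (trans (square-^ (j * a)) (cong (λ p → p * p) (^-distribˡ-* j a k)))))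
      (^-monoˡ-≤ k h)
    eq₁ : ∀ P α q a → 4 * (P * P) * (α * α) * (q * q * (a * a * (a * a))) ≡ 4 * (q * q) * (P * (a * a * α) * (P * (a * a * α)))
    eq₁ = solve-∀
    eq₂ : ∀ q f b β ρ → 4 * (q * q) * (2 * f * (b * b * β) * ρ * (2 * f * (b * b * β) * ρ)) ≡
      16 * (f * f) * (b * b * (b * b)) * (q * β * ρ * (q * β * ρ))
    eq₂ = solve-∀
    eq₃ : ∀ f a P γ α → 16 * (f * f) * (2 * a * (2 * a) * (2 * a * (2 * a))) * (4 * (P * P) * (γ * α * (γ * α))) ≡
      4 * (P * P) * (α * α) * (16 * f * γ * (16 * f * γ) * (a * a * (a * a)))
    eq₃ = solve-∀

  estimate : 2 ^ (k + 3) * (j * a * (j * a)) < suc j * b * r * (suc j * b * r)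
  estimate = ≰⇒> (λ h → absurd h large)

-- Passage to the real numbers

/-* : ∀ p n → (+ p ℚ./ suc n) ℚ.* ι (suc n) ≡ ι p
/-* p n = ℚ.toℚᵘ-injective (ℚᵘ.≃-trans (ℚ.toℚᵘ-homo-* (+ p ℚ./ suc n) (ι (suc n)))
  (ℚᵘ.≃-trans (ℚᵘ.*-cong (toℚᵘ-/ p n) (toℚᵘ-/ (suc n) 0))
    (ℚᵘ.≃-trans (ℚᵘ.*≡* (trans (ℤ.*-identityʳ (+ p ℤ.* + suc n)) (cong (λ m → + p ℤ.* + m) (sym (ℕ.*-identityʳ (suc n))))))
      (ℚᵘ.≃-sym (toℚᵘ-/ p 0)))))

fraction : ∀ q → 0ℚ ℚ.≤ q → ∃[ a ] ∃[ b ] q ℚ.* ι (suc b) ≡ ι a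
fraction (ℚ.mkℚ (+ a) b c) _ = a , b , ℚ.toℚᵘ-injective (ℚᵘ.≃-trans (ℚ.toℚᵘ-homo-* (ℚ.mkℚ (+ a) b c) (ι (suc b)))
  (ℚᵘ.≃-trans (ℚᵘ.*-cong (ℚᵘ.≃-refl {mkℚᵘ (+ a) b}) (toℚᵘ-/ (suc b) 0))
    (ℚᵘ.≃-trans (ℚᵘ.*≡* (trans (ℤ.*-identityʳ (+ a ℤ.* + suc b)) (cong (λ m → + a ℤ.* + m) (sym (ℕ.*-identityʳ (suc b))))))
      (ℚᵘ.≃-sym (toℚᵘ-/ a 0)))))
fraction (ℚ.mkℚ -[1+ _ ] _ _) (ℚ.*≤* ())

½≤ln2Approx : ∀ n → ½ ℚ.≤ ln2Approx n
½≤ln2Approx zero    = ℚ.≤-refl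
½≤ln2Approx (suc n) = ℚ.≤-trans (½≤ln2Approx n) (ln2-increasing n)

ln2Approx≤2 : ∀ n → ln2Approx n ℚ.≤ ι 2
ln2Approx≤2 n = ℚ.≤-trans (ln2Approx-rate n 0) (toWitness {a? = (ln2Approx 0 ℚ.+ 1/suc 0) ℚ.≤? ι 2} tt)

ι-^ : ∀ a k → ι (a ^ k) ≡ ι a ↑ k
ι-^ a zero    = refl
ι-^ a (suc k) = trans (ι-* a (a ^ k)) (trans (cong (ι a ℚ.*_) (ι-^ a k)) (ℚ.*-comm (ι a) (ι a ↑ k)))

↑-* : ∀ x y k → (x ℚ.* y) ↑ k ≡ x ↑ k ℚ.* y ↑ k
↑-* x y zero    = refl
↑-* x y (suc k) = trans (cong (ℚ._* (x ℚ.* y)) (↑-* x y k)) (eq (x ↑ k) (y ↑ k) x y)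
  where
  open +-*-Solver
  eq : ∀ a b x y → a ℚ.* b ℚ.* (x ℚ.* y) ≡ a ℚ.* x ℚ.* (b ℚ.* y)
  eq = solve 4 (λ a b x y → a :* b :* (x :* y) := a :* x :* (b :* y)) refl

sqrtApprox-* : ∀ x n → sqrtApprox x n ℚ.* ι (suc n) ≡ ι (isqrt (x ℕ.* (suc n ℕ.* suc n)))
sqrtApprox-* x n = /-* (isqrt (x ℕ.* (suc n ℕ.* suc n))) n

0≤sqrtApprox : ∀ x n → 0ℚ ℚ.≤ sqrtApprox x n
0≤sqrtApprox x n = /-mono-≤ 0 (isqrt (x ℕ.* (suc n ℕ.* suc n))) 0 n ℕ.z≤n

sqrtApprox² : ∀ x n → sqrtApprox x n ℚ.* sqrtApprox x n ℚ.≤ ι x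
sqrtApprox² x n = ℚ.*-cancelʳ-≤-pos (d ℚ.* d) {{ℚ.pos*pos⇒pos d {{ℚ.positive (0<ι n)}} d {{ℚ.positive (0<ι n)}}}} (begin
  A ℚ.* A ℚ.* (d ℚ.* d)       ≡⟨ eq A d ⟩
  A ℚ.* d ℚ.* (A ℚ.* d)       ≡⟨ cong₂ ℚ._*_ (sqrtApprox-* x n) (sqrtApprox-* x n) ⟩
  ι p ℚ.* ι p                 ≡⟨ ι-* p p ⟨
  ι (p ℕ.* p)                 ≤⟨ ι-mono-≤ (isqrt-lower (x ℕ.* (suc n ℕ.* suc n))) ⟩
  ι (x ℕ.* (suc n ℕ.* suc n)) ≡⟨ trans (ι-* x (suc n ℕ.* suc n)) (cong (ι x ℚ.*_) (ι-* (suc n) (suc n))) ⟩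
  ι x ℚ.* (d ℚ.* d)           ∎)
  where
  open ℚ.≤-Reasoning
  open +-*-Solver
  A d : ℚ
  A = sqrtApprox x n
  d = ι (suc n)
  p : ℕ
  p = isqrt (x ℕ.* (suc n ℕ.* suc n))
  eq : ∀ A d → A ℚ.* A ℚ.* (d ℚ.* d) ≡ A ℚ.* d ℚ.* (A ℚ.* d)
  eq = solve 2 (λ A d → A :* A :* (d :* d) := A :* d :* (A :* d)) refl

sqrtApprox-2≤2 : ∀ n → sqrtApprox 2 n ℚ.≤ ι 2
sqrtApprox-2≤2 n = ℚ.≮⇒≥ λ 2<A → contradiction (ι-cancel-≤ {4} {2} (4≤2 (ℚ.<⇒≤ 2<A))) λ { (ℕ.s≤s (ℕ.s≤s ())) }
  where
  4≤2 : ι 2 ℚ.≤ sqrtApprox 2 n → ι 4 ℚ.≤ ι 2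
  4≤2 2≤A = ℚ.≤-trans (*-monoʳ (ι 2) (0≤ι 2) 2≤A) (ℚ.≤-trans (*-monoˡ (sqrtApprox 2 n) (0≤sqrtApprox 2 n) 2≤A) (sqrtApprox² 2 n))

1≤sqrtApprox : ∀ x n → 1 ≤ x → 1ℚ ℚ.≤ sqrtApprox x n
1≤sqrtApprox x n 1≤x = /-mono-≤ 1 p 0 n (subst₂ _≤_ (sym (ℕ.*-identityˡ (suc n))) (sym (ℕ.*-identityʳ p)) (ℕ.≮⇒≥ λ p<n →
  ℕ.<⇒≱ (isqrt-upper (x ℕ.* (suc n ℕ.* suc n))) (ℕ.≤-trans (ℕ.*-mono-≤ p<n p<n)
    (ℕ.≤-trans (ℕ.≤-reflexive (sym (ℕ.*-identityˡ (suc n ℕ.* suc n)))) (ℕ.*-monoˡ-≤ (suc n ℕ.* suc n) 1≤x)))))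
  where
  p : ℕ
  p = isqrt (x ℕ.* (suc n ℕ.* suc n))

-- One parameter j controls both losses, the error of the approximation `L` of ln 2 and the slack
-- j/(j + 1), so that all errors are multiples of `u`.
module LowerBound (i : ℕ) where

  j : ℕ
  j = suc i

  threshold : ∃[ K ] ∀ k → K ≤ k → 16 ℕ.* fourth (2 ℕ.+ k) ℕ.* j ^ k ℕ.< suc j ^ k
  threshold = eventually 16 j

  L u : ℚ
  L = ln2Approx j
  u = 1/suc j

  module _ (k r : ℕ) (K≤k : proj₁ threshold ≤ suc k) (unavoidable : Unavoidable (3 ℕ.+ k) r) where

    s m F : ℕ
    s = 3 ℕ.+ k
    -- With s written as 3 + k, `triangle s` computes to 2 + m.
    m = k ℕ.+ triangle (2 ℕ.+ k)
    F = ♯codes s s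

    integral : ∃[ a ] ∃[ b ] (L ℚ.* ι (suc b) ≡ ι a) ×
      (2 ^ (suc k ℕ.+ 3) ℕ.* (j ℕ.* a ℕ.* (j ℕ.* a)) ℕ.< suc j ℕ.* suc b ℕ.* r ℕ.* (suc j ℕ.* suc b ℕ.* r))
    integral = from-fraction (fraction L (0≤ln2Approx j))
      where
      from-fraction : (∃[ a ] ∃[ b ] L ℚ.* ι (suc b) ≡ ι a) → _
      from-fraction (a , b , Lb≡a) = a , b , Lb≡a ,
        Estimate.estimate F (suc k) m r a (suc b) j {{ℕ.>-nonZero 0<a}} refl many few b≤2a (proj₂ threshold (suc k) K≤k)
        where
        many : 2 ^ m ℕ.* suc k ! ≤ (F ℕ.+ F) ℕ.* (s ℕ.* s ℕ.* r ^ suc k)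
        many = ℕ.<⇒≤ (ℕ.≰⇒> (λ h → avoidable r (suc k) m refl h unavoidable))
        few : F ℕ.* a ^ s ≤ s ! ℕ.* suc b ^ s
        few = ι-cancel-≤ (begin
          ι (F ℕ.* a ^ s)
            ≡⟨ trans (ι-* F (a ^ s)) (cong (ι F ℚ.*_) (trans (ι-^ a s) (trans (cong (_↑ s) (sym Lb≡a)) (↑-* L (ι (suc b)) s)))) ⟩
          ι F ℚ.* (L ↑ s ℚ.* ι (suc b) ↑ s)
            ≡⟨ ℚ.*-assoc (ι F) (L ↑ s) (ι (suc b) ↑ s) ⟨
          ι F ℚ.* L ↑ s ℚ.* ι (suc b) ↑ s
            ≤⟨ *-monoˡ (ι (suc b) ↑ s) (0≤↑ s (0≤ι (suc b))) (♯codes-bound L (0≤ln2Approx j) (expSum-ln2 j) s s) ⟩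
          ι (s !) ℚ.* ι (suc b) ↑ s
            ≡⟨ trans (ι-* (s !) (suc b ^ s)) (cong (ι (s !) ℚ.*_) (ι-^ (suc b) s)) ⟨
          ι (s ! ℕ.* suc b ^ s) ∎)
          where open ℚ.≤-Reasoning
        b≤2a : suc b ≤ 2 ℕ.* a
        b≤2a = ι-cancel-≤ (begin
          ι (suc b)                         ≡⟨ ℚ.*-identityˡ (ι (suc b)) ⟨
          ι 2 ℚ.* ½ ℚ.* ι (suc b)           ≡⟨ ℚ.*-assoc (ι 2) ½ (ι (suc b)) ⟩
          ι 2 ℚ.* (½ ℚ.* ι (suc b))         ≤⟨ *-monoʳ (ι 2) (0≤ι 2) (*-monoˡ (ι (suc b)) (0≤ι (suc b)) (½≤ln2Approx j)) ⟩
          ι 2 ℚ.* (L ℚ.* ι (suc b))         ≡⟨ cong (ι 2 ℚ.*_) Lb≡a ⟩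
          ι 2 ℚ.* ι a                       ≡⟨ ι-* 2 a ⟨
          ι (2 ℕ.* a)                       ∎)
          where open ℚ.≤-Reasoning
        0<a : 0 ℕ.< a
        0<a = ℕ.n≢0⇒n>0 λ { refl → contradiction b≤2a λ () }

    a b D : ℕ
    a = proj₁ integral
    b = proj₁ (proj₂ integral)
    D = suc j ℕ.* suc b

    M : ℚ
    M = L ℚ.* (ι j ℚ.* u)

    M≡ : M ℚ.* ι D ≡ ι (j ℕ.* a)
    M≡ = begin
      L ℚ.* (ι j ℚ.* u) ℚ.* ι (suc j ℕ.* suc b)
        ≡⟨ cong (L ℚ.* (ι j ℚ.* u) ℚ.*_) (ι-* (suc j) (suc b)) ⟩
      L ℚ.* (ι j ℚ.* u) ℚ.* (ι (suc j) ℚ.* ι (suc b))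
        ≡⟨ eq L (ι j) u (ι (suc j)) (ι (suc b)) ⟩
      ι j ℚ.* (L ℚ.* ι (suc b)) ℚ.* (u ℚ.* ι (suc j))
        ≡⟨ cong₂ (λ x y → ι j ℚ.* x ℚ.* y) (proj₁ (proj₂ (proj₂ integral))) (1/suc-* j) ⟩
      ι j ℚ.* ι a ℚ.* 1ℚ
        ≡⟨ trans (ℚ.*-identityʳ (ι j ℚ.* ι a)) (sym (ι-* j a)) ⟩
      ι (j ℕ.* a) ∎
      where
      open ≡-Reasoning
      open +-*-Solver
      eq : ∀ L J u c B → L ℚ.* (J ℚ.* u) ℚ.* (c ℚ.* B) ≡ J ℚ.* (L ℚ.* B) ℚ.* (u ℚ.* c)
      eq = solve 5 (λ L J u c B → L :* (J :* u) :* (c :* B) := J :* (L :* B) :* (u :* c)) refl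

    0≤u : 0ℚ ℚ.≤ u
    0≤u = 0≤1/suc j

    L≤M+2u : L ℚ.≤ M ℚ.+ ι 2 ℚ.* u
    L≤M+2u = begin
      L                                    ≡⟨ ℚ.*-identityʳ L ⟨
      L ℚ.* 1ℚ                             ≡⟨ cong (L ℚ.*_) (sym (trans (cong (u ℚ.*_) (sym (ι-+ 1 j))) (1/suc-* j))) ⟩
      L ℚ.* (u ℚ.* (1ℚ ℚ.+ ι j))           ≡⟨ eq L u (ι j) ⟩
      M ℚ.+ L ℚ.* u                        ≤⟨ ℚ.+-monoʳ-≤ M (*-monoˡ u 0≤u (ln2Approx≤2 j)) ⟩
      M ℚ.+ ι 2 ℚ.* u                      ∎
      where
      open ℚ.≤-Reasoning
      open +-*-Solver
      eq : ∀ L u J → L ℚ.* (u ℚ.* (1ℚ ℚ.+ J)) ≡ L ℚ.* (J ℚ.* u) ℚ.+ L ℚ.* u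
      eq = solve 3 (λ L u J → L :* (u :* (con 1ℚ :+ J)) := L :* (J :* u) :+ L :* u) refl

    module _ (n : ℕ) where
      A l Q : ℚ
      A = sqrtApprox 2 n
      l = ln2Approx n
      Q = sqrtApprox (2 ^ s) n

      -- The roots are approximated from below, so A² ≤ 2 and Q² ≤ 2^s. The opposite inequality,
      -- multiplied by `D` and squared, would contradict `integral`.
      AMQ<r : A ℚ.* M ℚ.* Q ℚ.< ι r
      AMQ<r = ℚ.≰⇒> λ r≤ → ℕ.<⇒≱ (proj₂ (proj₂ (proj₂ integral))) (ι-cancel-≤ (squares r≤))
        where
        open ℚ.≤-Reasoning
        open +-*-Solver
        Y : ℚ
        Y = ι (j ℕ.* a)
        eq₁ : ∀ A M Q D → A ℚ.* M ℚ.* Q ℚ.* D ≡ A ℚ.* Q ℚ.* (M ℚ.* D)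
        eq₁ = solve 4 (λ A M Q D → A :* M :* Q :* D := A :* Q :* (M :* D)) refl
        eq₂ : ∀ A Q Y → A ℚ.* Q ℚ.* Y ℚ.* (A ℚ.* Q ℚ.* Y) ≡ (A ℚ.* A) ℚ.* ((Q ℚ.* Q) ℚ.* (Y ℚ.* Y))
        eq₂ = solve 3 (λ A Q Y → A :* Q :* Y :* (A :* Q :* Y) := (A :* A) :* ((Q :* Q) :* (Y :* Y))) refl
        exponent′ : 2 ℕ.* (2 ^ s ℕ.* (j ℕ.* a ℕ.* (j ℕ.* a))) ≡ 2 ^ (suc k ℕ.+ 3) ℕ.* (j ℕ.* a ℕ.* (j ℕ.* a))
        exponent′ = trans (sym (ℕ.*-assoc 2 (2 ^ s) (j ℕ.* a ℕ.* (j ℕ.* a))))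
          (cong (λ e → 2 ^ e ℕ.* (j ℕ.* a ℕ.* (j ℕ.* a))) (ℕ.+-comm 3 (suc k)))
        0≤Y : 0ℚ ℚ.≤ Y
        0≤Y = 0≤ι (j ℕ.* a)
        squares : ι r ℚ.≤ A ℚ.* M ℚ.* Q → ι (D ℕ.* r ℕ.* (D ℕ.* r)) ℚ.≤ ι (2 ^ (suc k ℕ.+ 3) ℕ.* (j ℕ.* a ℕ.* (j ℕ.* a)))
        squares r≤ = begin
          ι (D ℕ.* r ℕ.* (D ℕ.* r))
            ≡⟨ ι-* (D ℕ.* r) (D ℕ.* r) ⟩
          ι (D ℕ.* r) ℚ.* ι (D ℕ.* r)
            ≤⟨ ℚ.≤-trans (*-monoˡ (ι (D ℕ.* r)) (0≤ι (D ℕ.* r)) Dr≤) (*-monoʳ (A ℚ.* Q ℚ.* Y)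
                 (0≤* (0≤* (0≤sqrtApprox 2 n) (0≤sqrtApprox (2 ^ s) n)) 0≤Y) Dr≤) ⟩
          A ℚ.* Q ℚ.* Y ℚ.* (A ℚ.* Q ℚ.* Y)
            ≡⟨ eq₂ A Q Y ⟩
          (A ℚ.* A) ℚ.* ((Q ℚ.* Q) ℚ.* (Y ℚ.* Y))
            ≤⟨ ℚ.≤-trans (*-monoˡ ((Q ℚ.* Q) ℚ.* (Y ℚ.* Y)) (0≤* (0≤* (0≤sqrtApprox (2 ^ s) n) (0≤sqrtApprox (2 ^ s) n)) (0≤* 0≤Y 0≤Y))
                   (sqrtApprox² 2 n))
                 (*-monoʳ (ι 2) (0≤ι 2) (*-monoˡ (Y ℚ.* Y) (0≤* 0≤Y 0≤Y) (sqrtApprox² (2 ^ s) n))) ⟩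
          ι 2 ℚ.* (ι (2 ^ s) ℚ.* (Y ℚ.* Y))
            ≡⟨ cong (λ y → ι 2 ℚ.* (ι (2 ^ s) ℚ.* y)) (ι-* (j ℕ.* a) (j ℕ.* a)) ⟨
          ι 2 ℚ.* (ι (2 ^ s) ℚ.* ι (j ℕ.* a ℕ.* (j ℕ.* a)))
            ≡⟨ cong (ι 2 ℚ.*_) (ι-* (2 ^ s) (j ℕ.* a ℕ.* (j ℕ.* a))) ⟨
          ι 2 ℚ.* ι (2 ^ s ℕ.* (j ℕ.* a ℕ.* (j ℕ.* a)))
            ≡⟨ ι-* 2 (2 ^ s ℕ.* (j ℕ.* a ℕ.* (j ℕ.* a))) ⟨
          ι (2 ℕ.* (2 ^ s ℕ.* (j ℕ.* a ℕ.* (j ℕ.* a))))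
            ≡⟨ cong ι exponent′ ⟩
          ι (2 ^ (suc k ℕ.+ 3) ℕ.* (j ℕ.* a ℕ.* (j ℕ.* a))) ∎
          where
          Dr≤ : ι (D ℕ.* r) ℚ.≤ A ℚ.* Q ℚ.* Y
          Dr≤ = begin
            ι (D ℕ.* r)                     ≡⟨ trans (ι-* D r) (ℚ.*-comm (ι D) (ι r)) ⟩
            ι r ℚ.* ι D                     ≤⟨ *-monoˡ (ι D) (0≤ι D) r≤ ⟩
            A ℚ.* M ℚ.* Q ℚ.* ι D           ≡⟨ eq₁ A M Q (ι D) ⟩
            A ℚ.* Q ℚ.* (M ℚ.* ι D)         ≡⟨ cong (A ℚ.* Q ℚ.*_) M≡ ⟩
            A ℚ.* Q ℚ.* Y                   ∎

      gap : (A ℚ.* l ℚ.- ι 7 ℚ.* u) ℚ.* Q ℚ.+ u ℚ.< ι r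
      gap = ℚ.≤-<-trans (begin
        (A ℚ.* l ℚ.- ι 7 ℚ.* u) ℚ.* Q ℚ.+ u
          ≤⟨ ℚ.+-monoˡ-≤ u (*-monoˡ Q 0≤Q (ℚ.+-monoˡ-≤ (ℚ.- (ι 7 ℚ.* u)) Al≤)) ⟩
        (A ℚ.* M ℚ.+ ι 6 ℚ.* u ℚ.- ι 7 ℚ.* u) ℚ.* Q ℚ.+ u
          ≡⟨ eq₁ (A ℚ.* M) u Q ⟩
        A ℚ.* M ℚ.* Q ℚ.+ (u ℚ.* 1ℚ ℚ.- u ℚ.* Q)
          -- Since Q ≥ 1, the term u·Q pays for the gap `u`, which `<ℝ` requires uniformly in n.
          ≤⟨ ℚ.+-monoʳ-≤ (A ℚ.* M ℚ.* Q) (ℚ.+-monoˡ-≤ (ℚ.- (u ℚ.* Q)) (*-monoʳ u 0≤u (1≤sqrtApprox (2 ^ s) n (ℕ.m^n>0 2 s)))) ⟩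
        A ℚ.* M ℚ.* Q ℚ.+ (u ℚ.* Q ℚ.- u ℚ.* Q)
          ≡⟨ eq₂ (A ℚ.* M ℚ.* Q) (u ℚ.* Q) ⟩
        A ℚ.* M ℚ.* Q ∎) AMQ<r
        where
        open ℚ.≤-Reasoning
        open +-*-Solver
        0≤Q : 0ℚ ℚ.≤ Q
        0≤Q = 0≤sqrtApprox (2 ^ s) n
        eq₁ : ∀ x u Q → (x ℚ.+ ι 6 ℚ.* u ℚ.- ι 7 ℚ.* u) ℚ.* Q ℚ.+ u ≡ x ℚ.* Q ℚ.+ (u ℚ.* 1ℚ ℚ.- u ℚ.* Q)
        eq₁ = solve 3 (λ x u Q → (x :+ con (ι 6) :* u :- con (ι 7) :* u) :* Q :+ u := x :* Q :+ (u :* con 1ℚ :- u :* Q)) refl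
        eq₂ : ∀ x y → x ℚ.+ (y ℚ.- y) ≡ x
        eq₂ = solve 2 (λ x y → x :+ (y :- y) := x) refl
        eq₃ : ∀ M u → (M ℚ.+ ι 2 ℚ.* u) ℚ.+ u ≡ M ℚ.+ ι 3 ℚ.* u
        eq₃ = solve 2 (λ M u → (M :+ con (ι 2) :* u) :+ u := M :+ con (ι 3) :* u) refl
        eq₄ : ∀ A M u → A ℚ.* (M ℚ.+ ι 3 ℚ.* u) ≡ A ℚ.* M ℚ.+ A ℚ.* (ι 3 ℚ.* u)
        eq₄ = solve 3 (λ A M u → A :* (M :+ con (ι 3) :* u) := A :* M :+ A :* (con (ι 3) :* u)) refl
        Al≤ : A ℚ.* l ℚ.≤ A ℚ.* M ℚ.+ ι 6 ℚ.* u
        Al≤ = begin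
          A ℚ.* l
            ≤⟨ *-monoʳ A (0≤sqrtApprox 2 n) (ℚ.≤-trans (ln2Approx-rate n j) (ℚ.+-monoˡ-≤ u L≤M+2u)) ⟩
          A ℚ.* ((M ℚ.+ ι 2 ℚ.* u) ℚ.+ u)
            ≡⟨ trans (cong (A ℚ.*_) (eq₃ M u)) (eq₄ A M u) ⟩
          A ℚ.* M ℚ.+ A ℚ.* (ι 3 ℚ.* u)
            ≤⟨ ℚ.+-monoʳ-≤ (A ℚ.* M) (*-monoˡ (ι 3 ℚ.* u) (0≤* (0≤ι 3) 0≤u) (sqrtApprox-2≤2 n)) ⟩
          A ℚ.* M ℚ.+ ι 2 ℚ.* (ι 3 ℚ.* u)
            ≡⟨ cong (A ℚ.* M ℚ.+_) (sym (ℚ.*-assoc (ι 2) (ι 3) u)) ⟩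
          A ℚ.* M ℚ.+ ι 6 ℚ.* u ∎

    lower-bound : ((√ 2) *ℝ ln2 -ℝ fromℚ (ι 7 ℚ.* u)) *ℝ (√ (2 ^ s)) <ℝ fromℕ r
    lower-bound = u , ℚ.<-≤-trans (ℚ.positive⁻¹ (1/suc j) {{ℚ.normalize-pos 1 (suc j)}}) ℚ.≤-refl , 0 , λ n _ → gap n

-- The largest i ≤ s whose threshold has been passed: it tends to infinity
-- whatever the thresholds are.
module Diagonal (θ : ℕ → ℕ) where

  search : ℕ → ℕ → ℕ
  search s zero    = 0
  search s (suc i) with θ (suc i) ℕ.≤? s
  ... | yes _ = suc i
  ... | no  _ = search s i

  level : ℕ → ℕ
  level s = search s s

  search-passed : ∀ s i → θ 0 ≤ s → θ (search s i) ≤ s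
  search-passed s zero    h = h
  search-passed s (suc i) h with θ (suc i) ℕ.≤? s
  ... | yes p = p
  ... | no  _ = search-passed s i h

  search-large : ∀ s i l → l ≤ i → θ l ≤ s → l ≤ search s i
  search-large s zero    l l≤0 _ = l≤0
  search-large s (suc i) l l≤i h with θ (suc i) ℕ.≤? s
  ... | yes _ = l≤i
  ... | no ¬p = search-large s i l (ℕ.s≤s⁻¹ (ℕ.≤∧≢⇒< l≤i λ { refl → ¬p h })) h

-- The added 6 secures the orders from which the upper bound holds, and after the shift s = 6 + k
-- the threshold is still at most k.
θ : ℕ → ℕ
θ i = 6 ℕ.+ proj₁ (LowerBound.threshold i)

open Diagonal θ

-- ln 2 ≤ M + 3u and √2 ≤ 2 account for 6u; the seventh u leaves a strict gap.
error : ℕ → ℝ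
error s = fromℚ (ι 7 ℚ.* 1/suc (suc (level s)))

error→0 : TendsToZero error
error→0 δ 0<δ = N ℕ.⊔ θ N , λ s S≤s → ½ ℚ.* δ , ½-pos 0<δ , 0 , λ _ _ →
  subst₂ (λ x y → x ℚ.+ ½ ℚ.* δ ℚ.< y) (sym (ℚ.0≤p⇒∣p∣≡p (0≤* (0≤ι 7) (0≤1/suc (suc (level s)))))) (½+½ δ)
    (ℚ.+-monoˡ-< (½ ℚ.* δ) (ℚ.≤-<-trans
      (*-monoʳ (ι 7) (0≤ι 7) (1/suc-anti N (suc (level s)) (ℕ.≤-trans (search-large s s N
        (ℕ.m⊔n≤o⇒m≤o N (θ N) S≤s) (ℕ.m⊔n≤o⇒n≤o N (θ N) S≤s)) (ℕ.n≤1+n _)))) small))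
  where
  -- Making 7/(N + 1) smaller than δ/2 leaves δ/2 as the gap required by `<ℝ`.
  0<δ/14 : 0ℚ ℚ.< 1/suc 6 ℚ.* (½ ℚ.* δ)
  0<δ/14 = subst (ℚ._< 1/suc 6 ℚ.* (½ ℚ.* δ)) (ℚ.*-zeroʳ (1/suc 6)) (ℚ.*-monoʳ-<-pos (1/suc 6) (½-pos 0<δ))
  N : ℕ
  N = proj₁ (archimedean (1/suc 6 ℚ.* (½ ℚ.* δ)) 0<δ/14)
  small : ι 7 ℚ.* 1/suc N ℚ.< ½ ℚ.* δ
  small = subst (ι 7 ℚ.* 1/suc N ℚ.<_) (trans (sym (ℚ.*-assoc (ι 7) (1/suc 6) (½ ℚ.* δ))) (ℚ.*-identityˡ (½ ℚ.* δ)))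
    (ℚ.*-monoʳ-<-pos (ι 7) (proj₂ (archimedean (1/suc 6 ℚ.* (½ ℚ.* δ)) 0<δ/14)))

theorem1p2 : Σ[ ε ∈ (ℕ → ℝ) ] TendsToZero ε ×
    (∃[ S ] ∀ (s : ℕ) → S ≤ s →
    ∃[ r ] IsR'₂ s r ×
    ((√ 2) *ℝ ln2 -ℝ ε s) *ℝ (√ (2 ^ s)) <ℝ fromℕ r ×
    (+ r) ℤ.≤ ceiling ((+ 13 ℚ./ 48) ℚ.* (+ (2 ^ s) ℚ./ 1)))
theorem1p2 = error , error→0 , θ 0 , bounds
  where
  bounds : ∀ s → θ 0 ≤ s → ∃[ r ] IsR'₂ s r × ((√ 2) *ℝ ln2 -ℝ error s) *ℝ (√ (2 ^ s)) <ℝ fromℕ r ×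
    (+ r) ℤ.≤ ceiling ((+ 13 ℚ./ 48) ℚ.* (+ (2 ^ s) ℚ./ 1))
  bounds s θ≤s = subst (λ s → θ (level s) ≤ s → ∃[ r ] IsR'₂ s r × ((√ 2) *ℝ ln2 -ℝ error s) *ℝ (√ (2 ^ s)) <ℝ fromℕ r ×
      (+ r) ℤ.≤ ceiling ((+ 13 ℚ./ 48) ℚ.* (+ (2 ^ s) ℚ./ 1)))
    (ℕ.m+[n∸m]≡n (ℕ.m+n≤o⇒m≤o 6 θ≤s)) (shifted (s ℕ.∸ 6)) (search-passed s s θ≤s)
    where
    shifted : ∀ k → θ (level (6 ℕ.+ k)) ≤ 6 ℕ.+ k → ∃[ r ] IsR'₂ (6 ℕ.+ k) r ×
      ((√ 2) *ℝ ln2 -ℝ error (6 ℕ.+ k)) *ℝ (√ (2 ^ (6 ℕ.+ k))) <ℝ fromℕ r ×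
      (+ r) ℤ.≤ ceiling ((+ 13 ℚ./ 48) ℚ.* (+ (2 ^ (6 ℕ.+ k)) ℚ./ 1))
    shifted k θ≤ = let (r , min , upper) = r′₂-upper k in r , min ,
      LowerBound.lower-bound (level (6 ℕ.+ k)) (3 ℕ.+ k) r (ℕ.≤-trans (ℕ.+-cancelˡ-≤ 6 _ k θ≤) (ℕ.m≤n+m k 4)) (proj₁ min) , upper
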